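{- Let $t$ be a positive integer. The existence of the following are equivalent: (a) a symmetric Seidel matrix with characteristic polynomial $(x^2-4t-1)^{2t+1}$; (b) a symmetric Seidel matrix with characteristic polynomial $x(x^2-4t-1)^{2t}$; (c) a symmetric Seidel matrix with characteristic polynomial $(x^2-1)(x^2-4t-1)^{2t-1}$; (d) a symmetric Seidel matrix with characteristic polynomial $(x-2)(x+1)^2(x^2-4t-1)^{2(t-1)}$.
   Context: A Seidel matrix is a square $\{0,\pm1\}$-matrix $S$ with zero diagonal, all off-diagonal entries nonzero, and $S=\pm S^\top$; it is symmetric if $S^\top=S$. The characteristic polynomial of $S$ is $\det(xI-S)$. -}

module Defs where

open import Data.Nat using (ℕ; zero; suc; _≤_; _∸_) renaming (_+_ to _+ℕ_; _*_ to _*ℕ_)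
open import Data.Integer using (ℤ; +_; -_; _+_; _*_; -[1+_])
open import Data.Fin using (Fin; zero; suc; punchIn; _≟_)
open import Data.List using (List; []; _∷_)
open import Data.Product using (Σ; ∃; _×_; _,_)
open import Data.Sum using (_⊎_)
open import Relation.Nullary using (¬_; yes; no)
open import Relation.Binary.PropositionalEquality using (_≡_)

-- Polynomials over ℤ as coefficient lists, lowest degree first.

Poly : Set
Poly = List ℤ

infixl 6 _+ₚ_
infixl 7 _*ₚ_

_+ₚ_ : Poly → Poly → Poly
[]      +ₚ q       = q
(a ∷ p) +ₚ []      = a ∷ p
(a ∷ p) +ₚ (b ∷ q) = (a + b) ∷ (p +ₚ q)

scaleₚ : ℤ → Poly → Poly
scaleₚ c []      = []
scaleₚ c (a ∷ p) = (c * a) ∷ scaleₚ c p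

negₚ : Poly → Poly
negₚ = scaleₚ (- (+ 1))

_*ₚ_ : Poly → Poly → Poly
[]      *ₚ q = []
(a ∷ p) *ₚ q = scaleₚ a q +ₚ ((+ 0) ∷ (p *ₚ q))

constₚ : ℤ → Poly
constₚ c = c ∷ []

Xₚ : Poly
Xₚ = (+ 0) ∷ (+ 1) ∷ []

_^ₚ_ : Poly → ℕ → Poly
p ^ₚ zero  = constₚ (+ 1)
p ^ₚ suc k = p *ₚ (p ^ₚ k)

coeff : Poly → ℕ → ℤ
coeff []      n       = + 0
coeff (a ∷ p) zero    = a
coeff (a ∷ p) (suc n) = coeff p n

-- equality of polynomials (coefficientwise; insensitive to trailing zeros)
infix 4 _≈ₚ_
_≈ₚ_ : Poly → Poly → Set
p ≈ₚ q = ∀ n → coeff p n ≡ coeff q n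

Matrix : Set → ℕ → Set
Matrix A n = Fin n → Fin n → A

alt : ℕ → Poly → Poly
alt zero    p = p
alt (suc k) p = negₚ (alt k p)

sumFin : (k : ℕ) → (Fin k → Poly) → Poly
sumFin zero    f = []
sumFin (suc k) f = f zero +ₚ sumFin k (λ j → f (suc j))

minor : ∀ {n} → Fin (suc n) → Matrix Poly (suc n) → Matrix Poly n
minor j M i k = M (suc i) (punchIn j k)

det : (n : ℕ) → Matrix Poly n → Poly
det zero    M = constₚ (+ 1)
det (suc n) M =
  sumFin (suc n) (λ j → alt (Data.Fin.toℕ j) (M zero j *ₚ det n (minor j M)))

charPoly : (n : ℕ) → Matrix ℤ n → Poly
charPoly n S = det n (λ i j → entry i j)
  where
  entry : Fin n → Fin n → Poly
  entry i j with i ≟ j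
  ... | yes _ = Xₚ +ₚ constₚ (- S i j)
  ... | no  _ = constₚ (- S i j)

IsSymmetricSeidel : (n : ℕ) → Matrix ℤ n → Set
IsSymmetricSeidel n S =
  (∀ i → S i i ≡ + 0) ×
  (∀ i j → ¬ (i ≡ j) → (S i j ≡ + 1) ⊎ (S i j ≡ - (+ 1))) ×
  (∀ i j → S i j ≡ S j i)

HasSymSeidelWithCharPoly : Poly → Set
HasSymSeidelWithCharPoly p =
  Σ ℕ λ n → Σ (Matrix ℤ n) λ S → IsSymmetricSeidel n S × (charPoly n S ≈ₚ p)

q : ℕ → Poly
q t = (Xₚ *ₚ Xₚ) +ₚ constₚ (- (+ (4 *ℕ t +ℕ 1)))

polyA polyB polyC polyD : ℕ → Poly
polyA t = q t ^ₚ (2 *ℕ t +ℕ 1)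
polyB t = Xₚ *ₚ (q t ^ₚ (2 *ℕ t))
polyC t = ((Xₚ *ₚ Xₚ) +ₚ constₚ (- (+ 1))) *ₚ (q t ^ₚ (2 *ℕ t ∸ 1))
polyD t = (Xₚ +ₚ constₚ (- (+ 2))) *ₚ ((Xₚ +ₚ constₚ (+ 1)) ^ₚ 2)
            *ₚ (q t ^ₚ (2 *ℕ (t ∸ 1)))

{-# OPTIONS --safe #-}
module Submission where

-- Write m = 4t + 1 and Q = x² - m. The implications (a) ⇒ (b) ⇒ (c) ⇒ (d) delete one row and column at
-- a time. By Cayley–Hamilton and symmetry, S satisfies the squarefree polynomial with the given roots,
-- so M = m I - S² is killed by a polynomial g(S) of degree at most two, and x I - S has an explicit
-- resolvent built from S, M and K = M S. Comparing it with the adjugate gives the characteristic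
-- polynomial of S with its first row and column deleted in terms of M₀₀ and K₀₀, and, through
-- p′ = tr adj, the order of S and tr K. In case (c), K₀₀ = ±2 by a bound on row norms and a parity
-- count; the sign is adjusted by replacing S by - S.
--
-- For (d) ⇒ (a), 3 M is the sum of Y = (S + I) M and Z = (2 I - S) M, which are multiples of
-- orthogonal projections of ranks 1 and 2. Integrality forces Y = s sᵀ with entries of s in {±1, ±3},
-- and the rows of Z at the entries ±1 of s to lie along three directions at mutual angle 120°. This
-- yields M = u₁u₁ᵀ + u₂u₂ᵀ + u₃u₃ᵀ with sign vectors uᵢ, which border S to a symmetric matrix of square
-- m I; the determinant relations of the first part, read backwards, give its characteristic polynomial.

open import Algebra.Bundles using (CommutativeRing)
import Algebra.Properties.Ring as RingProperties
import Algebra.Properties.Semiring.Sum as SemiringSum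
import Algebra.Solver.Ring as RingSolver
open import Algebra.Solver.Ring.AlmostCommutativeRing
  using (AlmostCommutativeRing; fromCommutativeRing; _-Raw-AlmostCommutative⟶_)
import Algebra.Solver.Ring.NaturalCoefficients.Default as NatSolver
open import Algebra.Structures using (IsCommutativeRing)
open import Data.Empty using (⊥-elim)
open import Data.Fin as Fin using (Fin; zero; suc; toℕ; punchIn)
open import Data.Fin.Properties using (any?; suc-injective)
open import Data.Integer as ℤ using (ℤ; +_; -[1+_]; +≤+)
import Data.Integer.Properties as ℤₚ
open import Data.Integer.Tactic.RingSolver using (solve-∀)
open import Data.List using ([]; _∷_)
open import Data.Maybe using (Maybe; just; nothing)
open import Data.Nat as ℕ using (ℕ; zero; suc; z≤n; s≤s)
import Data.Nat.Properties as ℕₚ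
open import Data.Product using (∃; _×_; _,_; proj₁; proj₂)
open import Data.Sum using (_⊎_; inj₁; inj₂; [_,_]′)
open import Data.Unit using (⊤)
open import Data.Vec.Functional using (updateAt; tail)
open import Data.Vec.Functional.Properties using (updateAt-updates; updateAt-minimal; map-updateAt)
open import Function using (_∘_; const)
open import Function.Bundles using (_⇔_; mk⇔)
open import Level using (0ℓ; Lift)
import Relation.Binary.Reasoning.Setoid as SetoidReasoning
open import Relation.Binary.PropositionalEquality as ≡ using (_≡_; _≢_; module ≡-Reasoning)
open import Relation.Nullary using (Dec; yes; no)

-- √m need not be an integer, so no eigenvalue is ever taken and every spectral fact is an identity
-- over ℤ. Diagonalisability is replaced by the vanishing of |v r(S)ᵏ|², ranks of projections by
-- traces, and interlacing by the exact (0,0) entry of the adjugate. That entry gives one equation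
-- between the characteristic polynomials before and after a deletion, with cancellable factors on
-- both sides; it can be solved for either of them, so the same equation serves deletion and
-- bordering.
--
-- The constants of (d) are explained by its target. Let a symmetric matrix of square m I have a 3 ×
-- 3 corner I - J, the block S opposite to it, and let U be the block with columns u₁, u₂, u₃. The
-- blocks of the square give M = U Uᵀ and S U = U (J - I). As J - I has eigenvalues 2, -1, -1, these
-- appear on the span of the uᵢ, and s should be u₁ + u₂ + u₃. The obstacle is to recover the single
-- uᵢ: eigenspaces only determine their sum and the plane spanned by their differences. Congruences
-- modulo 8 and 6 combined with trace counts leave so few values that the three directions in that
-- plane become visible.

module Determinant {c ℓ} (R : CommutativeRing c ℓ) where
  open CommutativeRing R hiding (zero)
  open SetoidReasoning setoid
  private module Sum = SemiringSum semiring
  open RingProperties ring using (-‿distribˡ-*; -‿distribʳ-*; -0#≈0#; -‿+-comm; -‿involutive)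
  open NatSolver commutativeSemiring using (solve; _:+_; _:*_; _:=_)

  -- Finite sums, Laplace expansion and the adjugate over a commutative ring.

  Mat : ℕ → ℕ → Set c
  Mat m n = Fin m → Fin n → Carrier

  δ : ∀ {n} → Mat n n
  δ zero    zero    = 1#
  δ zero    (suc j) = 0#
  δ (suc i) zero    = 0#
  δ (suc i) (suc j) = δ i j

  δ-refl : ∀ {n} (i : Fin n) → δ i i ≡ 1#
  δ-refl zero    = ≡.refl
  δ-refl (suc i) = δ-refl i

  δ-≢ : ∀ {n} {i j : Fin n} → i ≢ j → δ i j ≡ 0#
  δ-≢ {i = zero}  {zero}  ne = ⊥-elim (ne ≡.refl)
  δ-≢ {i = zero}  {suc j} ne = ≡.refl
  δ-≢ {i = suc i} {zero}  ne = ≡.refl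
  δ-≢ {i = suc i} {suc j} ne = δ-≢ (ne ∘ ≡.cong suc)

  δ-sym : ∀ {n} (i j : Fin n) → δ i j ≡ δ j i
  δ-sym zero    zero    = ≡.refl
  δ-sym zero    (suc j) = ≡.refl
  δ-sym (suc i) zero    = ≡.refl
  δ-sym (suc i) (suc j) = δ-sym i j

  -- Opaque, so that unification does not unfold a sum over Fin (suc n).
  opaque
    ∑ : ∀ {n} → (Fin n → Carrier) → Carrier
    ∑ = Sum.sum

    ∑-[] : (f : Fin 0 → Carrier) → ∑ f ≈ 0#
    ∑-[] f = refl

    ∑-∷ : ∀ {n} (f : Fin (suc n) → Carrier) → ∑ f ≈ f zero + ∑ (λ i → f (suc i))
    ∑-∷ f = refl

    ∑-cong : ∀ {n} {f g : Fin n → Carrier} → (∀ i → f i ≈ g i) → ∑ f ≈ ∑ g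
    ∑-cong = Sum.sum-cong-≋

    ∑-0 : ∀ {n} {f : Fin n → Carrier} → (∀ i → f i ≈ 0#) → ∑ f ≈ 0#
    ∑-0 {n} e = trans (∑-cong e) (Sum.sum-replicate-zero n)

    ∑-+ : ∀ {n} (f g : Fin n → Carrier) → ∑ (λ i → f i + g i) ≈ ∑ f + ∑ g
    ∑-+ = Sum.∑-distrib-+

    ∑-comm : ∀ {m n} (f : Fin m → Fin n → Carrier) →
      ∑ (λ i → ∑ (λ j → f i j)) ≈ ∑ (λ j → ∑ (λ i → f i j))
    ∑-comm = Sum.∑-comm

    *-∑ : ∀ {n} x (f : Fin n → Carrier) → x * ∑ f ≈ ∑ (λ i → x * f i)
    *-∑ = Sum.*-distribˡ-sum

    ∑-* : ∀ {n} x (f : Fin n → Carrier) → ∑ f * x ≈ ∑ (λ i → f i * x)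
    ∑-* = Sum.*-distribʳ-sum

  ∑-δˡ : ∀ {n} (i : Fin n) (f : Fin n → Carrier) → ∑ (λ k → δ i k * f k) ≈ f i
  ∑-δˡ zero    f = trans (∑-∷ _) (trans (+-cong (*-identityˡ _) (∑-0 λ k → zeroˡ _)) (+-identityʳ _))
  ∑-δˡ (suc i) f = trans (∑-∷ _) (trans (+-cong (zeroˡ _) (∑-δˡ i (λ k → f (suc k)))) (+-identityˡ _))

  ∑-δʳ : ∀ {n} (i : Fin n) (f : Fin n → Carrier) → ∑ (λ k → f k * δ k i) ≈ f i
  ∑-δʳ i f = trans (∑-cong λ k → trans (*-comm _ _) (*-congʳ (reflexive (δ-sym k i)))) (∑-δˡ i f)

  ∑-linear : ∀ {n} a b (f g : Fin n → Carrier) →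
    ∑ (λ i → a * f i + b * g i) ≈ a * ∑ f + b * ∑ g
  ∑-linear a b f g = trans (∑-+ (λ i → a * f i) (λ i → b * g i))
    (+-cong (sym (*-∑ a f)) (sym (*-∑ b g)))

  ∑-assoc : ∀ {m n} (a : Fin m → Carrier) (b : Mat m n) (c : Fin n → Carrier) →
    ∑ (λ k → ∑ (λ l → a l * b l k) * c k) ≈ ∑ (λ l → a l * ∑ (λ k → b l k * c k))
  ∑-assoc a b c = begin
    ∑ (λ k → ∑ (λ l → a l * b l k) * c k)      ≈⟨ (∑-cong λ k → ∑-* (c k) (λ l → a l * b l k)) ⟩
    ∑ (λ k → ∑ (λ l → a l * b l k * c k))      ≈⟨ ∑-comm (λ k l → a l * b l k * c k) ⟩
    ∑ (λ l → ∑ (λ k → a l * b l k * c k))      ≈⟨ (∑-cong λ l → ∑-cong λ k → *-assoc (a l) (b l k) (c k)) ⟩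
    ∑ (λ l → ∑ (λ k → a l * (b l k * c k)))    ≈⟨ (∑-cong λ l → *-∑ (a l) (λ k → b l k * c k)) ⟨
    ∑ (λ l → a l * ∑ (λ k → b l k * c k))      ∎

  sgn : ℕ → Carrier → Carrier
  sgn zero    x = x
  sgn (suc k) x = - sgn k x

  sgn-cong : ∀ k {x y} → x ≈ y → sgn k x ≈ sgn k y
  sgn-cong zero    e = e
  sgn-cong (suc k) e = -‿cong (sgn-cong k e)

  sgn-even : ∀ k x → sgn (2 ℕ.* k) x ≈ x
  sgn-even zero    x = refl
  sgn-even (suc k) x = trans
    (reflexive (≡.cong (λ l → sgn (suc l) x) (ℕₚ.+-suc k (k ℕ.+ 0))))
    (trans (-‿involutive _) (sgn-even k x))

  ε : ℕ → Carrier
  ε k = sgn k 1#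

  sgn-ε : ∀ k x → sgn k x ≈ ε k * x
  sgn-ε zero    x = sym (*-identityˡ x)
  sgn-ε (suc k) x = trans (-‿cong (sgn-ε k x)) (-‿distribˡ-* (ε k) x)

  minor : ∀ {m n} → Fin (suc n) → Mat (suc m) (suc n) → Mat m n
  minor j M r k = M (suc r) (punchIn j k)

  det : ∀ {n} → Mat n n → Carrier
  det {zero}  M = 1#
  det {suc n} M = ∑ (λ j → sgn (toℕ j) (M zero j * det (minor j M)))

  det-cong : ∀ {n} {M N : Mat n n} → (∀ i j → M i j ≈ N i j) → det M ≈ det N
  det-cong {zero}  e = refl
  det-cong {suc n} e = ∑-cong λ j → sgn-cong (toℕ j)
    (*-cong (e zero j) (det-cong λ r k → e (suc r) (punchIn j k)))

  det-ε : ∀ {n} (M : Mat (suc n) (suc n)) →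
    det M ≈ ∑ (λ j → ε (toℕ j) * (M zero j * det (minor j M)))
  det-ε M = ∑-cong λ j → sgn-ε (toℕ j) _

  det-row-linear : ∀ {n} (i : Fin n) a b (M N P : Mat n n) →
    (∀ r k → r ≢ i → M r k ≈ N r k) → (∀ r k → r ≢ i → M r k ≈ P r k) →
    (∀ k → M i k ≈ a * N i k + b * P i k) → det M ≈ a * det N + b * det P
  det-row-linear {suc n} zero a b M N P eN eP e = begin
    det M
      ≈⟨ det-ε M ⟩
    ∑ (λ j → ε (toℕ j) * (M zero j * det (minor j M)))
      ≈⟨ (∑-cong λ j → trans (*-congˡ (*-congʳ (e j)))
           (trans (solve 6 (λ ε a b x y d → ε :* ((a :* x :+ b :* y) :* d)
                             := a :* (ε :* (x :* d)) :+ b :* (ε :* (y :* d))) refl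
                     (ε (toℕ j)) a b (N zero j) (P zero j) (det (minor j M)))
             (+-cong (*-congˡ (*-congˡ (*-congˡ (det-cong λ r k → eN (suc r) (punchIn j k) λ ()))))
                     (*-congˡ (*-congˡ (*-congˡ (det-cong λ r k → eP (suc r) (punchIn j k) λ ()))))))) ⟩
    ∑ (λ j → a * (ε (toℕ j) * (N zero j * det (minor j N))) + b * (ε (toℕ j) * (P zero j * det (minor j P))))
      ≈⟨ ∑-linear a b (λ j → ε (toℕ j) * (N zero j * det (minor j N))) _ ⟩
    _ ≈⟨ +-cong (*-congˡ (det-ε N)) (*-congˡ (det-ε P)) ⟨
    a * det N + b * det P ∎
  det-row-linear {suc n} (suc i) a b M N P eN eP e = begin
    det M
      ≈⟨ det-ε M ⟩
    ∑ (λ j → ε (toℕ j) * (M zero j * det (minor j M)))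
      ≈⟨ (∑-cong λ j → trans (*-congˡ (*-congˡ
           (det-row-linear i a b (minor j M) (minor j N) (minor j P)
             (λ r k ne → eN (suc r) (punchIn j k) (ne ∘ suc-injective))
             (λ r k ne → eP (suc r) (punchIn j k) (ne ∘ suc-injective))
             (λ k → e (punchIn j k)))))
           (trans (solve 6 (λ ε x a b d e → ε :* (x :* (a :* d :+ b :* e))
                             := a :* (ε :* (x :* d)) :+ b :* (ε :* (x :* e))) refl
                     (ε (toℕ j)) (M zero j) a b (det (minor j N)) (det (minor j P)))
             (+-cong (*-congˡ (*-congˡ (*-congʳ (eN zero j λ ()))))
                     (*-congˡ (*-congˡ (*-congʳ (eP zero j λ ()))))))) ⟩
    ∑ (λ j → a * (ε (toℕ j) * (N zero j * det (minor j N))) + b * (ε (toℕ j) * (P zero j * det (minor j P))))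
      ≈⟨ ∑-linear a b (λ j → ε (toℕ j) * (N zero j * det (minor j N))) _ ⟩
    _ ≈⟨ +-cong (*-congˡ (det-ε N)) (*-congˡ (det-ε P)) ⟨
    a * det N + b * det P ∎

  -- Expansion along the first two rows. Column pairs are indexed by (j , punchIn j k); the two
  -- orderings of an unordered pair of columns carry opposite signs and the same complementary minor.
  twoRow : ∀ {n} (a b : Fin (suc n) → Carrier) (D : Fin (suc n) → Fin n → Carrier) → Carrier
  twoRow a b D = ∑ λ j → ∑ λ k → ε (toℕ j) * ε (toℕ k) * (a j * b (punchIn j k) * D j k)

  -- The part of `twoRow` in which the column of `a` lies to the left of the column of `b`. It reads
  -- `D j k` only for k ≥ j.
  ascending : ∀ {n} (a b : Fin (suc n) → Carrier) (D : Fin (suc n) → Fin n → Carrier) → Carrier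
  ascending {zero}  a b D = 0#
  ascending {suc n} a b D = ∑ (λ k → ε (toℕ k) * (a zero * b (suc k) * D zero k))
    + ascending (tail a) (tail b) (λ j k → D (suc j) (suc k))

  -- `(zero , k)` and `(suc k , zero)` index the same pair of columns {0, k + 1}; pairs that avoid
  -- column 0 are left to the recursion.
  Symmetric : ∀ {n} → (Fin (suc n) → Fin n → Carrier) → Set ℓ
  Symmetric {zero}  D = Lift _ ⊤
  Symmetric {suc n} D = (∀ k → D zero k ≈ D (suc k) zero) × Symmetric (λ j k → D (suc j) (suc k))

  -- Splitting off column 0: the index `(suc j , zero)` carries the sign of `(zero , j)` negated,
  -- and for two columns beyond 0 both signs flip, so that they cancel.
  twoRow-ascending : ∀ {n} (a b : Fin (suc n) → Carrier) D → Symmetric D →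
    twoRow a b D ≈ ascending a b D - ascending b a D
  twoRow-ascending {zero}  a b D _ = begin
    twoRow a b D  ≈⟨ ∑-0 (λ j → ∑-[] _) ⟩
    0#         ≈⟨ +-identityˡ 0# ⟨
    0# + 0#    ≈⟨ +-congˡ -0#≈0# ⟨
    0# + - 0#  ∎
  twoRow-ascending {suc n} a b D (s , s′) = begin
    twoRow a b D
      ≈⟨ ∑-∷ _ ⟩
    _ ≈⟨ +-cong (∑-cong λ k → *-congʳ (*-identityˡ _))
          (trans (∑-cong λ j → trans (∑-∷ _) (+-cong (lower j)
                                        (∑-cong λ k → *-congʳ (neg-neg (ε (toℕ j)) (ε (toℕ k))))))
                 (∑-+ (λ j → - 1# * (ε (toℕ j) * (b zero * a (suc j) * D zero j))) _)) ⟩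
    p + (∑ (λ j → - 1# * (ε (toℕ j) * (b zero * a (suc j) * D zero j))) + rest)
      ≈⟨ +-congˡ (+-cong (sym (*-∑ (- 1#) (λ j → ε (toℕ j) * (b zero * a (suc j) * D zero j))))
                         (twoRow-ascending (tail a) (tail b) _ s′)) ⟩
    p + (- 1# * r + (p′ + - r′))
      ≈⟨ +-congˡ (+-congʳ (trans (sym (-‿distribˡ-* 1# r)) (-‿cong (*-identityˡ r)))) ⟩
    p + (- r + (p′ + - r′))
      ≈⟨ solve 4 (λ p r p′ r′ → p :+ (r :+ (p′ :+ r′)) := (p :+ p′) :+ (r :+ r′)) refl p (- r) p′ (- r′) ⟩
    (p + p′) + (- r + - r′)
      ≈⟨ +-congˡ (-‿+-comm r r′) ⟩
    (p + p′) - (r + r′) ∎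
    where
    D′ = λ j k → D (suc j) (suc k)
    p = ∑ (λ k → ε (toℕ k) * (a zero * b (suc k) * D zero k))
    r = ∑ (λ k → ε (toℕ k) * (b zero * a (suc k) * D zero k))
    p′ = ascending (tail a) (tail b) D′
    r′ = ascending (tail b) (tail a) D′
    rest = twoRow (tail a) (tail b) D′
    lower : ∀ j → - ε (toℕ j) * 1# * (a (suc j) * b zero * D (suc j) zero)
                ≈ - 1# * (ε (toℕ j) * (b zero * a (suc j) * D zero j))
    lower j = begin
      - ε (toℕ j) * 1# * (a (suc j) * b zero * D (suc j) zero)
        ≈⟨ *-cong (trans (*-identityʳ _) (-‿cong (sym (*-identityˡ _)))) (*-cong (*-comm _ _) (sym (s j))) ⟩
      - (1# * ε (toℕ j)) * (b zero * a (suc j) * D zero j)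
        ≈⟨ *-congʳ (-‿distribˡ-* _ _) ⟩
      - 1# * ε (toℕ j) * (b zero * a (suc j) * D zero j)
        ≈⟨ *-assoc _ _ _ ⟩
      _ ∎
    neg-neg : ∀ x y → - x * - y ≈ x * y
    neg-neg x y = trans (sym (-‿distribˡ-* x (- y)))
      (trans (-‿cong (sym (-‿distribʳ-* x y))) (-‿involutive _))

  -- Both orders of a pair of deleted columns leave the same increasing list of columns. An
  -- arbitrary extensional `f` of that list stands in for the complementary minor, so that the
  -- induction can put column 0 in front by `lift`.
  punchIn-symmetric : ∀ {n} (f : (Fin n → Fin (suc (suc n))) → Carrier) →
    (∀ {g h} → (∀ k → g k ≡ h k) → f g ≈ f h) →
    ∀ D → (∀ j k → D j k ≈ f (punchIn j ∘ punchIn k)) → Symmetric D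
  punchIn-symmetric {zero} f f-cong D e =
    (λ k → trans (e zero k) (trans (f-cong λ _ → ≡.refl) (sym (e (suc k) zero)))) , _
  punchIn-symmetric {suc n} f f-cong D e =
    (λ k → trans (e zero k) (trans (f-cong λ _ → ≡.refl) (sym (e (suc k) zero)))) ,
    punchIn-symmetric (f ∘ lift) (λ e → f-cong λ { zero → ≡.refl ; (suc k) → ≡.cong suc (e k) })
      (λ j k → D (suc j) (suc k))
      (λ j k → trans (e (suc j) (suc k)) (f-cong λ { zero → ≡.refl ; (suc l) → ≡.refl }))
    where
    lift : (Fin n → Fin (suc (suc n))) → Fin (suc n) → Fin (suc (suc (suc n)))
    lift g zero    = zero
    lift g (suc k) = suc (g k)

  complement : ∀ {n} → Mat (suc (suc n)) (suc (suc n)) → Fin (suc (suc n)) → Fin (suc n) → Carrier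
  complement M j k = det (minor k (minor j M))

  complement-symmetric : ∀ {n} (M : Mat (suc (suc n)) (suc (suc n))) → Symmetric (complement M)
  complement-symmetric M =
    punchIn-symmetric (λ g → det λ r k → M (suc (suc r)) (g k))
      (λ e → det-cong λ r k → reflexive (≡.cong (M (suc (suc r))) (e k)))
      (complement M) (λ j k → refl)

  det-twoRow : ∀ {n} (M : Mat (suc (suc n)) (suc (suc n))) →
    det M ≈ twoRow (M zero) (M (suc zero)) (complement M)
  det-twoRow M = trans (det-ε M) (∑-cong λ j → begin
    ε (toℕ j) * (M zero j * det (minor j M))
      ≈⟨ *-congˡ (*-congˡ (det-ε (minor j M))) ⟩
    ε (toℕ j) * (M zero j * ∑ (λ k → ε (toℕ k) * (M (suc zero) (punchIn j k) * complement M j k)))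
      ≈⟨ *-assoc _ _ _ ⟨
    ε (toℕ j) * M zero j * ∑ (λ k → ε (toℕ k) * (M (suc zero) (punchIn j k) * complement M j k))
      ≈⟨ *-∑ _ (λ k → ε (toℕ k) * (M (suc zero) (punchIn j k) * complement M j k)) ⟩
    _ ≈⟨ (∑-cong λ k → solve 5 (λ e a f b d → e :* a :* (f :* (b :* d)) := e :* f :* (a :* b :* d)) refl
            (ε (toℕ j)) (M zero j) (ε (toℕ k)) (M (suc zero) (punchIn j k)) (complement M j k)) ⟩
    _ ∎)

  swap₀₁ : ∀ {m} {a} {A : Set a} → (Fin (suc (suc m)) → A) → Fin (suc (suc m)) → A
  swap₀₁ M zero          = M (suc zero)
  swap₀₁ M (suc zero)    = M zero
  swap₀₁ M (suc (suc r)) = M (suc (suc r))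

  det-swap : ∀ {n} (M : Mat (suc (suc n)) (suc (suc n))) → det (swap₀₁ M) ≈ - det M
  det-swap M = begin
    det (swap₀₁ M)                 ≈⟨ det-twoRow (swap₀₁ M) ⟩
    twoRow b a D                   ≈⟨ twoRow-ascending b a D (complement-symmetric M) ⟩
    ascending b a D - ascending a b D
      ≈⟨ +-congʳ (-‿involutive _) ⟨
    - - ascending b a D - ascending a b D
      ≈⟨ -‿+-comm _ _ ⟩
    - (- ascending b a D + ascending a b D)
      ≈⟨ -‿cong (+-comm _ _) ⟩
    - (ascending a b D - ascending b a D)
      ≈⟨ -‿cong (twoRow-ascending a b D (complement-symmetric M)) ⟨
    - twoRow a b D                 ≈⟨ -‿cong (det-twoRow M) ⟨
    - det M                        ∎
    where
    a = M zero
    b = M (suc zero)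
    D = complement M

  det-firstRowsEqual : ∀ {n} (M : Mat (suc (suc n)) (suc (suc n))) →
    (∀ k → M zero k ≈ M (suc zero) k) → det M ≈ 0#
  det-firstRowsEqual M e = begin
    det M                ≈⟨ det-twoRow M ⟩
    twoRow a b D         ≈⟨ (∑-cong λ j → ∑-cong λ k → *-congˡ (*-congʳ (*-congʳ (e j)))) ⟩
    twoRow b b D         ≈⟨ twoRow-ascending b b D (complement-symmetric M) ⟩
    ascending b b D - ascending b b D ≈⟨ -‿inverseʳ _ ⟩
    0#                   ∎
    where
    a = M zero
    b = M (suc zero)
    D = complement M

  -- Two equal rows below the first survive in every minor. If one of them is row 0, either the
  -- other is row 1, or exchanging rows 0 and 1 pushes the pair below the first row.
  det-alternating : ∀ {n} (M : Mat n n) (i j : Fin n) → i ≢ j → (∀ k → M i k ≈ M j k) → det M ≈ 0#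
  det-alternating M zero zero ne e = ⊥-elim (ne ≡.refl)
  det-alternating {suc n} M (suc i) (suc j) ne e = trans (det-ε M)
    (∑-0 λ l → trans (*-congˡ (trans (*-congˡ
      (det-alternating (minor l M) i j (ne ∘ ≡.cong suc) (λ k → e (punchIn l k)))) (zeroʳ _))) (zeroʳ _))
  det-alternating M zero (suc zero) ne e = det-firstRowsEqual M e
  det-alternating M (suc zero) zero ne e = det-firstRowsEqual M (sym ∘ e)
  det-alternating M zero (suc (suc j)) ne e = begin
    det M             ≈⟨ -‿involutive _ ⟨
    - - det M         ≈⟨ -‿cong (det-swap M) ⟨
    - det (swap₀₁ M)  ≈⟨ -‿cong (trans (det-ε (swap₀₁ M)) (∑-0 λ l → trans (*-congˡ (trans (*-congˡ
      (det-alternating (minor l (swap₀₁ M)) zero (suc j) (λ ()) (λ k → e (punchIn l k)))) (zeroʳ _))) (zeroʳ _))) ⟩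
    - 0#              ≈⟨ -0#≈0# ⟩
    0#                ∎
  det-alternating M (suc (suc i)) zero ne e = begin
    det M             ≈⟨ -‿involutive _ ⟨
    - - det M         ≈⟨ -‿cong (det-swap M) ⟨
    - det (swap₀₁ M)  ≈⟨ -‿cong (trans (det-ε (swap₀₁ M)) (∑-0 λ l → trans (*-congˡ (trans (*-congˡ
      (det-alternating (minor l (swap₀₁ M)) (suc i) zero (λ ()) (λ k → e (punchIn l k)))) (zeroʳ _))) (zeroʳ _))) ⟩
    - 0#              ≈⟨ -0#≈0# ⟩
    0#                ∎

  setRow : ∀ {n} → Mat n n → Fin n → (Fin n → Carrier) → Mat n n
  setRow M i v = updateAt M i (const v)

  det-row-∑ : ∀ {n m} (M : Mat n n) (i : Fin n) (x : Fin m → Carrier) (v : Mat m n) →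
    det (setRow M i (λ k → ∑ λ l → x l * v l k)) ≈ ∑ (λ l → x l * det (setRow M i (v l)))
  det-row-∑ {n} {zero} M i x v = trans
    (det-row-linear i 0# 0# _ M′ M′ (λ r k ne → refl) (λ r k ne → refl)
      (λ k → trans (reflexive (≡.cong (λ f → f k) (updateAt-updates i M)))
               (trans (∑-[] _) (sym (trans (+-cong (zeroˡ _) (zeroˡ _)) (+-identityˡ _))))))
    (trans (+-cong (zeroˡ _) (zeroˡ _)) (trans (+-identityˡ _) (sym (∑-[] _))))
    where
    M′ = setRow M i (λ k → ∑ λ l → x l * v l k)
  det-row-∑ {n} {suc m} M i x v = trans
    (det-row-linear i (x zero) 1# _ (setRow M i (v zero)) (setRow M i (λ k → ∑ λ l → x (suc l) * v (suc l) k))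
      (λ r k ne → reflexive (≡.cong (λ f → f k)
        (≡.trans (updateAt-minimal r i M ne) (≡.sym (updateAt-minimal r i M ne)))))
      (λ r k ne → reflexive (≡.cong (λ f → f k)
        (≡.trans (updateAt-minimal r i M ne) (≡.sym (updateAt-minimal r i M ne)))))
      (λ k → trans (reflexive (≡.cong (λ f → f k) (updateAt-updates i M))) (trans (∑-∷ _)
        (+-cong (*-congˡ (reflexive (≡.sym (≡.cong (λ f → f k) (updateAt-updates i M)))))
                (trans (sym (*-identityˡ _))
                  (*-congˡ (reflexive (≡.sym (≡.cong (λ f → f k) (updateAt-updates i M))))))))))
    (trans (+-congˡ (trans (*-identityˡ _) (det-row-∑ M i (x ∘ suc) (v ∘ suc)))) (sym (∑-∷ _)))

  adj : ∀ {n} → Mat n n → Mat n n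
  adj M i j = det (setRow M j (δ i))

  -- By linearity, row k of M times column j of adj M is the determinant of M with row j
  -- overwritten by row k.
  *-adj : ∀ {n} (M : Mat n n) k j → ∑ (λ i → M k i * adj M i j) ≈ det M * δ k j
  *-adj M k j = trans (sym (det-row-∑ M j (M k) δ))
    (trans (det-cong {N = setRow M j (M k)} rows) (lem (k Fin.≟ j)))
    where
    rows : ∀ r l → setRow M j (λ l → ∑ λ i → M k i * δ i l) r l ≈ setRow M j (M k) r l
    rows r l with r Fin.≟ j
    ... | yes ≡.refl = trans (reflexive (≡.cong (λ f → f l) (updateAt-updates j M)))
          (trans (∑-δʳ l (M k)) (reflexive (≡.sym (≡.cong (λ f → f l) (updateAt-updates j M)))))
    ... | no ne = reflexive (≡.cong (λ f → f l)
          (≡.trans (updateAt-minimal r j M ne) (≡.sym (updateAt-minimal r j M ne))))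
    lem : _ → det (setRow M j (M k)) ≈ det M * δ k j
    lem (yes ≡.refl) = trans (det-cong same)
      (sym (trans (*-congˡ (reflexive (δ-refl k))) (*-identityʳ _)))
      where
      same : ∀ r l → setRow M k (M k) r l ≈ M r l
      same r l with r Fin.≟ k
      ... | yes ≡.refl = reflexive (≡.cong (λ f → f l) (updateAt-updates k M))
      ... | no ne      = reflexive (≡.cong (λ f → f l) (updateAt-minimal r k M ne))
    lem (no ne) = trans (det-alternating (setRow M j (M k)) k j ne
      (λ l → reflexive (≡.cong (λ f → f l)
        (≡.trans (updateAt-minimal k j M ne) (≡.sym (updateAt-updates j M))))))
      (sym (trans (*-congˡ (reflexive (δ-≢ ne))) (zeroʳ _)))

  adj₀₀ : ∀ {n} (M : Mat (suc n) (suc n)) → adj M zero zero ≈ det (minor zero M)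
  adj₀₀ M = trans (∑-∷ _) (trans (+-cong (*-identityˡ _)
      (∑-0 λ j → trans (sgn-ε (suc (toℕ j)) _) (trans (*-congˡ (zeroˡ _)) (zeroʳ _))))
    (+-identityʳ _))

  module Derivation (d : Carrier → Carrier) (d-cong : ∀ {x y} → x ≈ y → d x ≈ d y)
    (d-+ : ∀ x y → d (x + y) ≈ d x + d y) (d-* : ∀ x y → d (x * y) ≈ d x * y + x * d y)
    (d-neg : ∀ x → d (- x) ≈ - d x) (d-0 : d 0# ≈ 0#) (d-1 : d 1# ≈ 0#) where

    d-sgn : ∀ k x → d (sgn k x) ≈ sgn k (d x)
    d-sgn zero    x = refl
    d-sgn (suc k) x = trans (d-neg _) (-‿cong (d-sgn k x))

    d-∑ : ∀ {n} (f : Fin n → Carrier) → d (∑ f) ≈ ∑ (d ∘ f)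
    d-∑ {zero}  f = trans (d-cong (∑-[] _)) (trans d-0 (sym (∑-[] _)))
    d-∑ {suc n} f = trans (d-cong (∑-∷ _)) (trans (d-+ _ _) (trans (+-congˡ (d-∑ (f ∘ suc))) (sym (∑-∷ _))))

    -- The Leibniz rule, one row at a time. For x I - S, differentiating row `i` leaves the unit
    -- row, so the sum becomes the trace of the adjugate.
    d-det : ∀ {n} (M : Mat n n) → d (det M) ≈ ∑ (λ i → det (updateAt M i (d ∘_)))
    d-det {zero}  M = trans d-1 (sym (∑-[] _))
    d-det {suc n} M = begin
      d (det M)
        ≈⟨ d-∑ _ ⟩
      ∑ (λ j → d (sgn (toℕ j) (M zero j * det (minor j M))))
        ≈⟨ (∑-cong λ j → trans (d-sgn (toℕ j) _) (trans (sgn-ε (toℕ j) _)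
             (trans (*-congˡ (trans (d-* _ _) (+-congˡ (*-congˡ (d-det (minor j M))))))
             (trans (distribˡ _ _ _) (+-cong (sym (sgn-ε (toℕ j) _)) (inner j)))))) ⟩
      ∑ (λ j → sgn (toℕ j) (d (M zero j) * det (minor j M)) + ∑ (λ i → term i j))
        ≈⟨ ∑-+ (λ j → sgn (toℕ j) (d (M zero j) * det (minor j M))) _ ⟩
      det (updateAt M zero (d ∘_)) + ∑ (λ j → ∑ (λ i → term i j))
        ≈⟨ +-congˡ (∑-comm (λ j i → term i j)) ⟩
      det (updateAt M zero (d ∘_)) + ∑ (λ i → ∑ (term i))
        ≈⟨ ∑-∷ _ ⟨
      ∑ (λ i → det (updateAt M i (d ∘_))) ∎
      where
      term : Fin n → Fin (suc n) → Carrier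
      term i j = sgn (toℕ j) (M zero j * det (minor j (updateAt M (suc i) (d ∘_))))
      inner : ∀ j → ε (toℕ j) * (M zero j * ∑ (λ i → det (updateAt (minor j M) i (d ∘_))))
                  ≈ ∑ (λ i → term i j)
      inner j = trans (sym (*-assoc _ _ _)) (trans
        (*-∑ _ (λ i → det (updateAt (minor j M) i (d ∘_))))
        (∑-cong λ i → trans (*-assoc _ _ _) (trans (sym (sgn-ε (toℕ j) _))
          (sgn-cong (toℕ j) (*-congˡ (det-cong λ r k → reflexive (≡.cong (λ f → f k)
            (≡.sym (map-updateAt {f = _∘ punchIn j} {g = d ∘_} {h = d ∘_} (λ _ → ≡.refl) (tail M) i r)))))))))

  module Endomorphism (h : Carrier → Carrier) (h-cong : ∀ {x y} → x ≈ y → h x ≈ h y)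
    (h-+ : ∀ x y → h (x + y) ≈ h x + h y) (h-* : ∀ x y → h (x * y) ≈ h x * h y)
    (h-neg : ∀ x → h (- x) ≈ - h x) (h-0 : h 0# ≈ 0#) (h-1 : h 1# ≈ 1#) where

    h-sgn : ∀ k x → h (sgn k x) ≈ sgn k (h x)
    h-sgn zero    x = refl
    h-sgn (suc k) x = trans (h-neg _) (-‿cong (h-sgn k x))

    h-∑ : ∀ {n} (f : Fin n → Carrier) → h (∑ f) ≈ ∑ (h ∘ f)
    h-∑ {zero}  f = trans (h-cong (∑-[] _)) (trans h-0 (sym (∑-[] _)))
    h-∑ {suc n} f = trans (h-cong (∑-∷ _)) (trans (h-+ _ _) (trans (+-congˡ (h-∑ (f ∘ suc))) (sym (∑-∷ _))))

    h-det : ∀ {n} (M : Mat n n) → h (det M) ≈ det (λ i j → h (M i j))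
    h-det {zero}  M = h-1
    h-det {suc n} M = trans (h-∑ _) (∑-cong λ j → trans (h-sgn (toℕ j) _)
      (sgn-cong (toℕ j) (trans (h-* _ _) (*-congˡ (h-det (minor j M))))))

  det-neg : ∀ {n} (M : Mat n n) → det (λ i j → - M i j) ≈ sgn n (det M)
  det-neg {zero}  M = refl
  det-neg {suc n} M = begin
    det (λ i j → - M i j)
      ≈⟨ det-ε (λ i j → - M i j) ⟩
    ∑ (λ j → ε (toℕ j) * (- M zero j * det (λ r k → - minor j M r k)))
      ≈⟨ (∑-cong λ j → *-congˡ (trans (*-congˡ (trans (det-neg (minor j M)) (sgn-ε n _)))
            (trans (sym (-‿distribˡ-* _ _)) (-‿distribʳ-* _ _)))) ⟩
    ∑ (λ j → ε (toℕ j) * (M zero j * - (ε n * det (minor j M))))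
      ≈⟨ (∑-cong λ j → trans (*-congˡ (*-congˡ (-‿distribˡ-* _ _)))
            (solve 4 (λ e m f d → e :* (m :* (f :* d)) := f :* (e :* (m :* d))) refl
               (ε (toℕ j)) (M zero j) (- ε n) (det (minor j M)))) ⟩
    ∑ (λ j → - ε n * (ε (toℕ j) * (M zero j * det (minor j M))))
      ≈⟨ *-∑ (- ε n) (λ j → ε (toℕ j) * (M zero j * det (minor j M))) ⟨
    - ε n * ∑ (λ j → ε (toℕ j) * (M zero j * det (minor j M)))
      ≈⟨ *-congˡ (det-ε M) ⟨
    - ε n * det M
      ≈⟨ sgn-ε (suc n) (det M) ⟨
    sgn (suc n) (det M) ∎

open import Defs
open ≡ using (refl; sym; trans; cong; cong₂; subst)

-- The commutative ring ℤ[x] on coefficient lists.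

module PolynomialRing where

  -- Wrapping _≈ₚ_ in a record lets Agda recover the two polynomials from the type of an equation.
  infix 4 _≋_
  record _≋_ (p r : Poly) : Set where
    constructor coeffwise
    field at : p ≈ₚ r
  open _≋_ public

  ≋-refl : ∀ {p} → p ≋ p
  ≋-refl = coeffwise λ _ → refl

  ≋-sym : ∀ {p r} → p ≋ r → r ≋ p
  ≋-sym e = coeffwise λ n → sym (at e n)

  ≋-trans : ∀ {p r s} → p ≋ r → r ≋ s → p ≋ s
  ≋-trans e f = coeffwise λ n → trans (at e n) (at f n)

  private
    ∷-cong : ∀ {a b p r} → a ≡ b → p ≋ r → (a ∷ p) ≋ (b ∷ r)
    ∷-cong e f = coeffwise λ { zero → e ; (suc n) → at f n }

    0∷[] : (+ 0 ∷ []) ≋ []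
    0∷[] = coeffwise λ { zero → refl ; (suc n) → refl }

  coeff-+ : ∀ p r n → coeff (p +ₚ r) n ≡ coeff p n ℤ.+ coeff r n
  coeff-+ []      r       n       = sym (ℤₚ.+-identityˡ _)
  coeff-+ (a ∷ p) []      n       = sym (ℤₚ.+-identityʳ _)
  coeff-+ (a ∷ p) (b ∷ r) zero    = refl
  coeff-+ (a ∷ p) (b ∷ r) (suc n) = coeff-+ p r n

  coeff-scale : ∀ c p n → coeff (scaleₚ c p) n ≡ c ℤ.* coeff p n
  coeff-scale c []      n       = sym (ℤₚ.*-zeroʳ c)
  coeff-scale c (a ∷ p) zero    = refl
  coeff-scale c (a ∷ p) (suc n) = coeff-scale c p n

  private
    +-cong : ∀ {p p′ r r′} → p ≋ p′ → r ≋ r′ → (p +ₚ r) ≋ (p′ +ₚ r′)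
    +-cong {p} {p′} {r} {r′} e f = coeffwise λ n →
      trans (coeff-+ p r n) (trans (cong₂ ℤ._+_ (at e n) (at f n)) (sym (coeff-+ p′ r′ n)))

    +-assoc : ∀ p r s → (p +ₚ r) +ₚ s ≋ p +ₚ (r +ₚ s)
    +-assoc []      r       s       = ≋-refl
    +-assoc (a ∷ p) []      s       = ≋-refl
    +-assoc (a ∷ p) (b ∷ r) []      = ≋-refl
    +-assoc (a ∷ p) (b ∷ r) (c ∷ s) = ∷-cong (ℤₚ.+-assoc a b c) (+-assoc p r s)

    +-comm : ∀ p r → p +ₚ r ≋ r +ₚ p
    +-comm []      []      = ≋-refl
    +-comm []      (b ∷ r) = ≋-refl
    +-comm (a ∷ p) []      = ≋-refl
    +-comm (a ∷ p) (b ∷ r) = ∷-cong (ℤₚ.+-comm a b) (+-comm p r)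

    +-identityʳ : ∀ p → p +ₚ [] ≋ p
    +-identityʳ []      = ≋-refl
    +-identityʳ (a ∷ p) = ≋-refl

    scale-cong : ∀ c {p r} → p ≋ r → scaleₚ c p ≋ scaleₚ c r
    scale-cong c {p} {r} e = coeffwise λ n →
      trans (coeff-scale c p n) (trans (cong (c ℤ.*_) (at e n)) (sym (coeff-scale c r n)))

    scale-+ : ∀ c p r → scaleₚ c (p +ₚ r) ≋ scaleₚ c p +ₚ scaleₚ c r
    scale-+ c []      r       = ≋-refl
    scale-+ c (a ∷ p) []      = ≋-refl
    scale-+ c (a ∷ p) (b ∷ r) = ∷-cong (ℤₚ.*-distribˡ-+ c a b) (scale-+ c p r)

    +-scale : ∀ c d p → scaleₚ (c ℤ.+ d) p ≋ scaleₚ c p +ₚ scaleₚ d p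
    +-scale c d []      = ≋-refl
    +-scale c d (a ∷ p) = ∷-cong (ℤₚ.*-distribʳ-+ a c d) (+-scale c d p)

    scale-scale : ∀ c d p → scaleₚ c (scaleₚ d p) ≋ scaleₚ (c ℤ.* d) p
    scale-scale c d []      = ≋-refl
    scale-scale c d (a ∷ p) = ∷-cong (sym (ℤₚ.*-assoc c d a)) (scale-scale c d p)

    scale-1 : ∀ p → scaleₚ (+ 1) p ≋ p
    scale-1 []      = ≋-refl
    scale-1 (a ∷ p) = ∷-cong (ℤₚ.*-identityˡ a) (scale-1 p)

    scale-0 : ∀ p → scaleₚ (+ 0) p ≋ []
    scale-0 []      = ≋-refl
    scale-0 (a ∷ p) = ≋-trans (∷-cong refl (scale-0 p)) 0∷[]

    +-interchange : ∀ p r s u → (p +ₚ r) +ₚ (s +ₚ u) ≋ (p +ₚ s) +ₚ (r +ₚ u)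
    +-interchange p r s u =
      ≋-trans (+-assoc p r (s +ₚ u))
      (≋-trans (+-cong (≋-refl {p})
         (≋-trans (≋-sym (+-assoc r s u)) (≋-trans (+-cong (+-comm r s) ≋-refl) (+-assoc s r u))))
       (≋-sym (+-assoc p s (r +ₚ u))))

    *-zeroʳ : ∀ p → p *ₚ [] ≋ []
    *-zeroʳ []      = ≋-refl
    *-zeroʳ (a ∷ p) = ≋-trans (∷-cong refl (*-zeroʳ p)) 0∷[]

    -- The defining recursion of `_*ₚ_`, mirrored to the second factor; commutativity follows by
    -- comparing the two.
    *-∷ : ∀ p b r → p *ₚ (b ∷ r) ≋ scaleₚ b p +ₚ (+ 0 ∷ (p *ₚ r))
    *-∷ []      b r = ≋-sym 0∷[]
    *-∷ (a ∷ p) b r = ∷-cong (cong (ℤ._+ + 0) (ℤₚ.*-comm a b))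
      (≋-trans (+-cong ≋-refl (*-∷ p b r))
      (≋-trans (≋-sym (+-assoc (scaleₚ a r) (scaleₚ b p) (+ 0 ∷ (p *ₚ r))))
      (≋-trans (+-cong (+-comm (scaleₚ a r) (scaleₚ b p)) ≋-refl)
               (+-assoc (scaleₚ b p) (scaleₚ a r) (+ 0 ∷ (p *ₚ r))))))

    *-comm : ∀ p r → p *ₚ r ≋ r *ₚ p
    *-comm []      r = ≋-sym (*-zeroʳ r)
    *-comm (a ∷ p) r = ≋-trans (+-cong ≋-refl (∷-cong refl (*-comm p r))) (≋-sym (*-∷ r a p))

    *-congˡ : ∀ p {r s} → r ≋ s → p *ₚ r ≋ p *ₚ s
    *-congˡ []      e = ≋-refl
    *-congˡ (a ∷ p) e = +-cong (scale-cong a e) (∷-cong refl (*-congˡ p e))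

    *-cong : ∀ {p p′ r r′} → p ≋ p′ → r ≋ r′ → p *ₚ r ≋ p′ *ₚ r′
    *-cong {p} {p′} {r} {r′} e f =
      ≋-trans (*-congˡ p f) (≋-trans (*-comm p r′) (≋-trans (*-congˡ r′ e) (*-comm r′ p′)))

    *-distribʳ : ∀ s p r → (p +ₚ r) *ₚ s ≋ (p *ₚ s) +ₚ (r *ₚ s)
    *-distribʳ s []      r       = ≋-refl
    *-distribʳ s (a ∷ p) []      = ≋-sym (+-identityʳ _)
    *-distribʳ s (a ∷ p) (b ∷ r) =
      ≋-trans (+-cong (+-scale a b s) (∷-cong refl (*-distribʳ s p r)))
              (+-interchange (scaleₚ a s) (scaleₚ b s) (+ 0 ∷ (p *ₚ s)) (+ 0 ∷ (r *ₚ s)))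

    *-distribˡ : ∀ s p r → s *ₚ (p +ₚ r) ≋ (s *ₚ p) +ₚ (s *ₚ r)
    *-distribˡ s p r = ≋-trans (*-comm s (p +ₚ r))
      (≋-trans (*-distribʳ s p r) (+-cong (*-comm p s) (*-comm r s)))

    scale-* : ∀ c p r → scaleₚ c p *ₚ r ≋ scaleₚ c (p *ₚ r)
    scale-* c []      r = ≋-refl
    scale-* c (a ∷ p) r =
      ≋-trans (+-cong (≋-sym (scale-scale c a r)) (∷-cong (sym (ℤₚ.*-zeroʳ c)) (scale-* c p r)))
              (≋-sym (scale-+ c (scaleₚ a r) (+ 0 ∷ (p *ₚ r))))

    shift-* : ∀ p r → (+ 0 ∷ p) *ₚ r ≋ + 0 ∷ (p *ₚ r)
    shift-* p r = +-cong (scale-0 r) ≋-refl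

    *-assoc : ∀ p r s → (p *ₚ r) *ₚ s ≋ p *ₚ (r *ₚ s)
    *-assoc []      r s = ≋-refl
    *-assoc (a ∷ p) r s =
      ≋-trans (*-distribʳ s (scaleₚ a r) (+ 0 ∷ (p *ₚ r)))
              (+-cong (scale-* a r s) (≋-trans (shift-* (p *ₚ r) s) (∷-cong refl (*-assoc p r s))))

    *-identityˡ : ∀ p → constₚ (+ 1) *ₚ p ≋ p
    *-identityˡ p = ≋-trans (+-cong (scale-1 p) 0∷[]) (+-identityʳ p)

    +-inverseˡ : ∀ p → negₚ p +ₚ p ≋ []
    +-inverseˡ []      = ≋-refl
    +-inverseˡ (a ∷ p) = ≋-trans (∷-cong (lem a) (+-inverseˡ p)) 0∷[]
      where
      lem : ∀ a → ℤ.- (+ 1) ℤ.* a ℤ.+ a ≡ + 0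
      lem = solve-∀

  infixl 6 _⊕_
  infixl 7 _⊗_
  infix  8 ⊖_

  -- Opaque copies of the operations: the list-recursive ones unfold during unification.
  opaque
    _⊕_ _⊗_ : Poly → Poly → Poly
    _⊕_ = _+ₚ_
    _⊗_ = _*ₚ_

    ⊖_ : Poly → Poly
    ⊖_ = negₚ

    C : ℤ → Poly
    C = constₚ

    X : Poly
    X = Xₚ

    ⊕-def : ∀ p r → p +ₚ r ≡ p ⊕ r
    ⊕-def p r = refl

    ⊗-def : ∀ p r → p *ₚ r ≡ p ⊗ r
    ⊗-def p r = refl

    ⊖-def : ∀ p → negₚ p ≡ ⊖ p
    ⊖-def p = refl

    C-def : ∀ a → constₚ a ≡ C a
    C-def a = refl

    X-def : Xₚ ≡ X
    X-def = refl

    isCommutativeRing : IsCommutativeRing _≋_ _⊕_ _⊗_ ⊖_ [] (C (+ 1))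
    isCommutativeRing = record
      { isRing = record
        { +-isAbelianGroup = record
          { isGroup = record
            { isMonoid = record
              { isSemigroup = record
                { isMagma = record
                  { isEquivalence = record { refl = ≋-refl ; sym = ≋-sym ; trans = ≋-trans }
                  ; ∙-cong = +-cong }
                ; assoc = +-assoc }
              ; identity = (λ _ → ≋-refl) , +-identityʳ }
            ; inverse = +-inverseˡ , (λ p → ≋-trans (+-comm p (negₚ p)) (+-inverseˡ p))
            ; ⁻¹-cong = scale-cong _ }
          ; comm = +-comm }
        ; *-cong = *-cong
        ; *-assoc = *-assoc
        ; *-identity = *-identityˡ , (λ p → ≋-trans (*-comm p _) (*-identityˡ p))
        ; distrib = *-distribˡ , *-distribʳ }
      ; *-comm = *-comm }

    C-+ : ∀ a b → C (a ℤ.+ b) ≋ C a ⊕ C b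
    C-+ a b = ≋-refl

    C-* : ∀ a b → C (a ℤ.* b) ≋ C a ⊗ C b
    C-* a b = ∷-cong (sym (ℤₚ.+-identityʳ _)) ≋-refl

    C-0 : C (+ 0) ≋ []
    C-0 = 0∷[]

    C-neg : ∀ a → C (ℤ.- a) ≋ ⊖ C a
    C-neg a = ∷-cong (sym (ℤₚ.-1*i≡-i a)) ≋-refl

    coeff-⊕ : ∀ p r n → coeff (p ⊕ r) n ≡ coeff p n ℤ.+ coeff r n
    coeff-⊕ = coeff-+

    coeff-⊖ : ∀ p n → coeff (⊖ p) n ≡ ℤ.- coeff p n
    coeff-⊖ p n = trans (coeff-scale _ p n) (ℤₚ.-1*i≡-i _)

    coeff-C⊗ : ∀ a p n → coeff (C a ⊗ p) n ≡ a ℤ.* coeff p n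
    coeff-C⊗ a p n = trans (coeff-+ (scaleₚ a p) (+ 0 ∷ []) n)
      (trans (cong₂ ℤ._+_ (coeff-scale a p n) (at 0∷[] n)) (ℤₚ.+-identityʳ _))

    X⊗ : ∀ p → X ⊗ p ≋ + 0 ∷ p
    X⊗ p = coeffwise λ n → trans (coeff-+ (scaleₚ (+ 0) p) (+ 0 ∷ (constₚ (+ 1) *ₚ p)) n)
      (trans (cong₂ ℤ._+_ (coeff-scale (+ 0) p n) (at (∷-cong refl (*-identityˡ p)) n))
               (ℤₚ.+-identityˡ _))

    ∷-X : ∀ a p → (a ∷ p) ≋ C a ⊕ X ⊗ p
    ∷-X a p = coeffwise λ n → trans (lem n)
      (sym (trans (coeff-+ (constₚ a) (Xₚ *ₚ p) n) (cong₂ ℤ._+_ (refl {x = coeff (constₚ a) n}) (at (X⊗ p) n))))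
      where
      lem : ∀ n → coeff (a ∷ p) n ≡ coeff (constₚ a) n ℤ.+ coeff (+ 0 ∷ p) n
      lem zero    = sym (ℤₚ.+-identityʳ a)
      lem (suc n) = sym (ℤₚ.+-identityˡ _)

    coeff₀-⊗ : ∀ p r → coeff (p ⊗ r) 0 ≡ coeff p 0 ℤ.* coeff r 0
    coeff₀-⊗ []      r = refl
    coeff₀-⊗ (a ∷ p) r = trans (coeff-+ (scaleₚ a r) (+ 0 ∷ (p *ₚ r)) 0)
      (trans (ℤₚ.+-identityʳ _) (coeff-scale a r 0))

    coeff₀-C : ∀ a → coeff (C a) 0 ≡ a
    coeff₀-C a = refl

  polyRing : CommutativeRing 0ℓ 0ℓ
  polyRing = record { isCommutativeRing = isCommutativeRing }

  private
    polyACR : AlmostCommutativeRing 0ℓ 0ℓ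
    polyACR = fromCommutativeRing polyRing

    constMorphism : CommutativeRing.rawRing ℤₚ.+-*-commutativeRing -Raw-AlmostCommutative⟶ polyACR
    constMorphism = record
      { ⟦_⟧ = C ; +-homo = C-+ ; *-homo = C-* ; -‿homo = C-neg ; 0-homo = C-0 ; 1-homo = ≋-refl }

    const≟ : ∀ a b → Maybe (C a ≋ C b)
    const≟ a b with a ℤ.≟ b
    ... | yes e = just (CommutativeRing.reflexive polyRing (cong C e))
    ... | no _  = nothing

  module PolySolver = RingSolver (CommutativeRing.rawRing ℤₚ.+-*-commutativeRing) polyACR constMorphism const≟

open PolynomialRing
open CommutativeRing polyRing using
  ( ring; setoid; reflexive; +-cong; +-congˡ; +-congʳ; +-identityˡ; +-identityʳ; -‿cong; -‿inverseʳ
  ; *-cong; *-congˡ; *-congʳ; *-assoc; *-comm; *-identityˡ; *-identityʳ; zeroˡ; zeroʳ)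
open RingProperties ring using (-0#≈0#)
open PolySolver using (solve; _:+_; _:*_; _:-_; :-_; con; _:=_)
open import Data.Integer using (_+_; _*_; -_; _≤_)

module ℤMat = Determinant ℤₚ.+-*-commutativeRing
module PolyMat = Determinant polyRing
open ℤMat using
  ( ∑; ∑-[]; ∑-∷; ∑-cong; ∑-0; ∑-+; ∑-linear; ∑-comm; ∑-assoc; *-∑; ∑-*; ∑-δˡ; ∑-δʳ
  ; δ; δ-refl; δ-≢; δ-sym)
open PolyMat using () renaming (∑ to ∑ₚ; δ to δₚ)

-- Derivatives, cancellation, and the resolvent of a matrix with known annihilator.

module CharacteristicPolynomials where
  open SetoidReasoning setoid

  infixr 8 _^_
  _^_ : Poly → ℕ → Poly
  p ^ zero  = C (+ 1)
  p ^ suc k = p ⊗ p ^ k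

  ^-cong : ∀ {p r} → p ≋ r → ∀ k → p ^ k ≋ r ^ k
  ^-cong e zero    = ≋-refl
  ^-cong e (suc k) = *-cong e (^-cong e k)

  ^-⊗ : ∀ p r k → (p ⊗ r) ^ k ≋ p ^ k ⊗ r ^ k
  ^-⊗ p r zero    = ≋-sym (*-identityʳ (C (+ 1)))
  ^-⊗ p r (suc k) = ≋-trans (*-congˡ (^-⊗ p r k))
    (solve 4 (λ p r s t → p :* r :* (s :* t) := (p :* s) :* (r :* t)) ≋-refl p r (p ^ k) (r ^ k))

  ^ₚ-def : ∀ p k → p ^ₚ k ≡ p ^ k
  ^ₚ-def p zero    = C-def (+ 1)
  ^ₚ-def p (suc k) = trans (⊗-def p (p ^ₚ k)) (cong (p ⊗_) (^ₚ-def p k))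

  D : Poly → Poly
  D []      = []
  D (a ∷ p) = p ⊕ X ⊗ D p

  coeff-D : ∀ p n → coeff (D p) n ≡ + suc n ℤ.* coeff p (suc n)
  coeff-D [] n = sym (ℤₚ.*-zeroʳ (+ suc n))
  coeff-D (a ∷ p) zero = trans (coeff-⊕ p (X ⊗ D p) zero)
    (trans (cong₂ ℤ._+_ (refl {x = coeff p 0}) (at (X⊗ (D p)) zero)) (lem (coeff p 0)))
    where
    lem : ∀ x → x ℤ.+ + 0 ≡ + 1 ℤ.* x
    lem = solve-∀
  coeff-D (a ∷ p) (suc n) = trans (coeff-⊕ p (X ⊗ D p) (suc n))
    (trans (cong₂ ℤ._+_ (refl {x = coeff p (suc n)}) (trans (at (X⊗ (D p)) (suc n)) (coeff-D p n)))
             (lem (+ suc n) (coeff p (suc n))))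
    where
    lem : ∀ k x → x ℤ.+ k ℤ.* x ≡ (+ 1 ℤ.+ k) ℤ.* x
    lem = solve-∀

  D-cong : ∀ {p r} → p ≋ r → D p ≋ D r
  D-cong {p} {r} e = coeffwise λ n →
    trans (coeff-D p n) (trans (cong (+ suc n ℤ.*_) (at e (suc n))) (sym (coeff-D r n)))

  D-+ : ∀ p r → D (p ⊕ r) ≋ D p ⊕ D r
  D-+ p r = coeffwise λ n → trans (coeff-D (p ⊕ r) n)
    (trans (cong (+ suc n ℤ.*_) (coeff-⊕ p r (suc n)))
    (trans (ℤₚ.*-distribˡ-+ (+ suc n) (coeff p (suc n)) (coeff r (suc n)))
    (trans (sym (cong₂ ℤ._+_ (coeff-D p n) (coeff-D r n))) (sym (coeff-⊕ (D p) (D r) n)))))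

  D-C⊗ : ∀ a p → D (C a ⊗ p) ≋ C a ⊗ D p
  D-C⊗ a p = coeffwise λ n → trans (coeff-D (C a ⊗ p) n)
    (trans (cong (+ suc n ℤ.*_) (coeff-C⊗ a p (suc n)))
    (trans (lem (+ suc n) a (coeff p (suc n)))
    (trans (cong (a ℤ.*_) (sym (coeff-D p n))) (sym (coeff-C⊗ a (D p) n)))))
    where
    lem : ∀ k a x → k ℤ.* (a ℤ.* x) ≡ a ℤ.* (k ℤ.* x)
    lem = solve-∀

  D-X⊗ : ∀ p → D (X ⊗ p) ≋ p ⊕ X ⊗ D p
  D-X⊗ p = D-cong (X⊗ p)

  D-* : ∀ p r → D (p ⊗ r) ≋ D p ⊗ r ⊕ p ⊗ D r
  D-* []      r = ≋-trans (D-cong (zeroˡ r)) (≋-sym (≋-trans (+-cong (zeroˡ r) (zeroˡ (D r))) (+-identityˡ [])))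
  D-* (a ∷ p) r = begin
    D ((a ∷ p) ⊗ r)
      ≈⟨ D-cong (≋-trans (*-congʳ (∷-X a p)) (solve 4 (λ a x p r → (a :+ x :* p) :* r := a :* r :+ x :* (p :* r))
           ≋-refl (C a) X p r)) ⟩
    D (C a ⊗ r ⊕ X ⊗ (p ⊗ r))
      ≈⟨ D-+ (C a ⊗ r) (X ⊗ (p ⊗ r)) ⟩
    D (C a ⊗ r) ⊕ D (X ⊗ (p ⊗ r))
      ≈⟨ +-cong (D-C⊗ a r) (≋-trans (D-X⊗ (p ⊗ r)) (+-congˡ (*-congˡ (D-* p r)))) ⟩
    C a ⊗ D r ⊕ (p ⊗ r ⊕ X ⊗ (D p ⊗ r ⊕ p ⊗ D r))
      ≈⟨ solve 6 (λ a x p r dp dr → a :* dr :+ (p :* r :+ x :* (dp :* r :+ p :* dr))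
                                 := (p :+ x :* dp) :* r :+ (a :+ x :* p) :* dr) ≋-refl
           (C a) X p r (D p) (D r) ⟩
    (p ⊕ X ⊗ D p) ⊗ r ⊕ (C a ⊕ X ⊗ p) ⊗ D r
      ≈⟨ +-congˡ (*-congʳ (∷-X a p)) ⟨
    D (a ∷ p) ⊗ r ⊕ (a ∷ p) ⊗ D r ∎

  ⊖-C : ∀ p → ⊖ p ≋ C (ℤ.- (+ 1)) ⊗ p
  ⊖-C p = solve 1 (λ p → :- p := con (ℤ.- (+ 1)) :* p) ≋-refl p

  D-neg : ∀ p → D (⊖ p) ≋ ⊖ D p
  D-neg p = ≋-trans (D-cong (⊖-C p)) (≋-trans (D-C⊗ _ p) (≋-sym (⊖-C (D p))))

  D-C : ∀ a → D (C a) ≋ []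
  D-C a = ≋-trans (D-cong (reflexive (sym (C-def a))))
    (≋-trans (+-identityˡ _) (zeroʳ X))

  D-X : D X ≋ C (+ 1)
  D-X = ≋-trans (D-cong (≋-sym (*-identityʳ X)))
    (≋-trans (D-X⊗ (C (+ 1))) (≋-trans (+-congˡ (≋-trans (*-congˡ (D-C (+ 1))) (zeroʳ X)))
      (+-identityʳ _)))

  -- The substitution x ↦ - x.
  reflect : Poly → Poly
  reflect []      = []
  reflect (a ∷ p) = C a ⊕ ⊖ (X ⊗ reflect p)

  sign : ℕ → ℤ
  sign zero    = + 1
  sign (suc n) = ℤ.- sign n

  coeff-reflect : ∀ p n → coeff (reflect p) n ≡ sign n ℤ.* coeff p n
  coeff-reflect []      n       = sym (ℤₚ.*-zeroʳ (sign n))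
  coeff-reflect (a ∷ p) zero    = trans (coeff-⊕ (C a) (⊖ (X ⊗ reflect p)) 0)
    (trans (cong₂ ℤ._+_ (coeff₀-C a) (trans (coeff-⊖ (X ⊗ reflect p) 0) (cong ℤ.-_ (at (X⊗ (reflect p)) 0)))) (lem a))
    where
    lem : ∀ x → x ℤ.+ ℤ.- (+ 0) ≡ + 1 ℤ.* x
    lem = solve-∀
  coeff-reflect (a ∷ p) (suc n) = trans (coeff-⊕ (C a) (⊖ (X ⊗ reflect p)) (suc n))
    (trans (cong₂ ℤ._+_ (cong (λ p → coeff p (suc n)) (sym (C-def a)))
        (trans (coeff-⊖ (X ⊗ reflect p) (suc n)) (cong ℤ.-_ (trans (at (X⊗ (reflect p)) (suc n)) (coeff-reflect p n)))))
      (lem (sign n) (coeff p n)))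
    where
    lem : ∀ s x → + 0 ℤ.+ ℤ.- (s ℤ.* x) ≡ ℤ.- s ℤ.* x
    lem = solve-∀

  reflect-cong : ∀ {p r} → p ≋ r → reflect p ≋ reflect r
  reflect-cong {p} {r} e = coeffwise λ n →
    trans (coeff-reflect p n) (trans (cong (sign n ℤ.*_) (at e n)) (sym (coeff-reflect r n)))

  reflect-+ : ∀ p r → reflect (p ⊕ r) ≋ reflect p ⊕ reflect r
  reflect-+ p r = coeffwise λ n → trans (coeff-reflect (p ⊕ r) n)
    (trans (cong (sign n ℤ.*_) (coeff-⊕ p r n))
    (trans (ℤₚ.*-distribˡ-+ (sign n) (coeff p n) (coeff r n))
    (trans (sym (cong₂ ℤ._+_ (coeff-reflect p n) (coeff-reflect r n)))
             (sym (coeff-⊕ (reflect p) (reflect r) n)))))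

  reflect-C⊗ : ∀ a p → reflect (C a ⊗ p) ≋ C a ⊗ reflect p
  reflect-C⊗ a p = coeffwise λ n → trans (coeff-reflect (C a ⊗ p) n)
    (trans (cong (sign n ℤ.*_) (coeff-C⊗ a p n))
    (trans (lem (sign n) a (coeff p n))
    (sym (trans (coeff-C⊗ a (reflect p) n) (cong (a ℤ.*_) (coeff-reflect p n))))))
    where
    lem : ∀ k a x → k ℤ.* (a ℤ.* x) ≡ a ℤ.* (k ℤ.* x)
    lem = solve-∀

  reflect-X⊗ : ∀ p → reflect (X ⊗ p) ≋ ⊖ (X ⊗ reflect p)
  reflect-X⊗ p = ≋-trans (reflect-cong (X⊗ p))
    (≋-trans (+-congʳ C-0) (+-identityˡ _))

  reflect-* : ∀ p r → reflect (p ⊗ r) ≋ reflect p ⊗ reflect r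
  reflect-* []      r = ≋-trans (reflect-cong (zeroˡ r)) (≋-sym (zeroˡ (reflect r)))
  reflect-* (a ∷ p) r = begin
    reflect ((a ∷ p) ⊗ r)
      ≈⟨ reflect-cong (≋-trans (*-congʳ (∷-X a p)) (solve 4 (λ a x p r → (a :+ x :* p) :* r := a :* r :+ x :* (p :* r))
           ≋-refl (C a) X p r)) ⟩
    reflect (C a ⊗ r ⊕ X ⊗ (p ⊗ r))
      ≈⟨ reflect-+ (C a ⊗ r) (X ⊗ (p ⊗ r)) ⟩
    reflect (C a ⊗ r) ⊕ reflect (X ⊗ (p ⊗ r))
      ≈⟨ +-cong (reflect-C⊗ a r) (≋-trans (reflect-X⊗ (p ⊗ r)) (-‿cong (*-congˡ (reflect-* p r)))) ⟩
    C a ⊗ reflect r ⊕ ⊖ (X ⊗ (reflect p ⊗ reflect r))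
      ≈⟨ solve 4 (λ a x p r → a :* r :+ :- (x :* (p :* r)) := (a :+ :- (x :* p)) :* r) ≋-refl
           (C a) X (reflect p) (reflect r) ⟩
    reflect (a ∷ p) ⊗ reflect r ∎

  reflect-neg : ∀ p → reflect (⊖ p) ≋ ⊖ reflect p
  reflect-neg p = ≋-trans (reflect-cong (⊖-C p)) (≋-trans (reflect-C⊗ _ p) (≋-sym (⊖-C (reflect p))))

  reflect-C : ∀ a → reflect (C a) ≋ C a
  reflect-C a = ≋-trans (reflect-cong (reflexive (sym (C-def a))))
    (≋-trans (+-congˡ (≋-trans (-‿cong (zeroʳ X)) -0#≈0#)) (+-identityʳ (C a)))

  reflect-X : reflect X ≋ ⊖ X
  reflect-X = ≋-trans (reflect-cong (≋-sym (*-identityʳ X)))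
    (≋-trans (reflect-X⊗ (C (+ 1))) (-‿cong (≋-trans (*-congˡ (reflect-C (+ 1))) (*-identityʳ X))))

  -- Non-zero-divisors. The factors cancelled later are built from `X` and from polynomials with
  -- nonzero constant term, the two kinds treated next.
  Regular : Poly → Set
  Regular p = ∀ r → p ⊗ r ≋ [] → r ≋ []

  regular-X : Regular X
  regular-X r e = coeffwise λ n → at (≋-trans (≋-sym (X⊗ r)) e) (suc n)

  -- The lowest coefficient of the product forces that of the other factor to vanish; that factor is
  -- then x times a shorter list, and `X` cancels.
  regular-coeff₀ : ∀ p → coeff p 0 ≢ + 0 → Regular p
  regular-coeff₀ p ne []      e = ≋-refl
  regular-coeff₀ p ne (b ∷ r) e = coeffwise λ { zero → b≡0 ; (suc n) → at r≋0 n }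
    where
    b≡0 : b ≡ + 0
    b≡0 with ℤₚ.i*j≡0⇒i≡0∨j≡0 (coeff p 0) {b} (trans (sym (coeff₀-⊗ p (b ∷ r))) (at e 0))
    ... | inj₁ z = ⊥-elim (ne z)
    ... | inj₂ z = z
    r≋0 : r ≋ []
    r≋0 = regular-coeff₀ p ne r (regular-X (p ⊗ r) (begin
      X ⊗ (p ⊗ r)           ≈⟨ solve 3 (λ x p r → x :* (p :* r) := p :* (con (+ 0) :+ x :* r)) ≋-refl X p r ⟩
      p ⊗ (C (+ 0) ⊕ X ⊗ r) ≈⟨ *-congˡ (∷-X (+ 0) r) ⟨
      p ⊗ (+ 0 ∷ r)         ≡⟨ cong (λ b → p ⊗ (b ∷ r)) b≡0 ⟨
      p ⊗ (b ∷ r)           ≈⟨ e ⟩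
      []                    ∎))

  regular-* : ∀ {p r} → Regular p → Regular r → Regular (p ⊗ r)
  regular-* {p} {r} Rp Rr s e = Rr s (Rp (r ⊗ s) (≋-trans (≋-sym (*-assoc p r s)) e))

  regular-^ : ∀ {p} → Regular p → ∀ k → Regular (p ^ k)
  regular-^ Rp zero    s e = ≋-trans (≋-sym (*-identityˡ s)) e
  regular-^ Rp (suc k) = regular-* Rp (regular-^ Rp k)

  cancel : ∀ {p} → Regular p → ∀ {r s} → p ⊗ r ≋ p ⊗ s → r ≋ s
  cancel {p} Rp {r} {s} e = begin
    r              ≈⟨ solve 2 (λ r s → r := (r :- s) :+ s) ≋-refl r s ⟩
    (r ⊕ ⊖ s) ⊕ s  ≈⟨ +-congʳ (Rp (r ⊕ ⊖ s) (begin
        p ⊗ (r ⊕ ⊖ s)        ≈⟨ solve 3 (λ p r s → p :* (r :- s) := p :* r :- p :* s) ≋-refl p r s ⟩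
        p ⊗ r ⊕ ⊖ (p ⊗ s)    ≈⟨ +-congʳ e ⟩
        p ⊗ s ⊕ ⊖ (p ⊗ s)    ≈⟨ -‿inverseʳ (p ⊗ s) ⟩
        [] ∎)) ⟩
    [] ⊕ s         ≈⟨ +-identityˡ s ⟩
    s              ∎

  charMatrix : ∀ {n} → Matrix ℤ n → Matrix Poly n
  charMatrix S i j = X ⊗ δₚ i j ⊕ ⊖ C (S i j)

  sumFin-∑ : ∀ k (f : Fin k → Poly) → sumFin k f ≋ ∑ₚ f
  sumFin-∑ zero    f = ≋-sym (PolyMat.∑-[] f)
  sumFin-∑ (suc k) f = ≋-trans (reflexive (⊕-def _ _))
    (≋-trans (+-congˡ (sumFin-∑ k (f ∘ suc))) (≋-sym (PolyMat.∑-∷ f)))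

  alt-sgn : ∀ k p → alt k p ≡ PolyMat.sgn k p
  alt-sgn zero    p = refl
  alt-sgn (suc k) p = trans (⊖-def _) (cong ⊖_ (alt-sgn k p))

  det-≋ : ∀ n {M N : Matrix Poly n} → (∀ i j → M i j ≋ N i j) → det n M ≋ PolyMat.det N
  det-≋ zero    e = reflexive (C-def (+ 1))
  det-≋ (suc n) {M} {N} e = begin
    det (suc n) M ≈⟨ sumFin-∑ (suc n) (λ j → alt (toℕ j) (M zero j *ₚ det n (minor j M))) ⟩
    ∑ₚ (λ j → alt (toℕ j) (M zero j *ₚ det n (minor j M)))
      ≈⟨ (PolyMat.∑-cong λ j → ≋-trans (reflexive (trans (alt-sgn (toℕ j) _) (cong (PolyMat.sgn (toℕ j)) (⊗-def _ _))))
           (PolyMat.sgn-cong (toℕ j) (*-cong (e zero j) (det-≋ n λ r k → e (suc r) (punchIn j k))))) ⟩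
    PolyMat.det N ∎

  -- The entries of charPoly are local to its definition; unification recovers them.
  charEntries : ∀ {n} → Matrix ℤ n → Matrix Poly n
  charEntries {n} S = matrixOf refl
    where
    matrixOf : {M : Matrix Poly n} → charPoly n S ≡ det n M → Matrix Poly n
    matrixOf {M} _ = M

  charEntries-≋ : ∀ {n} (S : Matrix ℤ n) i j → charEntries S i j ≋ charMatrix S i j
  charEntries-≋ S i j with i Fin.≟ j
  ... | yes refl = begin
    Xₚ +ₚ constₚ (ℤ.- S i i)  ≡⟨ ⊕-def _ _ ⟩
    Xₚ ⊕ constₚ (ℤ.- S i i)   ≡⟨ cong₂ _⊕_ X-def (C-def _) ⟩
    X ⊕ C (ℤ.- S i i)         ≈⟨ +-cong (≋-sym (*-identityʳ X)) (C-neg (S i i)) ⟩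
    X ⊗ C (+ 1) ⊕ ⊖ C (S i i) ≡⟨ cong (λ d → X ⊗ d ⊕ ⊖ C (S i i)) (PolyMat.δ-refl i) ⟨
    charMatrix S i i          ∎
  ... | no ne = begin
    constₚ (ℤ.- S i j)        ≡⟨ C-def _ ⟩
    C (ℤ.- S i j)             ≈⟨ C-neg (S i j) ⟩
    ⊖ C (S i j)               ≈⟨ ≋-trans (+-congʳ (zeroʳ X)) (+-identityˡ _) ⟨
    X ⊗ [] ⊕ ⊖ C (S i j)      ≡⟨ cong (λ d → X ⊗ d ⊕ ⊖ C (S i j)) (PolyMat.δ-≢ ne) ⟨
    charMatrix S i j          ∎

  charPoly-det : ∀ {n} (S : Matrix ℤ n) → charPoly n S ≋ PolyMat.det (charMatrix S)
  charPoly-det {n} S = det-≋ n (charEntries-≋ S)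

  C-∑ : ∀ {n} (f : Fin n → ℤ) → C (∑ f) ≋ ∑ₚ (λ i → C (f i))
  C-∑ {zero}  f = ≋-trans (reflexive (cong C (ℤMat.∑-[] f))) (≋-trans C-0 (≋-sym (PolyMat.∑-[] _)))
  C-∑ {suc n} f = ≋-trans (reflexive (cong C (ℤMat.∑-∷ f)))
    (≋-trans (C-+ _ _) (≋-trans (+-congˡ (C-∑ (f ∘ suc))) (≋-sym (PolyMat.∑-∷ _))))

  C-∑* : ∀ {n} (f g : Fin n → ℤ) → ∑ₚ (λ i → C (f i) ⊗ C (g i)) ≋ C (∑ (λ i → f i * g i))
  C-∑* f g = ≋-trans (PolyMat.∑-cong λ i → ≋-sym (C-* (f i) (g i))) (≋-sym (C-∑ (λ i → f i * g i)))

  C-δ : ∀ {n} (i j : Fin n) → C (δ i j) ≋ δₚ i j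
  C-δ zero    zero    = ≋-refl
  C-δ zero    (suc j) = C-0
  C-δ (suc i) zero    = C-0
  C-δ (suc i) (suc j) = C-δ i j

  ∑-δ-diagonal : ∀ n → ∑ₚ (λ i → δₚ {n} i i) ≋ C (+ n)
  ∑-δ-diagonal zero    = ≋-trans (PolyMat.∑-[] _) (≋-sym C-0)
  ∑-δ-diagonal (suc n) = ≋-trans (PolyMat.∑-∷ _) (≋-trans (+-congˡ (∑-δ-diagonal n)) (≋-sym (C-+ (+ 1) (+ n))))

  tr : ∀ {n} → Matrix ℤ n → ℤ
  tr M = ∑ (λ i → M i i)

  quad : ℤ → Poly
  quad m = X ⊗ X ⊕ ⊖ C m

  -- The polynomial g with g(S) M = 0. It is x² for (a) and (b), x² - 1 for (c), and (x - 2)(x + 1)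
  -- for (d), that is (e, c) = (0, 0), (0, 1), (1, 2).
  cofactor : ℤ → ℤ → Poly
  cofactor e c = X ⊗ X ⊕ ⊖ (C e ⊗ X) ⊕ ⊖ C c

  -- M = m I - S², K = M S, and (S² - e S - c I) M = 0.
  record Annihilated (m e c : ℤ) {n} (S M K : Matrix ℤ n) : Set where
    field
      square : ∀ i j → ∑ (λ k → S i k * S k j) ≡ m * δ i j + - M i j
      M*S    : ∀ i j → ∑ (λ k → M i k * S k j) ≡ K i j
      K*S    : ∀ i j → ∑ (λ k → K i k * S k j) ≡ e * K i j + c * M i j

  module Resolvent {m e c : ℤ} {n} {S M K : Matrix ℤ n} (ann : Annihilated m e c S M K) where
    open Annihilated ann

    g : Poly
    g = cofactor e c

    -- (f(x) - f(S)) / (x - S) for f = (x² - e x - c)(x² - m), using f(S) = 0.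
    R : Matrix Poly n
    R i j = g ⊗ (X ⊗ δₚ i j ⊕ C (S i j)) ⊕ ⊖ ((X ⊕ ⊖ C e) ⊗ C (M i j)) ⊕ ⊖ C (K i j)

    private
      RS : ∀ i j → ∑ₚ (λ k → R i k ⊗ C (S k j)) ≋
        g ⊗ X ⊗ C (S i j) ⊕ C (+ 1) ⊗ (g ⊗ C (m * δ i j + - M i j)
          ⊕ C (+ 1) ⊗ (⊖ (X ⊕ ⊖ C e) ⊗ C (K i j) ⊕ ⊖ C (+ 1) ⊗ C (e * K i j + c * M i j)))
      RS i j = begin
        ∑ₚ (λ k → R i k ⊗ C (S k j))
          ≈⟨ (PolyMat.∑-cong λ k → solve 8
               (λ g x d s e M K t → (g :* (x :* d :+ s) :+ :- ((x :- e) :* M) :+ :- K) :* t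
                 := g :* x :* (d :* t) :+ con (+ 1) :* (g :* (s :* t)
                    :+ con (+ 1) :* (:- (x :- e) :* (M :* t) :+ :- con (+ 1) :* (K :* t))))
               ≋-refl g X (δₚ i k) (C (S i k)) (C e) (C (M i k)) (C (K i k)) (C (S k j))) ⟩
        ∑ₚ (λ k → g ⊗ X ⊗ (δₚ i k ⊗ C (S k j)) ⊕ C (+ 1) ⊗ (g ⊗ (C (S i k) ⊗ C (S k j))
          ⊕ C (+ 1) ⊗ (⊖ (X ⊕ ⊖ C e) ⊗ (C (M i k) ⊗ C (S k j)) ⊕ ⊖ C (+ 1) ⊗ (C (K i k) ⊗ C (S k j)))))
          ≈⟨ PolyMat.∑-linear _ _ (λ k → δₚ i k ⊗ C (S k j)) _ ⟩
        _ ≈⟨ +-cong (*-congˡ (PolyMat.∑-δˡ i (λ k → C (S k j))))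
               (*-congˡ (≋-trans (PolyMat.∑-linear _ _ (λ k → C (S i k) ⊗ C (S k j)) _)
                 (+-cong (*-congˡ (≋-trans (C-∑* (S i) (λ k → S k j)) (reflexive (cong C (square i j)))))
                   (*-congˡ (≋-trans (PolyMat.∑-linear _ _ (λ k → C (M i k) ⊗ C (S k j)) _)
                     (+-cong (*-congˡ (≋-trans (C-∑* (M i) (λ k → S k j)) (reflexive (cong C (M*S i j)))))
                             (*-congˡ (≋-trans (C-∑* (K i) (λ k → S k j)) (reflexive (cong C (K*S i j))))))))))) ⟩
        _ ∎

    -- The telescoping identity (f(x) - f(S)) (x - S)⁻¹ · (x - S) = f(x) written out; each power of
    -- `S` beyond the first is eliminated by one field of `Annihilated`.
    resolvent-* : ∀ i j → ∑ₚ (λ k → R i k ⊗ charMatrix S k j) ≋ g ⊗ quad m ⊗ δₚ i j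
    resolvent-* i j = begin
      ∑ₚ (λ k → R i k ⊗ charMatrix S k j)
        ≈⟨ (PolyMat.∑-cong λ k → solve 4 (λ r x d s → r :* (x :* d :- s) := x :* (r :* d) :+ :- con (+ 1) :* (r :* s))
              ≋-refl (R i k) X (δₚ k j) (C (S k j))) ⟩
      ∑ₚ (λ k → X ⊗ (R i k ⊗ δₚ k j) ⊕ ⊖ C (+ 1) ⊗ (R i k ⊗ C (S k j)))
        ≈⟨ PolyMat.∑-linear _ _ (λ k → R i k ⊗ δₚ k j) _ ⟩
      _ ≈⟨ +-cong (*-congˡ (PolyMat.∑-δʳ j (R i))) (*-congˡ (RS i j)) ⟩
      X ⊗ R i j ⊕ ⊖ C (+ 1) ⊗ (g ⊗ X ⊗ C (S i j) ⊕ C (+ 1) ⊗ (g ⊗ C (m * δ i j + - M i j)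
          ⊕ C (+ 1) ⊗ (⊖ (X ⊕ ⊖ C e) ⊗ C (K i j) ⊕ ⊖ C (+ 1) ⊗ C (e * K i j + c * M i j))))
        ≈⟨ +-congˡ (*-congˡ (+-congˡ (*-congˡ (+-cong (*-congˡ mδ-M) (*-congˡ (+-congˡ (*-congˡ eK+cM))))))) ⟩
      X ⊗ R i j ⊕ ⊖ C (+ 1) ⊗ (g ⊗ X ⊗ C (S i j) ⊕ C (+ 1) ⊗ (g ⊗ (C m ⊗ δₚ i j ⊕ ⊖ C (M i j))
          ⊕ C (+ 1) ⊗ (⊖ (X ⊕ ⊖ C e) ⊗ C (K i j) ⊕ ⊖ C (+ 1) ⊗ (C e ⊗ C (K i j) ⊕ C c ⊗ C (M i j)))))
        ≈⟨ solve 8 (λ x e c m d s M K →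
              let g = x :* x :- e :* x :- c in
              x :* (g :* (x :* d :+ s) :- (x :- e) :* M :- K) :+ :- con (+ 1) :* (g :* x :* s :+ con (+ 1) :*
                (g :* (m :* d :- M) :+ con (+ 1) :* (:- (x :- e) :* K :+ :- con (+ 1) :* (e :* K :+ c :* M))))
              := g :* (x :* x :- m) :* d)
            ≋-refl X (C e) (C c) (C m) (δₚ i j) (C (S i j)) (C (M i j)) (C (K i j)) ⟩
      g ⊗ quad m ⊗ δₚ i j ∎
      where
      mδ-M : C (m * δ i j + - M i j) ≋ C m ⊗ δₚ i j ⊕ ⊖ C (M i j)
      mδ-M = ≋-trans (C-+ _ _) (+-cong (≋-trans (C-* m (δ i j)) (*-congˡ (C-δ i j))) (C-neg (M i j)))
      eK+cM : C (e * K i j + c * M i j) ≋ C e ⊗ C (K i j) ⊕ C c ⊗ C (M i j)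
      eK+cM = ≋-trans (C-+ _ _) (+-cong (C-* e (K i j)) (C-* c (M i j)))

    private
      A : Matrix Poly n
      A = charMatrix S

    -- Evaluate R (x I - S) adj in its two bracketings: the left product is the scalar g (x² - m),
    -- the right one is the determinant. No division occurs.
    adj-resolvent : ∀ i j → g ⊗ quad m ⊗ PolyMat.adj A i j ≋ PolyMat.det A ⊗ R i j
    adj-resolvent i j = begin
      g ⊗ quad m ⊗ PolyMat.adj A i j
        ≈⟨ *-congˡ (PolyMat.∑-δˡ i (λ k → PolyMat.adj A k j)) ⟨
      g ⊗ quad m ⊗ ∑ₚ (λ k → δₚ i k ⊗ PolyMat.adj A k j)
        ≈⟨ PolyMat.*-∑ _ (λ k → δₚ i k ⊗ PolyMat.adj A k j) ⟩
      ∑ₚ (λ k → g ⊗ quad m ⊗ (δₚ i k ⊗ PolyMat.adj A k j))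
        ≈⟨ (PolyMat.∑-cong λ k → ≋-trans (≋-sym (*-assoc _ (δₚ i k) _)) (*-congʳ (≋-sym (resolvent-* i k)))) ⟩
      ∑ₚ (λ k → ∑ₚ (λ l → R i l ⊗ A l k) ⊗ PolyMat.adj A k j)
        ≈⟨ PolyMat.∑-assoc (R i) A (λ k → PolyMat.adj A k j) ⟩
      ∑ₚ (λ l → R i l ⊗ ∑ₚ (λ k → A l k ⊗ PolyMat.adj A k j))
        ≈⟨ (PolyMat.∑-cong λ l → ≋-trans (*-congˡ (PolyMat.*-adj A l j))
              (solve 3 (λ r d e → r :* (d :* e) := d :* (r :* e)) ≋-refl (R i l) (PolyMat.det A) (δₚ l j))) ⟩
      ∑ₚ (λ l → PolyMat.det A ⊗ (R i l ⊗ δₚ l j))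
        ≈⟨ PolyMat.*-∑ (PolyMat.det A) (λ l → R i l ⊗ δₚ l j) ⟨
      PolyMat.det A ⊗ ∑ₚ (λ l → R i l ⊗ δₚ l j)
        ≈⟨ *-congˡ (PolyMat.∑-δʳ j (R i)) ⟩
      PolyMat.det A ⊗ R i j ∎

    -- The trace of `adj-resolvent`: p′ = tr adj on the left, and on the right tr R, to which `S`
    -- itself contributes nothing because its diagonal is zero.
    charPoly-derivative : (∀ i → S i i ≡ + 0) →
      g ⊗ quad m ⊗ D (charPoly n S) ≋
      charPoly n S ⊗ (g ⊗ (X ⊗ C (+ n)) ⊕ ⊖ ((X ⊕ ⊖ C e) ⊗ C (tr M)) ⊕ ⊖ C (tr K))
    charPoly-derivative S₀ = begin
      g ⊗ quad m ⊗ D (charPoly n S)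
        ≈⟨ *-congˡ (≋-trans (D-cong (charPoly-det S)) (≋-trans (Der.d-det A) (PolyMat.∑-cong λ i →
             PolyMat.det-cong (row i)))) ⟩
      g ⊗ quad m ⊗ ∑ₚ (λ i → PolyMat.adj A i i)
        ≈⟨ PolyMat.*-∑ _ (λ i → PolyMat.adj A i i) ⟩
      ∑ₚ (λ i → g ⊗ quad m ⊗ PolyMat.adj A i i)
        ≈⟨ (PolyMat.∑-cong λ i → adj-resolvent i i) ⟩
      ∑ₚ (λ i → PolyMat.det A ⊗ R i i)
        ≈⟨ PolyMat.*-∑ (PolyMat.det A) (λ i → R i i) ⟨
      PolyMat.det A ⊗ ∑ₚ (λ i → R i i)
        ≈⟨ *-cong (≋-sym (charPoly-det S)) traceR ⟩
      charPoly n S ⊗ (g ⊗ (X ⊗ C (+ n)) ⊕ ⊖ ((X ⊕ ⊖ C e) ⊗ C (tr M)) ⊕ ⊖ C (tr K)) ∎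
      where
      module Der = PolyMat.Derivation D D-cong D-+ D-* D-neg ≋-refl (D-C (+ 1))
      D-entry : ∀ i j → D (A i j) ≋ δₚ i j
      D-entry i j = begin
        D (X ⊗ δₚ i j ⊕ ⊖ C (S i j))
          ≈⟨ D-+ (X ⊗ δₚ i j) (⊖ C (S i j)) ⟩
        D (X ⊗ δₚ i j) ⊕ D (⊖ C (S i j))
          ≈⟨ +-cong (≋-trans (D-* X (δₚ i j)) (+-cong (*-congʳ D-X) (*-congˡ
                (≋-trans (D-cong (≋-sym (C-δ i j))) (D-C (δ i j))))))
                (≋-trans (D-neg (C (S i j))) (-‿cong (D-C (S i j)))) ⟩
        C (+ 1) ⊗ δₚ i j ⊕ X ⊗ [] ⊕ ⊖ []
          ≈⟨ +-cong (≋-trans (+-cong (*-identityˡ _) (zeroʳ X)) (+-identityʳ _)) -0#≈0# ⟩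
        δₚ i j ⊕ []
          ≈⟨ +-identityʳ _ ⟩
        δₚ i j ∎
      row : ∀ i r k → updateAt A i (D ∘_) r k ≋ PolyMat.setRow A i (δₚ i) r k
      row i r k with r Fin.≟ i
      ... | yes refl = ≋-trans (reflexive (cong (λ f → f k) (updateAt-updates i A)))
              (≋-trans (D-entry i k) (reflexive (sym (cong (λ f → f k) (updateAt-updates i A)))))
      ... | no ne    = reflexive (cong (λ f → f k)
              (trans (updateAt-minimal r i A ne) (sym (updateAt-minimal r i A ne))))
      traceR : ∑ₚ (λ i → R i i) ≋ g ⊗ (X ⊗ C (+ n)) ⊕ ⊖ ((X ⊕ ⊖ C e) ⊗ C (tr M)) ⊕ ⊖ C (tr K)
      traceR = begin
        ∑ₚ (λ i → R i i)
          ≈⟨ (PolyMat.∑-cong λ i → ≋-trans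
               (+-congʳ (+-congʳ (*-congˡ (≋-trans (+-congˡ (≋-trans (reflexive (cong C (S₀ i))) C-0)) (+-identityʳ _)))))
               (solve 6 (λ g x d e M K → g :* (x :* d) :- (x :- e) :* M :- K :=
                   (g :* x) :* d :+ con (+ 1) :* (:- (x :- e) :* M :+ :- con (+ 1) :* K))
                 ≋-refl g X (δₚ i i) (C e) (C (M i i)) (C (K i i)))) ⟩
        ∑ₚ (λ i → g ⊗ X ⊗ δₚ i i ⊕ C (+ 1) ⊗ (⊖ (X ⊕ ⊖ C e) ⊗ C (M i i) ⊕ ⊖ C (+ 1) ⊗ C (K i i)))
          ≈⟨ PolyMat.∑-linear _ _ (λ i → δₚ i i) _ ⟩
        _ ≈⟨ +-cong (*-congˡ (∑-δ-diagonal n)) (*-congˡ (≋-trans (PolyMat.∑-linear _ _ (λ i → C (M i i)) _)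
               (+-cong (*-congˡ (≋-sym (C-∑ λ i → M i i))) (*-congˡ (≋-sym (C-∑ λ i → K i i)))))) ⟩
        g ⊗ X ⊗ C (+ n) ⊕ C (+ 1) ⊗ (⊖ (X ⊕ ⊖ C e) ⊗ C (tr M) ⊕ ⊖ C (+ 1) ⊗ C (tr K))
          ≈⟨ solve 6 (λ g x n e M K → (g :* x) :* n :+ con (+ 1) :* (:- (x :- e) :* M :+ :- con (+ 1) :* K)
                 := g :* (x :* n) :- (x :- e) :* M :- K)
               ≋-refl g X (C (+ n)) (C e) (C (tr M)) (C (tr K)) ⟩
        _ ∎

  dropFirst : ∀ {n} → Matrix ℤ (suc n) → Matrix ℤ n
  dropFirst S i j = S (suc i) (suc j)

  -- The (0,0) entry of `adj-resolvent`, since this entry of the adjugate of x I - S is the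
  -- determinant with row and column 0 deleted.
  charPoly-dropFirst : ∀ {m e c n} {S M K : Matrix ℤ (suc n)} → Annihilated m e c S M K → S zero zero ≡ + 0 →
    cofactor e c ⊗ quad m ⊗ charPoly n (dropFirst S) ≋
    charPoly (suc n) S ⊗ (cofactor e c ⊗ X ⊕ ⊖ ((X ⊕ ⊖ C e) ⊗ C (M zero zero)) ⊕ ⊖ C (K zero zero))
  charPoly-dropFirst {m} {e} {c} {n} {S} {M} {K} ann S₀ = begin
    g ⊗ quad m ⊗ charPoly n (dropFirst S)
      ≈⟨ *-congˡ (≋-trans (charPoly-det (dropFirst S)) (≋-sym (PolyMat.adj₀₀ (charMatrix S)))) ⟩
    g ⊗ quad m ⊗ PolyMat.adj (charMatrix S) zero zero
      ≈⟨ adj-resolvent zero zero ⟩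
    PolyMat.det (charMatrix S) ⊗ R zero zero
      ≈⟨ *-cong (≋-sym (charPoly-det S)) (+-congʳ (+-congʳ (*-congˡ (≋-trans
           (+-cong (*-identityʳ X) (≋-trans (reflexive (cong C S₀)) C-0)) (+-identityʳ X))))) ⟩
    _ ∎
    where open Resolvent ann

  -- Substituting -x in x I - S gives the negative of x I - (- S), and an even order absorbs the
  -- sign.
  charPoly-neg : ∀ k {n} (S : Matrix ℤ n) → n ≡ 2 ℕ.* k →
    charPoly n (λ i j → - S i j) ≋ reflect (charPoly n S)
  charPoly-neg k {n} S refl = begin
    charPoly n (λ i j → - S i j)
      ≈⟨ charPoly-det (λ i j → - S i j) ⟩
    PolyMat.det (charMatrix (λ i j → - S i j))
      ≈⟨ PolyMat.sgn-even k _ ⟨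
    PolyMat.sgn n (PolyMat.det (charMatrix (λ i j → - S i j)))
      ≈⟨ PolyMat.det-neg (charMatrix (λ i j → - S i j)) ⟨
    PolyMat.det (λ i j → ⊖ charMatrix (λ i j → - S i j) i j)
      ≈⟨ PolyMat.det-cong (λ i j → ≋-sym (entry i j)) ⟩
    PolyMat.det (λ i j → reflect (charMatrix S i j))
      ≈⟨ Endo.h-det (charMatrix S) ⟨
    reflect (PolyMat.det (charMatrix S))
      ≈⟨ reflect-cong (charPoly-det S) ⟨
    reflect (charPoly n S) ∎
    where
    module Endo = PolyMat.Endomorphism reflect reflect-cong reflect-+ reflect-* reflect-neg ≋-refl (reflect-C (+ 1))
    entry : ∀ i j → reflect (charMatrix S i j) ≋ ⊖ charMatrix (λ i j → - S i j) i j
    entry i j = begin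
      reflect (X ⊗ δₚ i j ⊕ ⊖ C (S i j))
        ≈⟨ reflect-+ (X ⊗ δₚ i j) (⊖ C (S i j)) ⟩
      reflect (X ⊗ δₚ i j) ⊕ reflect (⊖ C (S i j))
        ≈⟨ +-cong (≋-trans (reflect-* X (δₚ i j)) (*-cong reflect-X
              (≋-trans (reflect-cong (≋-sym (C-δ i j))) (≋-trans (reflect-C (δ i j)) (C-δ i j)))))
             (≋-trans (reflect-neg (C (S i j))) (-‿cong (reflect-C (S i j)))) ⟩
      ⊖ X ⊗ δₚ i j ⊕ ⊖ C (S i j)
        ≈⟨ solve 3 (λ x d s → :- x :* d :- s := :- (x :* d :- :- s)) ≋-refl X (δₚ i j) (C (S i j)) ⟩
      ⊖ (X ⊗ δₚ i j ⊕ ⊖ ⊖ C (S i j))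
        ≈⟨ -‿cong (+-congˡ (-‿cong (C-neg (S i j)))) ⟨
      ⊖ charMatrix (λ i j → - S i j) i j ∎

open CharacteristicPolynomials

-- Sums of squares of integers.

0≤x² : ∀ x → + 0 ≤ x * x
0≤x² (+ n)      = subst (+ 0 ≤_) (ℤₚ.pos-* n n) (+≤+ z≤n)
0≤x² (-[1+ n ]) = +≤+ z≤n

∑-nonneg : ∀ {n} (f : Fin n → ℤ) → (∀ i → + 0 ≤ f i) → + 0 ≤ ∑ f
∑-nonneg {zero}  f f≥0 = ℤₚ.≤-reflexive (sym (∑-[] f))
∑-nonneg {suc n} f f≥0 = subst (+ 0 ≤_) (sym (∑-∷ f))
  (ℤₚ.+-mono-≤ (f≥0 zero) (∑-nonneg (f ∘ suc) (f≥0 ∘ suc)))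

∑≡0⇒≡0 : ∀ {n} (f : Fin n → ℤ) → (∀ i → + 0 ≤ f i) → ∑ f ≡ + 0 → ∀ i → f i ≡ + 0
∑≡0⇒≡0 {suc n} f f≥0 e = go
  where
  rest≥0 = ∑-nonneg (f ∘ suc) (f≥0 ∘ suc)
  split : f zero + ∑ (f ∘ suc) ≡ + 0
  split = trans (sym (∑-∷ f)) e
  f₀≡0 : f zero ≡ + 0
  f₀≡0 = ℤₚ.≤-antisym (subst (f zero ≤_) split
    (subst (_≤ f zero + ∑ (f ∘ suc)) (ℤₚ.+-identityʳ _) (ℤₚ.+-monoʳ-≤ (f zero) rest≥0))) (f≥0 zero)
  go : ∀ i → f i ≡ + 0
  go zero    = f₀≡0
  go (suc i) = ∑≡0⇒≡0 (f ∘ suc) (f≥0 ∘ suc)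
    (trans (sym (ℤₚ.+-identityˡ _)) (trans (cong (λ z → z + ∑ (f ∘ suc)) (sym f₀≡0)) split)) i

∑²≡0⇒≡0 : ∀ {n} (f : Fin n → ℤ) → ∑ (λ i → f i * f i) ≡ + 0 → ∀ i → f i ≡ + 0
∑²≡0⇒≡0 f e i with ℤₚ.i*j≡0⇒i≡0∨j≡0 (f i) (∑≡0⇒≡0 (λ i → f i * f i) (λ i → 0≤x² (f i)) e i)
... | inj₁ z = z
... | inj₂ z = z

-- The row vector v p(S).
act : ∀ {n} → Matrix ℤ n → Poly → (Fin n → ℤ) → Fin n → ℤ
act S []      v j = + 0
act S (a ∷ p) v j = a * v j + ∑ (λ i → act S p v i * S i j)

-- Polynomials in a matrix acting on row vectors: Cayley-Hamilton and radicals.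

module _ {n} (S : Matrix ℤ n) where
  open ≡-Reasoning

  act-0 : ∀ p v → p ≋ [] → ∀ j → act S p v j ≡ + 0
  act-0 []      v e j = refl
  act-0 (a ∷ p) v e j = cong₂ _+_ (cong (_* v j) (at e 0))
    (∑-0 λ i → cong (_* S i j) (act-0 p v (coeffwise λ n → at e (suc n)) i))

  act-cong : ∀ {p r} → p ≋ r → ∀ v j → act S p v j ≡ act S r v j
  act-cong {[]}    {r}     e v j = sym (act-0 r v (≋-sym e) j)
  act-cong {a ∷ p} {[]}    e v j = act-0 (a ∷ p) v e j
  act-cong {a ∷ p} {b ∷ r} e v j = cong₂ _+_ (cong (_* v j) (at e 0))
    (∑-cong λ i → cong (_* S i j) (act-cong {p} {r} (coeffwise λ n → at e (suc n)) v i))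

  act-⊕ : ∀ p r v j → act S (p ⊕ r) v j ≡ act S p v j + act S r v j
  act-⊕ p r v j = trans (cong (λ p → act S p v j) (sym (⊕-def p r))) (lem p r j)
    where
    lem : ∀ p r j → act S (p +ₚ r) v j ≡ act S p v j + act S r v j
    lem []      r       j = sym (ℤₚ.+-identityˡ _)
    lem (a ∷ p) []      j = sym (ℤₚ.+-identityʳ _)
    lem (a ∷ p) (b ∷ r) j = begin
      (a + b) * v j + ∑ (λ i → act S (p +ₚ r) v i * S i j)
        ≡⟨ cong₂ _+_ (refl {x = (a + b) * v j}) (trans (∑-cong λ i → trans (cong (_* S i j) (lem p r i))
             (ℤₚ.*-distribʳ-+ (S i j) (act S p v i) (act S r v i))) (∑-+ (λ i → act S p v i * S i j) (λ i → act S r v i * S i j))) ⟩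
      (a + b) * v j + (∑ (λ i → act S p v i * S i j) + ∑ (λ i → act S r v i * S i j))
        ≡⟨ ring-lem a b (v j) _ _ ⟩
      _ ∎
      where
      ring-lem : ∀ a b v s t → (a + b) * v + (s + t) ≡ (a * v + s) + (b * v + t)
      ring-lem = solve-∀

  act-X⊗ : ∀ p v j → act S (X ⊗ p) v j ≡ ∑ (λ i → act S p v i * S i j)
  act-X⊗ p v j = trans (act-cong (X⊗ p) v j) (ℤₚ.+-identityˡ _)

  act-C⊗ : ∀ a p v j → act S (C a ⊗ p) v j ≡ a * act S p v j
  act-C⊗ a [] v j = trans (act-0 (C a ⊗ []) v (zeroʳ (C a)) j) (sym (ℤₚ.*-zeroʳ a))
  act-C⊗ a (b ∷ p) v j = begin
    act S (C a ⊗ (b ∷ p)) v j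
      ≡⟨ act-cong lem v j ⟩
    (a * b) * v j + ∑ (λ i → act S (C a ⊗ p) v i * S i j)
      ≡⟨ cong₂ _+_ (ℤₚ.*-assoc a b (v j)) (trans
           (∑-cong λ i → trans (cong (_* S i j) (act-C⊗ a p v i)) (ℤₚ.*-assoc a (act S p v i) (S i j)))
           (sym (*-∑ a (λ i → act S p v i * S i j)))) ⟩
    a * (b * v j) + a * ∑ (λ i → act S p v i * S i j)
      ≡⟨ ℤₚ.*-distribˡ-+ a _ _ ⟨
    a * act S (b ∷ p) v j ∎
    where
    lem : C a ⊗ (b ∷ p) ≋ (a * b) ∷ (C a ⊗ p)
    lem = coeffwise λ { zero → coeff-C⊗ a (b ∷ p) 0
                      ; (suc n) → trans (coeff-C⊗ a (b ∷ p) (suc n)) (sym (coeff-C⊗ a p n)) }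

  act-C : ∀ a v j → act S (C a) v j ≡ a * v j
  act-C a v j = trans (cong (λ p → act S p v j) (sym (C-def a)))
    (trans (cong₂ _+_ (refl {x = a * v j}) (∑-0 λ i → refl)) (ℤₚ.+-identityʳ _))

  act-⊖ : ∀ p v j → act S (⊖ p) v j ≡ - act S p v j
  act-⊖ p v j = trans (act-cong (⊖-C p) v j) (trans (act-C⊗ _ p v j) (ℤₚ.-1*i≡-i _))

  act-⊗ : ∀ p r v j → act S (p ⊗ r) v j ≡ act S p (act S r v) j
  act-⊗ []      r v j = act-0 ([] ⊗ r) v (zeroˡ r) j
  act-⊗ (a ∷ p) r v j = begin
    act S ((a ∷ p) ⊗ r) v j
      ≡⟨ act-cong (≋-trans (*-congʳ (∷-X a p))
           (solve 4 (λ a x p r → (a :+ x :* p) :* r := a :* r :+ x :* (p :* r)) ≋-refl (C a) X p r)) v j ⟩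
    act S (C a ⊗ r ⊕ X ⊗ (p ⊗ r)) v j
      ≡⟨ act-⊕ (C a ⊗ r) (X ⊗ (p ⊗ r)) v j ⟩
    act S (C a ⊗ r) v j + act S (X ⊗ (p ⊗ r)) v j
      ≡⟨ cong₂ _+_ (act-C⊗ a r v j) (trans (act-X⊗ (p ⊗ r) v j)
           (∑-cong λ i → cong (_* S i j) (act-⊗ p r v i))) ⟩
    act S (a ∷ p) (act S r v) j ∎

  act-congᵥ : ∀ p {v w} → (∀ j → v j ≡ w j) → ∀ j → act S p v j ≡ act S p w j
  act-congᵥ []      e j = refl
  act-congᵥ (a ∷ p) e j = cong₂ _+_ (cong (a *_) (e j)) (∑-cong λ i → cong (_* S i j) (act-congᵥ p e i))

  act-∑ : ∀ {l} p (a : Fin l → ℤ) (f : Fin l → Fin n → ℤ) j →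
    act S p (λ j → ∑ (λ k → a k * f k j)) j ≡ ∑ (λ k → a k * act S p (f k) j)
  act-∑ []      a f j = sym (∑-0 λ k → ℤₚ.*-zeroʳ (a k))
  act-∑ (b ∷ p) a f j = begin
    b * ∑ (λ k → a k * f k j) + ∑ (λ i → act S p (λ j → ∑ (λ k → a k * f k j)) i * S i j)
      ≡⟨ cong₂ _+_ (trans (*-∑ b (λ k → a k * f k j)) (∑-cong λ k → lem b (a k) (f k j)))
           (trans (∑-cong λ i → cong (_* S i j) (act-∑ p a f i))
                    (∑-assoc a (λ k → act S p (f k)) (λ i → S i j))) ⟩
    ∑ (λ k → a k * (b * f k j)) + ∑ (λ k → a k * ∑ (λ i → act S p (f k) i * S i j))
      ≡⟨ ∑-+ (λ k → a k * (b * f k j)) _ ⟨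
    ∑ (λ k → a k * (b * f k j) + a k * ∑ (λ i → act S p (f k) i * S i j))
      ≡⟨ (∑-cong λ k → sym (ℤₚ.*-distribˡ-+ (a k) _ _)) ⟩
    ∑ (λ k → a k * act S (b ∷ p) (f k) j) ∎
    where
    lem : ∀ b a f → b * (a * f) ≡ a * (b * f)
    lem = solve-∀

  act-zeroᵥ : ∀ p j → act S p (λ _ → + 0) j ≡ + 0
  act-zeroᵥ p j = trans (act-congᵥ p (λ j → sym (∑-[] _)) j)
    (trans (act-∑ {0} p (λ ()) (λ ()) j) (∑-[] _))

  act-basis : ∀ p → (∀ k j → act S p (δ k) j ≡ + 0) → ∀ v j → act S p v j ≡ + 0
  act-basis p e v j = trans (act-congᵥ p (λ j → sym (∑-δʳ j v)) j)
    (trans (act-∑ p v δ j) (∑-0 λ k → trans (cong (v k *_) (e k j)) (ℤₚ.*-zeroʳ (v k))))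

  act-∑ₚ : ∀ {l} (p : Fin l → Poly) v j → act S (∑ₚ p) v j ≡ ∑ (λ i → act S (p i) v j)
  act-∑ₚ {zero}  p v j = trans (act-cong (PolyMat.∑-[] p) v j) (sym (∑-[] _))
  act-∑ₚ {suc l} p v j = trans (act-cong (PolyMat.∑-∷ p) v j)
    (trans (act-⊕ (p zero) (∑ₚ (p ∘ suc)) v j)
      (trans (cong₂ _+_ (refl {x = act S (p zero) v j}) (act-∑ₚ (p ∘ suc) v j)) (sym (∑-∷ _))))

  act-X : ∀ v j → act S X v j ≡ ∑ (λ i → v i * S i j)
  act-X v j = trans (act-cong (≋-sym (*-identityʳ X)) v j) (trans (act-X⊗ (C (+ 1)) v j)
    (∑-cong λ i → cong (_* S i j) (trans (act-C (+ 1) v i) (ℤₚ.*-identityˡ (v i)))))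

  module _ (S-sym : ∀ i j → S i j ≡ S j i) where

    -- The sum is row `l` of `S` minus column `l` of `S`, zero by symmetry. The factor `+ 1` fits
    -- the shape of `act-∑`.
    act-charMatrix : ∀ l j → ∑ (λ i → + 1 * act S (charMatrix S i l) (δ i) j) ≡ + 0
    act-charMatrix l j = begin
      ∑ (λ i → + 1 * act S (charMatrix S i l) (δ i) j)
        ≡⟨ (∑-cong λ i → begin
             + 1 * act S (charMatrix S i l) (δ i) j
               ≡⟨ ℤₚ.*-identityˡ _ ⟩
             act S (X ⊗ δₚ i l ⊕ ⊖ C (S i l)) (δ i) j
               ≡⟨ act-⊕ (X ⊗ δₚ i l) (⊖ C (S i l)) (δ i) j ⟩
             act S (X ⊗ δₚ i l) (δ i) j + act S (⊖ C (S i l)) (δ i) j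
               ≡⟨ cong₂ _+_ (trans (act-cong (≋-trans (*-congˡ (≋-sym (C-δ i l))) (*-comm X _)) (δ i) j)
                    (trans (act-C⊗ (δ i l) X (δ i) j) (cong (δ i l *_)
                      (trans (act-X (δ i) j) (∑-δˡ i (λ k → S k j))))))
                  (trans (act-⊖ (C (S i l)) (δ i) j) (cong -_ (act-C (S i l) (δ i) j))) ⟩
             δ i l * S i j + - (S i l * δ i j)
               ≡⟨ lem (δ i l) (S i j) (S i l) (δ i j) ⟩
             + 1 * (S i j * δ i l) + - (+ 1) * (S i l * δ i j) ∎) ⟩
      ∑ (λ i → + 1 * (S i j * δ i l) + - (+ 1) * (S i l * δ i j))
        ≡⟨ ∑-linear (+ 1) (- (+ 1)) (λ i → S i j * δ i l) (λ i → S i l * δ i j) ⟩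
      + 1 * ∑ (λ i → S i j * δ i l) + - (+ 1) * ∑ (λ i → S i l * δ i j)
        ≡⟨ cong₂ (λ a b → + 1 * a + - (+ 1) * b) (∑-δʳ l (λ i → S i j)) (trans (∑-δʳ j (λ i → S i l)) (S-sym j l)) ⟩
      + 1 * S l j + - (+ 1) * S l j
        ≡⟨ lem′ (S l j) ⟩
      + 0 ∎
      where
      lem : ∀ a b c d → a * b + - (c * d) ≡ + 1 * (b * a) + - (+ 1) * (c * d)
      lem = solve-∀
      lem′ : ∀ a → + 1 * a + - (+ 1) * a ≡ + 0
      lem′ = solve-∀

    -- With A = x I - S and A B = p I: in ∑ᵢ eᵢ (A B)ᵢₖ(S) the inner sums ∑ᵢ eᵢ Aᵢₗ(S) vanish.
    cayleyHamilton : ∀ v j → act S (charPoly n S) v j ≡ + 0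
    cayleyHamilton v j = trans (act-cong (charPoly-det S) v j) (act-basis (PolyMat.det A) basis v j)
      where
      A = charMatrix S
      B = PolyMat.adj A
      p = PolyMat.det A
      basis : ∀ k j → act S p (δ k) j ≡ + 0
      basis k j = begin
        act S p (δ k) j
          ≡⟨ ∑-δˡ k (λ i → act S p (δ i) j) ⟨
        ∑ (λ i → δ k i * act S p (δ i) j)
          ≡⟨ (∑-cong λ i → trans (cong (_* act S p (δ i) j) (δ-sym k i))
               (sym (trans (act-cong (≋-trans (*-congˡ (≋-sym (C-δ i k))) (*-comm p _)) (δ i) j)
                        (act-C⊗ (δ i k) p (δ i) j)))) ⟩
        ∑ (λ i → act S (p ⊗ δₚ i k) (δ i) j)
          ≡⟨ (∑-cong λ i → trans (act-cong (≋-sym (PolyMat.*-adj A i k)) (δ i) j)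
               (act-∑ₚ (λ l → A i l ⊗ B l k) (δ i) j)) ⟩
        ∑ (λ i → ∑ (λ l → act S (A i l ⊗ B l k) (δ i) j))
          ≡⟨ (∑-cong λ i → ∑-cong λ l → trans (act-cong (*-comm (A i l) (B l k)) (δ i) j)
               (act-⊗ (B l k) (A i l) (δ i) j)) ⟩
        ∑ (λ i → ∑ (λ l → act S (B l k) (act S (A i l) (δ i)) j))
          ≡⟨ ∑-comm (λ i l → act S (B l k) (act S (A i l) (δ i)) j) ⟩
        ∑ (λ l → ∑ (λ i → act S (B l k) (act S (A i l) (δ i)) j))
          ≡⟨ (∑-cong λ l → ∑-cong λ i → sym (ℤₚ.*-identityˡ _)) ⟩
        ∑ (λ l → ∑ (λ i → + 1 * act S (B l k) (act S (A i l) (δ i)) j))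
          ≡⟨ (∑-0 λ l → trans (sym (act-∑ (B l k) (λ _ → + 1) (λ i → act S (A i l) (δ i)) j))
               (trans (act-congᵥ (B l k) (act-charMatrix l) j) (act-zeroᵥ (B l k) j))) ⟩
        + 0 ∎

    -- Symmetry of `S` moves one factor across the product; that factor then commutes past p(S).
    act-selfAdjoint : ∀ p u v → ∑ (λ j → act S p u j * v j) ≡ ∑ (λ j → u j * act S p v j)
    act-selfAdjoint [] u v = trans (∑-0 λ j → refl) (sym (∑-0 λ j → ℤₚ.*-zeroʳ (u j)))
    act-selfAdjoint (a ∷ p) u v = begin
      ∑ (λ j → (a * u j + ∑ (λ i → act S p u i * S i j)) * v j)
        ≡⟨ (∑-cong λ j → ring-lem a (u j) (v j) (∑ (λ i → act S p u i * S i j))) ⟩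
      ∑ (λ j → a * (u j * v j) + + 1 * (∑ (λ i → act S p u i * S i j) * v j))
        ≡⟨ ∑-linear a (+ 1) (λ j → u j * v j) (λ j → ∑ (λ i → act S p u i * S i j) * v j) ⟩
      a * ∑ (λ j → u j * v j) + + 1 * ∑ (λ j → ∑ (λ i → act S p u i * S i j) * v j)
        ≡⟨ cong (λ z → a * ∑ (λ j → u j * v j) + + 1 * z) (begin
             ∑ (λ j → ∑ (λ i → act S p u i * S i j) * v j)
               ≡⟨ ∑-assoc (act S p u) S v ⟩
             ∑ (λ i → act S p u i * ∑ (λ j → S i j * v j))
               ≡⟨ act-selfAdjoint p u (λ i → ∑ (λ j → S i j * v j)) ⟩
             ∑ (λ i → u i * act S p (λ i → ∑ (λ j → S i j * v j)) i)
               ≡⟨ (∑-cong λ i → cong (u i *_) (begin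
                    act S p (λ i → ∑ (λ j → S i j * v j)) i
                      ≡⟨ act-congᵥ p (λ i → ∑-cong λ j → trans (cong (_* v j) (S-sym i j)) (ℤₚ.*-comm (S j i) (v j))) i ⟩
                    act S p (λ i → ∑ (λ j → v j * S j i)) i
                      ≡⟨ act-congᵥ p (λ i → sym (act-X v i)) i ⟩
                    act S p (act S X v) i
                      ≡⟨ act-⊗ p X v i ⟨
                    act S (p ⊗ X) v i
                      ≡⟨ act-cong (*-comm p X) v i ⟩
                    act S (X ⊗ p) v i
                      ≡⟨ act-X⊗ p v i ⟩
                    ∑ (λ k → act S p v k * S k i) ∎)) ⟩
             ∑ (λ i → u i * ∑ (λ k → act S p v k * S k i)) ∎) ⟩
      a * ∑ (λ j → u j * v j) + + 1 * ∑ (λ i → u i * ∑ (λ k → act S p v k * S k i))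
        ≡⟨ ∑-linear a (+ 1) (λ j → u j * v j) _ ⟨
      ∑ (λ j → a * (u j * v j) + + 1 * (u j * ∑ (λ k → act S p v k * S k j)))
        ≡⟨ (∑-cong λ j → ring-lem′ a (u j) (v j) (∑ (λ k → act S p v k * S k j))) ⟩
      ∑ (λ j → u j * act S (a ∷ p) v j) ∎
      where
      ring-lem : ∀ a u v s → (a * u + s) * v ≡ a * (u * v) + + 1 * (s * v)
      ring-lem = solve-∀
      ring-lem′ : ∀ a u v s → a * (u * v) + + 1 * (u * s) ≡ u * (a * v + s)
      ring-lem′ = solve-∀

    -- A symmetric matrix has no nilpotent part. If rᵏ⁺²(S) = 0, then |v rᵏ⁺¹(S)|² = v · v r²ᵏ⁺²(S),
    -- which vanishes because 2k + 2 ≥ k + 2; so the exponent can be lowered until it is 1.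
    act-radical : ∀ r k → (∀ v j → act S (r ^ suc k) v j ≡ + 0) → ∀ v j → act S r v j ≡ + 0
    act-radical r zero    e v j = trans (act-cong (≋-sym (*-identityʳ r)) v j) (e v j)
    act-radical r (suc k) e = act-radical r k λ v → ∑²≡0⇒≡0 (act S (r ^ suc k) v) (begin
      ∑ (λ j → act S (r ^ suc k) v j * act S (r ^ suc k) v j)
        ≡⟨ act-selfAdjoint (r ^ suc k) v (act S (r ^ suc k) v) ⟩
      ∑ (λ j → v j * act S (r ^ suc k) (act S (r ^ suc k) v) j)
        ≡⟨ (∑-0 λ j → trans (cong (v j *_) (begin
             act S (r ^ suc k) (act S (r ^ suc k) v) j    ≡⟨ act-⊗ (r ^ suc k) (r ^ suc k) v j ⟨
             act S ((r ^ suc k) ⊗ (r ^ suc k)) v j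
               ≡⟨ act-cong (solve 2 (λ r p → r :* p :* (r :* p) := p :* (r :* (r :* p))) ≋-refl r (r ^ k)) v j ⟩
             act S ((r ^ k) ⊗ (r ^ suc (suc k))) v j      ≡⟨ act-⊗ (r ^ k) (r ^ suc (suc k)) v j ⟩
             act S (r ^ k) (act S (r ^ suc (suc k)) v) j  ≡⟨ act-congᵥ (r ^ k) (e v) j ⟩
             act S (r ^ k) (λ _ → + 0) j                  ≡⟨ act-zeroᵥ (r ^ k) j ⟩
             + 0                                          ∎)) (ℤₚ.*-zeroʳ (v j))) ⟩
      + 0 ∎)

defect : ℤ → ∀ {n} → Matrix ℤ n → Matrix ℤ n
defect m S i j = m * δ i j + - ∑ (λ k → S i k * S k j)

_·_ : ∀ {n} → Matrix ℤ n → Matrix ℤ n → Matrix ℤ n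
(A · B) i j = ∑ (λ k → A i k * B k j)

module _ (m : ℤ) {n} (S : Matrix ℤ n) where
  open ≡-Reasoning

  act-quad : ∀ i j → act S (quad m) (δ i) j ≡ - defect m S i j
  act-quad i j = begin
    act S (X ⊗ X ⊕ ⊖ C m) (δ i) j
      ≡⟨ act-⊕ S (X ⊗ X) (⊖ C m) (δ i) j ⟩
    act S (X ⊗ X) (δ i) j + act S (⊖ C m) (δ i) j
      ≡⟨ cong₂ _+_ (trans (act-X⊗ S X (δ i) j) (∑-cong λ k → cong (_* S k j)
           (trans (act-X S (δ i) k) (∑-δˡ i (λ l → S l k)))))
         (trans (act-⊖ S (C m) (δ i) j) (cong -_ (act-C S m (δ i) j))) ⟩
    ∑ (λ k → S i k * S k j) + - (m * δ i j)
      ≡⟨ lem (∑ (λ k → S i k * S k j)) (m * δ i j) ⟩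
    - defect m S i j ∎
    where
    lem : ∀ a b → a + - b ≡ - (b + - a)
    lem = solve-∀

  -- Row i of M is minus the image of the i-th unit vector under S² - m I, so applying the
  -- hypothesis to unit vectors leaves exactly the relation for K S.
  annihilated : ∀ e c → (∀ v j → act S (cofactor e c ⊗ quad m) v j ≡ + 0) →
    Annihilated m e c S (defect m S) (defect m S · S)
  annihilated e c h = record { square = λ i j → lem (m * δ i j) _ ; M*S = λ i j → refl ; K*S = K*S }
    where
    M = defect m S
    K = M · S
    lem : ∀ a b → b ≡ a + - (a + - b)
    lem = solve-∀
    neg-* : ∀ a b → - a * b ≡ - (+ 1) * (a * b)
    neg-* = solve-∀
    X₁ : ∀ i k → act S X (λ k → - M i k) k ≡ - K i k
    X₁ i k = trans (act-X S (λ k → - M i k) k) (trans (∑-cong λ l → neg-* (M i l) (S l k))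
        (trans (sym (*-∑ (- (+ 1)) (λ l → M i l * S l k))) (ℤₚ.-1*i≡-i _)))
    XX : ∀ i j → act S (X ⊗ X) (λ k → - M i k) j ≡ - ∑ (λ k → K i k * S k j)
    XX i j = begin
      act S (X ⊗ X) (λ k → - M i k) j
        ≡⟨ act-X⊗ S X (λ k → - M i k) j ⟩
      ∑ (λ k → act S X (λ k → - M i k) k * S k j)
        ≡⟨ (∑-cong λ k → trans (cong (_* S k j) (X₁ i k)) (neg-* (K i k) (S k j))) ⟩
      ∑ (λ k → - (+ 1) * (K i k * S k j))
        ≡⟨ *-∑ (- (+ 1)) (λ k → K i k * S k j) ⟨
      - (+ 1) * ∑ (λ k → K i k * S k j)
        ≡⟨ ℤₚ.-1*i≡-i _ ⟩
      _ ∎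
    K*S : ∀ i j → ∑ (λ k → K i k * S k j) ≡ e * K i j + c * M i j
    K*S i j = begin
      ∑ (λ k → K i k * S k j)
        ≡⟨ ring-lem (∑ (λ k → K i k * S k j)) e (K i j) c (M i j) ⟩
      e * K i j + c * M i j + - (- ∑ (λ k → K i k * S k j) + - (e * - K i j) + - (c * - M i j))
        ≡⟨ cong (λ z → e * K i j + c * M i j + - z) (begin
             - ∑ (λ k → K i k * S k j) + - (e * - K i j) + - (c * - M i j)
               ≡⟨ cong₂ _+_ (cong₂ _+_ (XX i j) (trans (act-⊖ S (C e ⊗ X) w j) (cong -_
                    (trans (act-C⊗ S e X w j) (cong (e *_) (X₁ i j))))))
                  (trans (act-⊖ S (C c) w j) (cong -_ (act-C S c w j))) ⟨
             act S (X ⊗ X) w j + act S (⊖ (C e ⊗ X)) w j + act S (⊖ C c) w j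
               ≡⟨ cong₂ _+_ (act-⊕ S (X ⊗ X) (⊖ (C e ⊗ X)) w j) refl ⟨
             act S (X ⊗ X ⊕ ⊖ (C e ⊗ X)) w j + act S (⊖ C c) w j
               ≡⟨ act-⊕ S (X ⊗ X ⊕ ⊖ (C e ⊗ X)) (⊖ C c) w j ⟨
             act S (cofactor e c) w j
               ≡⟨ act-congᵥ S (cofactor e c) (act-quad i) j ⟨
             act S (cofactor e c) (act S (quad m) (δ i)) j
               ≡⟨ act-⊗ S (cofactor e c) (quad m) (δ i) j ⟨
             act S (cofactor e c ⊗ quad m) (δ i) j
               ≡⟨ h (δ i) j ⟩
             + 0 ∎) ⟩
      e * K i j + c * M i j + - (+ 0)
        ≡⟨ ℤₚ.+-identityʳ _ ⟩
      e * K i j + c * M i j ∎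
      where
      w = λ k → - M i k
      ring-lem : ∀ s e k c m → s ≡ e * k + c * m + - (- s + - (e * - k) + - (c * - m))
      ring-lem = solve-∀

-- Order and trace read off from a characteristic polynomial.

infix 4 _≋C_
_≋C_ : Poly → ℤ → Set
p ≋C a = p ≋ C a

private
  C≋ : ∀ {a} → C a ≋C a
  C≋ = ≋-refl

  _⊕C_ : ∀ {p r a b} → p ≋C a → r ≋C b → p ⊕ r ≋C a + b
  e ⊕C f = ≋-trans (+-cong e f) (≋-sym (C-+ _ _))

  _⊗C_ : ∀ {p r a b} → p ≋C a → r ≋C b → p ⊗ r ≋C a * b
  e ⊗C f = ≋-trans (*-cong e f) (≋-sym (C-* _ _))

  ⊖C_ : ∀ {p a} → p ≋C a → ⊖ p ≋C - a
  ⊖C e = ≋-trans (-‿cong e) (≋-sym (C-neg _))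

  -- Horner form. `cubic-list` turns it into an explicit list, so that an identity between opaque
  -- polynomials of degree at most 3 can be compared coefficient by coefficient.
  cubic : Poly → Poly → Poly → Poly → Poly
  cubic p₀ p₁ p₂ p₃ = p₀ ⊕ X ⊗ (p₁ ⊕ X ⊗ (p₂ ⊕ X ⊗ p₃))

  cubic-list : ∀ {p₀ p₁ p₂ p₃ a b c d} → p₀ ≋C a → p₁ ≋C b → p₂ ≋C c → p₃ ≋C d →
    cubic p₀ p₁ p₂ p₃ ≋ a ∷ b ∷ c ∷ d ∷ []
  cubic-list {a = a} {b} {c} {d} e₀ e₁ e₂ e₃ = ≋-sym (≋-trans (∷-X a _) (+-cong (≋-sym e₀)
    (*-congˡ (≋-trans (∷-X b _) (+-cong (≋-sym e₁) (*-congˡ (≋-trans (∷-X c _)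
      (+-cong (≋-sym e₂) (*-congˡ (≋-trans (reflexive (C-def d)) (≋-sym e₃)))))))))))

D-quad : ∀ m → D (quad m) ≋ C (+ 2) ⊗ X
D-quad m = ≋-trans (D-+ (X ⊗ X) (⊖ C m)) (≋-trans
  (+-cong (≋-trans (D-* X X) (+-cong (*-congʳ D-X) (*-congˡ D-X)))
          (≋-trans (D-neg (C m)) (≋-trans (-‿cong (≋-trans (D-C m) (≋-sym C-0))) ≋-refl)))
  (solve 1 (λ x → con (+ 1) :* x :+ x :* con (+ 1) :+ :- con (+ 0) := con (+ 2) :* x) ≋-refl X))

-- The power rule multiplied by one more factor x² - m, which avoids the exponent k - 1 at k = 0.
D-quad^ : ∀ m k → D (quad m ^ k) ⊗ quad m ≋ C (+ (2 ℕ.* k)) ⊗ X ⊗ quad m ^ k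
D-quad^ m zero = ≋-trans (*-congʳ (≋-trans (D-C (+ 1)) (≋-sym C-0)))
  (solve 2 (λ x s → con (+ 0) :* s := con (+ 0) :* x :* con (+ 1)) ≋-refl X (quad m))
D-quad^ m (suc k) = begin
  D (quad m ⊗ quad m ^ k) ⊗ quad m
    ≈⟨ *-congʳ (D-* (quad m) (quad m ^ k)) ⟩
  (D (quad m) ⊗ quad m ^ k ⊕ quad m ⊗ D (quad m ^ k)) ⊗ quad m
    ≈⟨ solve 4 (λ a s d q → (a :* s :+ q :* d) :* q := (a :* s :+ d :* q) :* q) ≋-refl
         (D (quad m)) (quad m ^ k) (D (quad m ^ k)) (quad m) ⟩
  (D (quad m) ⊗ quad m ^ k ⊕ D (quad m ^ k) ⊗ quad m) ⊗ quad m
    ≈⟨ *-congʳ (+-cong (*-congʳ (D-quad m)) (D-quad^ m k)) ⟩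
  (C (+ 2) ⊗ X ⊗ quad m ^ k ⊕ C (+ (2 ℕ.* k)) ⊗ X ⊗ quad m ^ k) ⊗ quad m
    ≈⟨ solve 4 (λ x s q c → (con (+ 2) :* x :* s :+ c :* x :* s) :* q := (con (+ 2) :+ c) :* x :* (q :* s)) ≋-refl
         X (quad m ^ k) (quad m) (C (+ (2 ℕ.* k))) ⟩
  (C (+ 2) ⊕ C (+ (2 ℕ.* k))) ⊗ X ⊗ quad m ^ suc k
    ≈⟨ *-congʳ (*-congʳ (≋-trans (≋-sym (C-+ (+ 2) (+ (2 ℕ.* k)))) (reflexive (cong (C ∘ +_) (sym (ℕₚ.*-suc 2 k)))))) ⟩
  C (+ (2 ℕ.* suc k)) ⊗ X ⊗ quad m ^ suc k ∎
  where
  open SetoidReasoning setoid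

quad-regular : ∀ m → m ≢ + 0 → Regular (quad m)
quad-regular m m≢0 = regular-coeff₀ (quad m) λ e → m≢0 (begin
  m                        ≡⟨ lem m ⟩
  - (+ 0 + - m)            ≡⟨ cong -_ (cong₂ _+_ (sym (at (X⊗ X) 0)) (sym (trans (coeff-⊖ (C m) 0) (cong -_ (coeff₀-C m))))) ⟩
  - (coeff (X ⊗ X) 0 + coeff (⊖ C m) 0) ≡⟨ cong -_ (coeff-⊕ (X ⊗ X) (⊖ C m) 0) ⟨
  - coeff (quad m) 0       ≡⟨ cong -_ e ⟩
  + 0                      ∎)
  where
  open ≡-Reasoning
  lem : ∀ m → m ≡ - (+ 0 + - m)
  lem = solve-∀

-- Everything read off from a characteristic polynomial u (x² - m)ᵏ, where u divides the square of
-- x² - e x - c and (x² - e x - c) u′ / u = ℓ₁ x + ℓ₀.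
module Spectrum {m e c : ℤ} (m≢0 : m ≢ + 0) {u v : Poly} {ℓ₁ ℓ₀ : ℤ} (u-regular : Regular u)
  (uv : u ⊗ v ≋ cofactor e c ⊗ cofactor e c)
  (Du : cofactor e c ⊗ D u ≋ u ⊗ (C ℓ₁ ⊗ X ⊕ C ℓ₀)) (k : ℕ)
  {n} (S : Matrix ℤ n) (S₀ : ∀ i → S i i ≡ + 0) (S-sym : ∀ i j → S i j ≡ S j i)
  (charPoly≋ : charPoly n S ≋ u ⊗ quad m ^ k) where

  open SetoidReasoning setoid

  private
    g = cofactor e c
    Q = quad m
    M = defect m S
    K = M · S

  -- Since u v = g², the power (g Q)ᵏ⁺² is a multiple of the characteristic polynomial u Qᵏ and
  -- kills `S` by Cayley-Hamilton. `act-radical` strips the exponent.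
  ann : Annihilated m e c S M K
  ann = annihilated m S e c (act-radical S S-sym (g ⊗ Q) (suc k) λ w j →
    trans (act-cong S {r = (v ⊗ (g ^ k ⊗ (Q ⊗ Q))) ⊗ charPoly n S} multiple w j)
    (trans (act-⊗ S _ (charPoly n S) w j)
    (trans (act-congᵥ S (v ⊗ (g ^ k ⊗ (Q ⊗ Q))) (cayleyHamilton S S-sym w) j) (act-zeroᵥ S (v ⊗ (g ^ k ⊗ (Q ⊗ Q))) j))))
    where
    multiple : (g ⊗ Q) ^ suc (suc k) ≋ (v ⊗ (g ^ k ⊗ (Q ⊗ Q))) ⊗ charPoly n S
    multiple = begin
      g ⊗ Q ⊗ (g ⊗ Q ⊗ (g ⊗ Q) ^ k)
        ≈⟨ *-congˡ (*-congˡ (^-⊗ g Q k)) ⟩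
      g ⊗ Q ⊗ (g ⊗ Q ⊗ (g ^ k ⊗ Q ^ k))
        ≈⟨ solve 4 (λ g q s t → g :* q :* (g :* q :* (s :* t)) := (g :* g) :* (s :* (q :* q) :* t)) ≋-refl g Q (g ^ k) (Q ^ k) ⟩
      g ⊗ g ⊗ (g ^ k ⊗ (Q ⊗ Q) ⊗ Q ^ k)
        ≈⟨ *-congʳ uv ⟨
      u ⊗ v ⊗ (g ^ k ⊗ (Q ⊗ Q) ⊗ Q ^ k)
        ≈⟨ solve 4 (λ u v a t → u :* v :* (a :* t) := v :* a :* (u :* t)) ≋-refl u v (g ^ k ⊗ (Q ⊗ Q)) (Q ^ k) ⟩
      v ⊗ (g ^ k ⊗ (Q ⊗ Q)) ⊗ (u ⊗ Q ^ k)
        ≈⟨ *-congˡ charPoly≋ ⟨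
      v ⊗ (g ^ k ⊗ (Q ⊗ Q)) ⊗ charPoly n S ∎

  private
    κ = + (2 ℕ.* k)

    -- Two expressions for g Q p′ / p: from the factorisation p = u Qᵏ, and from the trace of the
    -- resolvent. The common factor u Qᵏ is cancelled.
    logarithmicDerivative : (C ℓ₁ ⊗ X ⊕ C ℓ₀) ⊗ Q ⊕ C κ ⊗ X ⊗ g ≋
      g ⊗ (X ⊗ C (+ n)) ⊕ ⊖ ((X ⊕ ⊖ C e) ⊗ C (tr M)) ⊕ ⊖ C (tr K)
    logarithmicDerivative = cancel (regular-* u-regular (regular-^ (quad-regular m m≢0) k)) (begin
      u ⊗ Q ^ k ⊗ ((C ℓ₁ ⊗ X ⊕ C ℓ₀) ⊗ Q ⊕ C κ ⊗ X ⊗ g)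
        ≈⟨ solve 7 (λ u s l q k x g → u :* s :* (l :* q :+ k :* x :* g) := (u :* l) :* q :* s :+ g :* u :* (k :* x :* s))
             ≋-refl u (Q ^ k) (C ℓ₁ ⊗ X ⊕ C ℓ₀) Q (C κ) X g ⟩
      u ⊗ (C ℓ₁ ⊗ X ⊕ C ℓ₀) ⊗ Q ⊗ Q ^ k ⊕ g ⊗ u ⊗ (C κ ⊗ X ⊗ Q ^ k)
        ≈⟨ +-cong (*-congʳ (*-congʳ Du)) (*-congˡ (D-quad^ m k)) ⟨
      g ⊗ D u ⊗ Q ⊗ Q ^ k ⊕ g ⊗ u ⊗ (D (Q ^ k) ⊗ Q)
        ≈⟨ solve 6 (λ g d q s u e → g :* d :* q :* s :+ g :* u :* (e :* q) := g :* q :* (d :* s :+ u :* e))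
             ≋-refl g (D u) Q (Q ^ k) u (D (Q ^ k)) ⟩
      g ⊗ Q ⊗ (D u ⊗ Q ^ k ⊕ u ⊗ D (Q ^ k))
        ≈⟨ *-congˡ (D-* u (Q ^ k)) ⟨
      g ⊗ Q ⊗ D (u ⊗ Q ^ k)
        ≈⟨ *-congˡ (D-cong charPoly≋) ⟨
      g ⊗ Q ⊗ D (charPoly n S)
        ≈⟨ Resolvent.charPoly-derivative ann S₀ ⟩
      charPoly n S ⊗ _
        ≈⟨ *-congʳ charPoly≋ ⟩
      u ⊗ Q ^ k ⊗ _ ∎)

    -- Only two entries are read later: the constant one, - m ℓ₀ = e tr M - tr K, and the cubic one,
    -- ℓ₁ + 2k = n. Unification fills in the others.
    coefficients : _ ∷ _ ∷ _ ∷ (ℓ₁ + κ) ∷ [] ≋ _ ∷ _ ∷ _ ∷ + n ∷ []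
    coefficients = begin
      _ ≈⟨ cubic-list (⊖C (C≋ {m} ⊗C C≋ {ℓ₀})) ((⊖C (C≋ {m} ⊗C C≋ {ℓ₁})) ⊕C (⊖C (C≋ {κ} ⊗C C≋ {c})))
              (C≋ {ℓ₀} ⊕C (⊖C (C≋ {κ} ⊗C C≋ {e}))) (C≋ {ℓ₁} ⊕C C≋ {κ}) ⟨
      _ ≈⟨ solve 7 (λ x m e c l₁ l₀ k →
             :- (m :* l₀) :+ x :* ((:- (m :* l₁) :+ :- (k :* c)) :+ x :* ((l₀ :+ :- (k :* e)) :+ x :* (l₁ :+ k)))
             := (l₁ :* x :+ l₀) :* (x :* x :- m) :+ k :* x :* (x :* x :- e :* x :- c))
             ≋-refl X (C m) (C e) (C c) (C ℓ₁) (C ℓ₀) (C κ) ⟩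
      _ ≈⟨ logarithmicDerivative ⟩
      _ ≈⟨ solve 6 (λ x e c n M K →
             (x :* x :- e :* x :- c) :* (x :* n) :- (x :- e) :* M :- K
             := (e :* M :+ :- K) :+ x :* ((:- (c :* n) :+ :- M) :+ x :* (:- (e :* n) :+ x :* n)))
             ≋-refl X (C e) (C c) (C (+ n)) (C (tr M)) (C (tr K)) ⟩
      _ ≈⟨ cubic-list ((C≋ {e} ⊗C C≋ {tr M}) ⊕C (⊖C C≋ {tr K})) ((⊖C (C≋ {c} ⊗C C≋ {+ n})) ⊕C (⊖C C≋ {tr M}))
              (⊖C (C≋ {e} ⊗C C≋ {+ n})) (C≋ {+ n}) ⟩
      _ ∎

  order : + n ≡ ℓ₁ + + (2 ℕ.* k)
  order = sym (at coefficients 3)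

  trace-K : tr K ≡ e * tr M + m * ℓ₀
  trace-K = trans (lem (e * tr M) (tr K)) (trans (cong (λ z → e * tr M + - z) (sym (at coefficients 0)))
    (lem′ (m * ℓ₀) (e * tr M)))
    where
    lem : ∀ b k → k ≡ b + - (b + - k)
    lem = solve-∀
    lem′ : ∀ a b → b + - - a ≡ b + a
    lem′ = solve-∀

-- Seidel matrices: dot products, congruences and the rows of M and K.

module SeidelMatrices where
  open ≡-Reasoning

  dot : ∀ {n} → (Fin n → ℤ) → (Fin n → ℤ) → ℤ
  dot u v = ∑ (λ k → u k * v k)

  dot-comm : ∀ {n} (u v : Fin n → ℤ) → dot u v ≡ dot v u
  dot-comm u v = ∑-cong λ k → ℤₚ.*-comm (u k) (v k)

  dot-linearˡ : ∀ {n} a b (u v w : Fin n → ℤ) → dot (λ k → a * u k + b * v k) w ≡ a * dot u w + b * dot v w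
  dot-linearˡ a b u v w = trans (∑-cong λ k → lem a b (u k) (v k) (w k)) (∑-linear a b _ _)
    where
    lem : ∀ a b u v w → (a * u + b * v) * w ≡ a * (u * w) + b * (v * w)
    lem = solve-∀

  dot-linearʳ : ∀ {n} a b (u v w : Fin n → ℤ) → dot w (λ k → a * u k + b * v k) ≡ a * dot w u + b * dot w v
  dot-linearʳ a b u v w = trans (dot-comm w _) (trans (dot-linearˡ a b u v w)
    (cong₂ (λ x y → a * x + b * y) (dot-comm u w) (dot-comm v w)))

  dot-bilinear : ∀ {n} a b c d (u v w z : Fin n → ℤ) →
    dot (λ k → a * u k + b * v k) (λ k → c * w k + d * z k) ≡
    a * (c * dot u w + d * dot u z) + b * (c * dot v w + d * dot v z)
  dot-bilinear a b c d u v w z = trans (dot-linearˡ a b u v _)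
    (cong₂ (λ x y → a * x + b * y) (dot-linearʳ c d w z u) (dot-linearʳ c d w z v))

  ∑-const : ∀ n a → ∑ {n} (λ _ → a) ≡ + n * a
  ∑-const zero    a = ∑-[] _
  ∑-const (suc n) a = trans (∑-∷ _) (trans (cong (λ z → a + z) (∑-const n a)) (lem a (+ n)))
    where
    lem : ∀ a n → a + n * a ≡ (+ 1 + n) * a
    lem = solve-∀

  nonneg-cancel : ∀ a x → + 1 ≤ a → + 0 ≤ a * x → + 0 ≤ x
  nonneg-cancel (+ suc a) x (+≤+ _) h =
    ℤₚ.*-cancelˡ-≤-pos (+ 0) x (+ suc a) (subst (_≤ + suc a * x) (sym (ℤₚ.*-zeroʳ (+ suc a))) h)

  zero-cancel : ∀ a x → + 1 ≤ a → a * x ≡ + 0 → x ≡ + 0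
  zero-cancel (+ suc a) x (+≤+ _) h with ℤₚ.i*j≡0⇒i≡0∨j≡0 (+ suc a) {x} h
  ... | inj₂ e = e

  infix 4 _≡_[mod_]
  record _≡_[mod_] (x y d : ℤ) : Set where
    constructor _,_
    field
      quotient : ℤ
      equality : x ≡ y + d * quotient
  open _≡_[mod_] public

  mod-* : ∀ {d x x′ y y′} → x ≡ x′ [mod d ] → y ≡ y′ [mod d ] → x * y ≡ x′ * y′ [mod d ]
  mod-* {d} {x′ = x} {y′ = y} (z , e) (w , f) =
    x * w + z * y + d * z * w , trans (cong₂ _*_ e f) (lem x y d z w)
    where
    lem : ∀ x y d z w → (x + d * z) * (y + d * w) ≡ x * y + d * (x * w + z * y + d * z * w)
    lem = solve-∀

  mod-∑ : ∀ {d n} {f g : Fin n → ℤ} → (∀ i → f i ≡ g i [mod d ]) → ∑ f ≡ ∑ g [mod d ]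
  mod-∑ {d} {g = g} e = ∑ (λ i → quotient (e i)) , trans (∑-cong λ i → equality (e i))
    (trans (∑-+ g (λ i → d * quotient (e i))) (cong (λ z → ∑ g + z) (sym (*-∑ d (λ i → quotient (e i))))))

  Sign : ℤ → Set
  Sign x = (x ≡ + 1) ⊎ (x ≡ - (+ 1))

  sign-* : ∀ {x y} → Sign x → Sign y → Sign (x * y)
  sign-* (inj₁ refl) (inj₁ refl) = inj₁ refl
  sign-* (inj₁ refl) (inj₂ refl) = inj₂ refl
  sign-* (inj₂ refl) (inj₁ refl) = inj₂ refl
  sign-* (inj₂ refl) (inj₂ refl) = inj₁ refl

  sign² : ∀ {x} → Sign x → x * x ≡ + 1
  sign² (inj₁ refl) = refl
  sign² (inj₂ refl) = refl

  sign-odd : ∀ {x} → Sign x → x ≡ + 1 [mod + 2 ]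
  sign-odd (inj₁ refl) = + 0 , refl
  sign-odd (inj₂ refl) = - (+ 1) , refl

  ∑-signs : ∀ {n} {f : Fin n → ℤ} → (∀ i → Sign (f i)) → ∑ f ≡ + n [mod + 2 ]
  ∑-signs {n} ±f with mod-∑ (λ i → sign-odd (±f i))
  ... | z , e = z , trans e (cong (λ w → w + + 2 * z) (trans (∑-const n (+ 1)) (ℤₚ.*-identityʳ (+ n))))

  -- Each unordered pair of indices contributes ±2 ≡ 2.
  ∑∑-signs : ∀ {n} (W : Matrix ℤ n) → (∀ i → W i i ≡ + 0) → (∀ i j → i ≢ j → Sign (W i j)) →
    (∀ i j → W i j ≡ W j i) → ∑ (λ i → ∑ (W i)) ≡ + n * (+ n + - (+ 1)) [mod + 4 ]
  ∑∑-signs {zero}  W W₀ W± W-sym = + 0 , ∑-[] _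
  ∑∑-signs {suc n} W W₀ W± W-sym
    with ∑-signs {f = λ k → W zero (suc k)} (λ k → W± zero (suc k) λ ())
       | ∑∑-signs (λ i j → W (suc i) (suc j)) (W₀ ∘ suc) (λ i j ne → W± (suc i) (suc j) (ne ∘ suc-injective))
                  (λ i j → W-sym (suc i) (suc j))
  ... | z , e | w , f = z + w , (begin
    ∑ (λ i → ∑ (W i))
      ≡⟨ ∑-∷ (λ i → ∑ (W i)) ⟩
    ∑ (W zero) + ∑ (λ i → ∑ (W (suc i)))
      ≡⟨ cong₂ _+_ (trans (∑-∷ (W zero)) (cong (λ d → d + r) (W₀ zero)))
           (trans (∑-cong λ i → trans (∑-∷ (W (suc i))) (cong (λ d → d + ∑ (λ j → W (suc i) (suc j))) (W-sym (suc i) zero)))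
                  (∑-+ (λ i → W zero (suc i)) (λ i → ∑ (λ j → W (suc i) (suc j))))) ⟩
    (+ 0 + r) + (r + T)
      ≡⟨ cong₂ (λ r T → (+ 0 + r) + (r + T)) e f ⟩
    (+ 0 + (+ n + + 2 * z)) + ((+ n + + 2 * z) + (+ n * (+ n + - (+ 1)) + + 4 * w))
      ≡⟨ lem (+ n) z w ⟩
    + suc n * (+ suc n + - (+ 1)) + + 4 * (z + w) ∎)
    where
    r = ∑ (λ k → W zero (suc k))
    T = ∑ (λ i → ∑ (λ j → W (suc i) (suc j)))
    lem : ∀ n z w → (+ 0 + (n + + 2 * z)) + ((n + + 2 * z) + (n * (n + - (+ 1)) + + 4 * w))
      ≡ (+ 1 + n) * (+ 1 + n + - (+ 1)) + + 4 * (z + w)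
    lem = solve-∀

  module Seidel {n} {S : Matrix ℤ n} (seidel : IsSymmetricSeidel n S) where

    S₀ : ∀ i → S i i ≡ + 0
    S₀ = proj₁ seidel

    S± : ∀ i j → i ≢ j → Sign (S i j)
    S± = proj₁ (proj₂ seidel)

    S-sym : ∀ i j → S i j ≡ S j i
    S-sym = proj₂ (proj₂ seidel)

    S-mod₂ : ∀ i j → S i j ≡ + 1 + - δ i j [mod + 2 ]
    S-mod₂ i j with i Fin.≟ j
    ... | yes refl rewrite δ-refl i | S₀ i = + 0 , refl
    ... | no ne    rewrite δ-≢ ne = sign-odd (S± i j ne)

    row-norm : ∀ i → ∑ (λ k → S i k * S k i) ≡ + n + - (+ 1)
    row-norm i = begin
      ∑ (λ k → S i k * S k i)
        ≡⟨ ∑-cong entry ⟩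
      ∑ (λ k → + 1 * + 1 + - (+ 1) * (δ i k * + 1))
        ≡⟨ ∑-linear (+ 1) (- (+ 1)) (λ _ → + 1) (λ k → δ i k * + 1) ⟩
      + 1 * ∑ {n} (λ _ → + 1) + - (+ 1) * ∑ (λ k → δ i k * + 1)
        ≡⟨ cong₂ (λ x y → + 1 * x + - (+ 1) * y) (∑-const n (+ 1)) (∑-δˡ i (λ _ → + 1)) ⟩
      + 1 * (+ n * + 1) + - (+ 1) * + 1
        ≡⟨ lem (+ n) ⟩
      + n + - (+ 1) ∎
      where
      lem : ∀ n → + 1 * (n * + 1) + - (+ 1) * + 1 ≡ n + - (+ 1)
      lem = solve-∀
      entry : ∀ k → S i k * S k i ≡ + 1 * + 1 + - (+ 1) * (δ i k * + 1)
      entry k with i Fin.≟ k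
      ... | yes refl rewrite δ-refl i | S₀ i = refl
      ... | no ne    rewrite δ-≢ ne | S-sym k i = sign² (S± i k ne)

    defect-diagonal : ∀ m i → defect m S i i ≡ m + - (+ n + - (+ 1))
    defect-diagonal m i = cong₂ (λ d r → m * d + - r) (δ-refl i) (row-norm i) `then` lem m (+ n)
      where
      _`then`_ = trans
      lem : ∀ m n → m * + 1 + - (n + - (+ 1)) ≡ m + - (n + - (+ 1))
      lem = solve-∀

    -- Modulo 2 every Seidel matrix is J - I, and (J - I)² = (n - 2) J + I.
    defect-mod₂ : ∀ m i j → defect m S i j ≡ (m + - (+ 1)) * δ i j + - (+ n + - (+ 2)) [mod + 2 ]
    defect-mod₂ m i j with mod-∑ (λ k → mod-* (S-mod₂ i k) (S-mod₂ k j))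
    ... | z , e = - z , (begin
      m * δ i j + - ∑ (λ k → S i k * S k j)
        ≡⟨ cong (λ s → m * δ i j + - s) (trans e (cong (λ s → s + + 2 * z) count)) ⟩
      m * δ i j + - (+ n + - (+ 2) + δ i j + + 2 * z)
        ≡⟨ lem m (δ i j) (+ n) z ⟩
      (m + - (+ 1)) * δ i j + - (+ n + - (+ 2)) + + 2 * - z ∎)
      where
      lem : ∀ m d n z → m * d + - (n + - (+ 2) + d + + 2 * z) ≡ (m + - (+ 1)) * d + - (n + - (+ 2)) + + 2 * - z
      lem = solve-∀
      count : ∑ (λ k → (+ 1 + - δ i k) * (+ 1 + - δ k j)) ≡ + n + - (+ 2) + δ i j
      count = begin
        ∑ (λ k → (+ 1 + - δ i k) * (+ 1 + - δ k j))
          ≡⟨ (∑-cong λ k → expand (δ i k) (δ k j)) ⟩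
        ∑ (λ k → + 1 * (+ 1 * + 1 + - (+ 1) * (+ 1 * δ k j)) + - (+ 1) * (δ i k * (+ 1 + - δ k j)))
          ≡⟨ ∑-linear (+ 1) (- (+ 1)) (λ k → + 1 * + 1 + - (+ 1) * (+ 1 * δ k j)) (λ k → δ i k * (+ 1 + - δ k j)) ⟩
        + 1 * ∑ (λ k → + 1 * + 1 + - (+ 1) * (+ 1 * δ k j)) + - (+ 1) * ∑ (λ k → δ i k * (+ 1 + - δ k j))
          ≡⟨ cong₂ (λ x y → + 1 * x + - (+ 1) * y)
               (trans (∑-linear (+ 1) (- (+ 1)) (λ _ → + 1) (λ k → + 1 * δ k j))
                      (cong₂ (λ x y → + 1 * x + - (+ 1) * y) (∑-const n (+ 1)) (∑-δʳ j (λ _ → + 1))))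
               (∑-δˡ i (λ k → + 1 + - δ k j)) ⟩
        + 1 * (+ 1 * (+ n * + 1) + - (+ 1) * + 1) + - (+ 1) * (+ 1 + - δ i j)
          ≡⟨ lem′ (+ n) (δ i j) ⟩
        + n + - (+ 2) + δ i j ∎
        where
        expand : ∀ a b → (+ 1 + - a) * (+ 1 + - b) ≡
          + 1 * (+ 1 * + 1 + - (+ 1) * (+ 1 * b)) + - (+ 1) * (a * (+ 1 + - b))
        expand = solve-∀
        lem′ : ∀ n d → + 1 * (+ 1 * (n * + 1) + - (+ 1) * + 1) + - (+ 1) * (+ 1 + - d) ≡ n + - (+ 2) + d
        lem′ = solve-∀

    defect-sym : ∀ m i j → defect m S i j ≡ defect m S j i
    defect-sym m i j = cong₂ (λ d s → m * d + - s) (δ-sym i j)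
      (∑-cong λ k → trans (ℤₚ.*-comm (S i k) (S k j)) (cong₂ _*_ (S-sym k j) (S-sym i k)))

  module Products {m e c : ℤ} {n} {S M K : Matrix ℤ n} (ann : Annihilated m e c S M K)
    (S-sym : ∀ i j → S i j ≡ S j i) (M-sym : ∀ i j → M i j ≡ M j i) where
    open Annihilated ann

    private
      SS : ∀ i j → ∑ (λ k → S i k * S k j) ≡ m * δ i j + - (+ 1) * M i j
      SS i j = trans (square i j) (cong (λ z → m * δ i j + z) (sym (ℤₚ.-1*i≡-i (M i j))))

      -- As M = m I - S², multiplying by M amounts to multiplying twice by `S`. This closes the span
      -- of M and K under products, so all dot products of their rows are combinations of M and K.
      ·M : ∀ (v : Fin n → ℤ) j → ∑ (λ k → v k * M k j) ≡ m * v j + - ∑ (λ k → ∑ (λ l → v l * S l k) * S k j)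
      ·M v j = begin
        ∑ (λ k → v k * M k j)
          ≡⟨ lem _ (m * v j) ⟩
        m * v j + - (m * v j + - (+ 1) * ∑ (λ k → v k * M k j))
          ≡⟨ cong (λ z → m * v j + - z) (begin
               m * v j + - (+ 1) * ∑ (λ k → v k * M k j)
                 ≡⟨ cong (λ z → m * z + - (+ 1) * ∑ (λ k → v k * M k j)) (∑-δʳ j v) ⟨
               m * ∑ (λ k → v k * δ k j) + - (+ 1) * ∑ (λ k → v k * M k j)
                 ≡⟨ dot-linearʳ m (- (+ 1)) (λ k → δ k j) (λ k → M k j) v ⟨
               ∑ (λ k → v k * (m * δ k j + - (+ 1) * M k j))
                 ≡⟨ (∑-cong λ k → cong (v k *_) (sym (SS k j))) ⟩
               ∑ (λ l → v l * ∑ (λ k → S l k * S k j))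
                 ≡⟨ ∑-assoc v S (λ k → S k j) ⟨
               ∑ (λ k → ∑ (λ l → v l * S l k) * S k j) ∎) ⟩
        m * v j + - ∑ (λ k → ∑ (λ l → v l * S l k) * S k j) ∎
        where
        lem : ∀ s a → s ≡ a + - (a + - (+ 1) * s)
        lem = solve-∀

    -- M is a polynomial in `S`, hence S M = M S; the transpose of K = M S is S M, evaluated here by
    -- `·M`.
    K-sym : ∀ i j → K i j ≡ K j i
    K-sym i j = begin
      K i j
        ≡⟨ M*S i j ⟨
      ∑ (λ k → M i k * S k j)
        ≡⟨ (∑-cong λ k → trans (ℤₚ.*-comm (M i k) (S k j)) (cong₂ _*_ (S-sym k j) (M-sym i k))) ⟩
      ∑ (λ k → S j k * M k i)
        ≡⟨ ·M (S j) i ⟩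
      m * S j i + - ∑ (λ k → ∑ (λ l → S j l * S l k) * S k i)
        ≡⟨ cong (λ z → m * S j i + - z) (trans (∑-cong λ k → cong (_* S k i) (SS j k))
             (trans (dot-linearˡ m (- (+ 1)) (δ j) (M j) (λ k → S k i))
               (cong₂ (λ x y → m * x + - (+ 1) * y) (∑-δˡ j (λ k → S k i)) (M*S j i)))) ⟩
      m * S j i + - (m * S j i + - (+ 1) * K j i)
        ≡⟨ lem (K j i) (m * S j i) ⟨
      K j i ∎
      where
      lem : ∀ s a → s ≡ a + - (a + - (+ 1) * s)
      lem = solve-∀

    dot-MM : ∀ i j → dot (M i) (M j) ≡ m * M i j + - (e * K i j + c * M i j)
    dot-MM i j = begin
      ∑ (λ k → M i k * M j k)
        ≡⟨ (∑-cong λ k → cong (M i k *_) (M-sym j k)) ⟩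
      ∑ (λ k → M i k * M k j)
        ≡⟨ ·M (M i) j ⟩
      m * M i j + - ∑ (λ k → ∑ (λ l → M i l * S l k) * S k j)
        ≡⟨ cong (λ z → m * M i j + - z) (trans (∑-cong λ k → cong (_* S k j) (M*S i k)) (K*S i j)) ⟩
      m * M i j + - (e * K i j + c * M i j) ∎

    dot-KM : ∀ i j → dot (K i) (M j) ≡ m * K i j + - (e * (e * K i j + c * M i j) + c * K i j)
    dot-KM i j = begin
      ∑ (λ k → K i k * M j k)
        ≡⟨ (∑-cong λ k → cong (K i k *_) (M-sym j k)) ⟩
      ∑ (λ k → K i k * M k j)
        ≡⟨ ·M (K i) j ⟩
      m * K i j + - ∑ (λ k → ∑ (λ l → K i l * S l k) * S k j)
        ≡⟨ cong (λ z → m * K i j + - z) (trans (∑-cong λ k → cong (_* S k j) (K*S i k))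
             (trans (dot-linearˡ e c (K i) (M i) (λ k → S k j))
               (cong₂ (λ x y → e * x + c * y) (K*S i j) (M*S i j)))) ⟩
      m * K i j + - (e * (e * K i j + c * M i j) + c * K i j) ∎

    dot-KK : ∀ i j → dot (K i) (K j) ≡ (m + - (e * e + c)) * (e * K i j + c * M i j) + - (e * c) * K i j
    dot-KK i j = begin
      ∑ (λ k → K i k * K j k)
        ≡⟨ (∑-cong λ k → cong (K i k *_) (trans (K-sym j k) (sym (M*S k j)))) ⟩
      ∑ (λ k → K i k * ∑ (λ l → M k l * S l j))
        ≡⟨ ∑-assoc (K i) M (λ l → S l j) ⟨
      ∑ (λ l → ∑ (λ k → K i k * M k l) * S l j)
        ≡⟨ (∑-cong λ l → cong (_* S l j) (trans
             (trans (∑-cong λ k → cong (K i k *_) (M-sym k l)) (dot-KM i l))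
             (lem m e c (K i l) (M i l)))) ⟩
      ∑ (λ l → ((m + - (e * e + c)) * K i l + - (e * c) * M i l) * S l j)
        ≡⟨ dot-linearˡ (m + - (e * e + c)) (- (e * c)) (K i) (M i) (λ l → S l j) ⟩
      (m + - (e * e + c)) * dot (K i) (λ l → S l j) + - (e * c) * dot (M i) (λ l → S l j)
        ≡⟨ cong₂ (λ x y → (m + - (e * e + c)) * x + - (e * c) * y) (K*S i j) (M*S i j) ⟩
      (m + - (e * e + c)) * (e * K i j + c * M i j) + - (e * c) * K i j ∎
      where
      lem : ∀ m e c k M → m * k + - (e * (e * k + c * M) + c * k) ≡ (m + - (e * e + c)) * k + - (e * c) * M
      lem = solve-∀

  -- |M₀ ± K₀|² ≥ 0 gives |K₀₀| ≤ 2, and K₀₀ = - (S³)₀₀ counts walks of length 3, hence is 2 mod 4.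
  corner-K : ∀ τ {n} {S : Matrix ℤ (suc n)} (seidel : IsSymmetricSeidel (suc n) S) → + 1 ≤ τ →
    + suc n ≡ + 4 * τ → let m = + 4 * τ + + 1 ; M = defect m S ; K = M · S in
    Annihilated m (+ 0) (+ 1) S M K → (K zero zero ≡ + 2) ⊎ (K zero zero ≡ - (+ 2))
  corner-K τ {n} {S} seidel τ≥1 n+1≡4τ ann = conclude
    where
    open Seidel seidel
    m = + 4 * τ + + 1
    M = defect m S
    K = M · S
    open Products ann S-sym (defect-sym m)
    κ = K zero zero

    M₀₀ : M zero zero ≡ + 2
    M₀₀ = trans (defect-diagonal m zero) (trans (cong (λ z → m + - (z + - (+ 1))) n+1≡4τ) (lem τ))
      where
      lem : ∀ τ → + 4 * τ + + 1 + - (+ 4 * τ + - (+ 1)) ≡ + 2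
      lem = solve-∀

    MM : dot (M zero) (M zero) ≡ + 8 * τ
    MM = trans (dot-MM zero zero) (trans (cong (λ z → m * z + - (+ 0 * κ + + 1 * z)) M₀₀) (lem τ κ))
      where
      lem : ∀ τ κ → (+ 4 * τ + + 1) * + 2 + - (+ 0 * κ + + 1 * + 2) ≡ + 8 * τ
      lem = solve-∀

    KM : dot (K zero) (M zero) ≡ + 4 * τ * κ
    KM = trans (dot-KM zero zero) (lem τ κ (+ 0 * κ + + 1 * M zero zero))
      where
      lem : ∀ τ κ x → (+ 4 * τ + + 1) * κ + - (+ 0 * x + + 1 * κ) ≡ + 4 * τ * κ
      lem = solve-∀

    KK : dot (K zero) (K zero) ≡ + 8 * τ
    KK = trans (dot-KK zero zero) (trans (cong (λ z → (m + - (+ 0 * + 0 + + 1)) * (+ 0 * κ + + 1 * z) + - (+ 0 * + 1) * κ) M₀₀) (lem τ κ))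
      where
      lem : ∀ τ κ → (+ 4 * τ + + 1 + - (+ 0 * + 0 + + 1)) * (+ 0 * κ + + 1 * + 2) + - (+ 0 * + 1) * κ ≡ + 8 * τ
      lem = solve-∀

    norm : ∀ s → s * s ≡ + 1 → dot (λ k → + 1 * M zero k + s * K zero k) (λ k → + 1 * M zero k + s * K zero k)
      ≡ (+ 8 * τ) * (+ 2 + s * κ)
    norm s s² = begin
      dot (λ k → + 1 * M zero k + s * K zero k) (λ k → + 1 * M zero k + s * K zero k)
        ≡⟨ dot-bilinear (+ 1) s (+ 1) s (M zero) (K zero) (M zero) (K zero) ⟩
      + 1 * (+ 1 * dot (M zero) (M zero) + s * dot (M zero) (K zero))
        + s * (+ 1 * dot (K zero) (M zero) + s * dot (K zero) (K zero))
        ≡⟨ cong₂ (λ x y → + 1 * x + s * y)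
             (cong₂ (λ x y → + 1 * x + s * y) MM (trans (dot-comm (M zero) (K zero)) KM))
             (cong₂ (λ x y → + 1 * x + s * y) KM KK) ⟩
      + 1 * (+ 1 * (+ 8 * τ) + s * (+ 4 * τ * κ)) + s * (+ 1 * (+ 4 * τ * κ) + s * (+ 8 * τ))
        ≡⟨ lem τ κ s ⟩
      (+ 8 * τ) * (+ 1 + s * s + s * κ)
        ≡⟨ cong (λ z → (+ 8 * τ) * (+ 1 + z + s * κ)) s² ⟩
      (+ 8 * τ) * (+ 2 + s * κ) ∎
      where
      lem : ∀ τ κ s → + 1 * (+ 1 * (+ 8 * τ) + s * (+ 4 * τ * κ)) + s * (+ 1 * (+ 4 * τ * κ) + s * (+ 8 * τ))
        ≡ (+ 8 * τ) * (+ 1 + s * s + s * κ)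
      lem = solve-∀

    8τ≥1 : + 1 ≤ + 8 * τ
    8τ≥1 = ℤₚ.≤-trans (ℤ.+≤+ (ℕ.s≤s z≤n)) (ℤₚ.*-monoˡ-≤-nonNeg (+ 8) τ≥1)

    bound : ∀ s → s * s ≡ + 1 → + 0 ≤ + 2 + s * κ
    bound s s² = nonneg-cancel (+ 8 * τ) _ 8τ≥1 (subst (+ 0 ≤_) (norm s s²)
      (∑-nonneg _ λ k → 0≤x² (+ 1 * M zero k + s * K zero k)))

    W : Matrix ℤ n
    W l k = S zero (suc l) * S (suc l) (suc k) * S (suc k) zero

    κ≡-∑∑W : κ ≡ - ∑ (λ l → ∑ (W l))
    κ≡-∑∑W = begin
      ∑ (λ k → M zero k * S k zero)
        ≡⟨ ∑-∷ (λ k → M zero k * S k zero) ⟩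
      M zero zero * S zero zero + ∑ (λ k → M zero (suc k) * S (suc k) zero)
        ≡⟨ cong₂ _+_ (trans (cong (M zero zero *_) (S₀ zero)) (ℤₚ.*-zeroʳ (M zero zero))) (∑-cong column) ⟩
      + 0 + ∑ (λ k → - (+ 1) * ∑ (λ l → W l k))
        ≡⟨ trans (ℤₚ.+-identityˡ _) (sym (*-∑ (- (+ 1)) (λ k → ∑ (λ l → W l k)))) ⟩
      - (+ 1) * ∑ (λ k → ∑ (λ l → W l k))
        ≡⟨ trans (ℤₚ.-1*i≡-i _) (cong -_ (∑-comm (λ k l → W l k))) ⟩
      - ∑ (λ l → ∑ (W l)) ∎
      where
      column : ∀ k → M zero (suc k) * S (suc k) zero ≡ - (+ 1) * ∑ (λ l → W l k)
      column k = begin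
        (m * + 0 + - ∑ (λ l → S zero l * S l (suc k))) * S (suc k) zero
          ≡⟨ cong (λ z → (m * + 0 + - z) * S (suc k) zero) (trans (∑-∷ _)
               (cong (λ z → z * S zero (suc k) + ∑ (λ l → S zero (suc l) * S (suc l) (suc k))) (S₀ zero))) ⟩
        (m * + 0 + - (+ 0 * S zero (suc k) + ∑ (λ l → S zero (suc l) * S (suc l) (suc k)))) * S (suc k) zero
          ≡⟨ lem m (S zero (suc k)) (∑ (λ l → S zero (suc l) * S (suc l) (suc k))) (S (suc k) zero) ⟩
        - (+ 1) * (∑ (λ l → S zero (suc l) * S (suc l) (suc k)) * S (suc k) zero)
          ≡⟨ cong (- (+ 1) *_) (∑-* (S (suc k) zero) (λ l → S zero (suc l) * S (suc l) (suc k))) ⟩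
        - (+ 1) * ∑ (λ l → W l k) ∎
        where
        lem : ∀ m a s b → (m * + 0 + - (+ 0 * a + s)) * b ≡ - (+ 1) * (s * b)
        lem = solve-∀

    κ≡2+4z : κ ≡ + 2 [mod + 4 ]
    κ≡2+4z = residue (∑∑-signs W W₀ W± W-sym)
      where
      W₀ : ∀ i → W i i ≡ + 0
      W₀ i = cong (_* S (suc i) zero) (trans (cong (S zero (suc i) *_) (S₀ (suc i))) (ℤₚ.*-zeroʳ (S zero (suc i))))
      W± : ∀ i j → i ≢ j → Sign (W i j)
      W± i j ne = sign-* (sign-* (S± zero (suc i) λ ()) (S± (suc i) (suc j) (ne ∘ suc-injective))) (S± (suc j) zero λ ())
      W-sym : ∀ i j → W i j ≡ W j i
      W-sym i j = trans (lem (S zero (suc i)) (S (suc i) (suc j)) (S (suc j) zero))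
        (cong₂ _*_ (cong₂ _*_ (S-sym (suc j) zero) (S-sym (suc i) (suc j))) (S-sym zero (suc i)))
        where
        lem : ∀ a b c → a * b * c ≡ c * b * a
        lem = solve-∀
      n≡ : + n ≡ + 4 * τ + - (+ 1)
      n≡ = trans (lem (+ n)) (cong (λ z → z + - (+ 1)) n+1≡4τ)
        where
        lem : ∀ n → n ≡ + 1 + n + - (+ 1)
        lem = solve-∀
      residue : ∑ (λ l → ∑ (W l)) ≡ + n * (+ n + - (+ 1)) [mod + 4 ] → κ ≡ + 2 [mod + 4 ]
      -- (4τ - 1)(4τ - 2) = 16τ² - 12τ + 2, whose negative is 2 modulo 4.
      residue (z , e) = - (+ 4 * τ * τ + - (+ 3 * τ) + + 1 + z) , trans κ≡-∑∑W
        (trans (cong -_ e) (trans (cong (λ n → - (n * (n + - (+ 1)) + + 4 * z)) n≡) (lem τ z)))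
        where
        lem : ∀ τ z → - ((+ 4 * τ + - (+ 1)) * (+ 4 * τ + - (+ 1) + - (+ 1)) + + 4 * z)
          ≡ + 2 + + 4 * - (+ 4 * τ * τ + - (+ 3 * τ) + + 1 + z)
        lem = solve-∀

    conclude : (κ ≡ + 2) ⊎ (κ ≡ - (+ 2))
    conclude = cases (quotient κ≡2+4z) (equality κ≡2+4z)
      (nonneg-cancel (+ 4) _ (+≤+ (ℕ.s≤s z≤n)) (subst (+ 0 ≤_)
        (trans (cong (λ k → + 2 + + 1 * k) (equality κ≡2+4z)) (lem₊ (quotient κ≡2+4z))) (bound (+ 1) refl)))
      (nonneg-cancel (+ 4) _ (+≤+ (ℕ.s≤s z≤n)) (subst (+ 0 ≤_)
        (trans (cong (λ k → + 2 + - (+ 1) * k) (equality κ≡2+4z)) (lem₋ (quotient κ≡2+4z))) (bound (- (+ 1)) refl)))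
      where
      lem₊ : ∀ z → + 2 + + 1 * (+ 2 + + 4 * z) ≡ + 4 * (+ 1 + z)
      lem₊ = solve-∀
      lem₋ : ∀ z → + 2 + - (+ 1) * (+ 2 + + 4 * z) ≡ + 4 * - z
      lem₋ = solve-∀
      cases : ∀ z → κ ≡ + 2 + + 4 * z → + 0 ≤ + 1 + z → + 0 ≤ - z → (κ ≡ + 2) ⊎ (κ ≡ - (+ 2))
      cases (+ zero)          e _ _ = inj₁ e
      cases -[1+ zero ]       e _ _ = inj₂ e
      cases (+ suc z)         e _ ()
      cases -[1+ suc z ]      e () _

  -- A system of three sign vectors bordering S to a matrix of square m I; the missing 3 × 3 corner is I - J.
  record Completion (τ : ℤ) {n} (S M : Matrix ℤ n) : Set where
    field
      u₁ u₂ u₃ : Fin n → ℤ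
      ±u₁ : ∀ i → Sign (u₁ i)
      ±u₂ : ∀ i → Sign (u₂ i)
      ±u₃ : ∀ i → Sign (u₃ i)
      u₁u₁ : dot u₁ u₁ ≡ + 4 * τ + - (+ 1)
      u₂u₂ : dot u₂ u₂ ≡ + 4 * τ + - (+ 1)
      u₃u₃ : dot u₃ u₃ ≡ + 4 * τ + - (+ 1)
      u₁u₂ : dot u₁ u₂ ≡ - (+ 1)
      u₁u₃ : dot u₁ u₃ ≡ - (+ 1)
      u₂u₃ : dot u₂ u₃ ≡ - (+ 1)
      Su₁ : ∀ i → dot (S i) u₁ ≡ u₂ i + u₃ i
      Su₂ : ∀ i → dot (S i) u₂ ≡ u₁ i + u₃ i
      Su₃ : ∀ i → dot (S i) u₃ ≡ u₁ i + u₂ i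
      gram : ∀ i j → M i j ≡ u₁ i * u₁ j + u₂ i * u₂ j + u₃ i * u₃ j

  dot-+ˡ : ∀ {n} (u v w : Fin n → ℤ) → dot (λ k → u k + v k) w ≡ dot u w + dot v w
  dot-+ˡ u v w = trans (∑-cong λ k → ℤₚ.*-distribʳ-+ (w k) (u k) (v k)) (∑-+ (λ k → u k * w k) (λ k → v k * w k))

  dot-+³ : ∀ {n} (u v w x : Fin n → ℤ) → dot (λ k → u k + v k + w k) x ≡ dot u x + dot v x + dot w x
  dot-+³ u v w x = trans (dot-+ˡ (λ k → u k + v k) w x) (cong (λ z → z + dot w x) (dot-+ˡ u v x))

  dot-scale : ∀ {n} a b (u v : Fin n → ℤ) → dot (λ k → a * u k) (λ k → b * v k) ≡ a * b * dot u v
  dot-scale a b u v = trans (∑-cong λ k → lem a b (u k) (v k)) (sym (*-∑ (a * b) (λ k → u k * v k)))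
    where
    lem : ∀ a b u v → a * u * (b * v) ≡ a * b * (u * v)
    lem = solve-∀

  dot≥0 : ∀ {n} (u : Fin n → ℤ) → + 0 ≤ dot u u
  dot≥0 u = ∑-nonneg _ λ k → 0≤x² (u k)

  -- The rank-two component Z and its three directions.

  module Planar {n} (M Z : Matrix ℤ n) (s : Fin n → ℤ) {ω : ℤ} (ω≥1 : + 1 ≤ ω)
    (3M : ∀ i j → + 3 * M i j ≡ Z i j + s i * s j)
    (M-odd : ∀ i j → M i j ≡ + 1 [mod + 2 ])
    (Z-sym : ∀ i j → Z i j ≡ Z j i)
    (ZZ : ∀ i j → dot (Z i) (Z j) ≡ ω * Z i j)
    (sZ : ∀ i → dot s (Z i) ≡ + 0)
    (shape : ∀ i → (Sign (s i) × Z i i ≡ + 8) ⊎ ((s i ≡ + 3 ⊎ s i ≡ - (+ 3)) × Z i i ≡ + 0))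
    (trZ : tr Z ≡ + 2 * ω)
    where

    -- The indices with nonzero row of Z. At all others `shape` gives Z i i = 0, and then |Z i|² = ω
    -- Z i i makes the row vanish.
    Short : Fin n → Set
    Short i = Sign (s i) × Z i i ≡ + 8

    norm : ∀ a b i j → dot (λ k → a * Z i k + b * Z j k) (λ k → a * Z i k + b * Z j k)
      ≡ ω * (a * a * Z i i + + 2 * (a * b * Z i j) + b * b * Z j j)
    norm a b i j = begin
      _ ≡⟨ dot-bilinear a b a b (Z i) (Z j) (Z i) (Z j) ⟩
      a * (a * dot (Z i) (Z i) + b * dot (Z i) (Z j)) + b * (a * dot (Z j) (Z i) + b * dot (Z j) (Z j))
        ≡⟨ cong₂ (λ x y → a * x + b * y) (cong₂ (λ x y → a * x + b * y) (ZZ i i) (ZZ i j))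
             (cong₂ (λ x y → a * x + b * y) (trans (ZZ j i) (cong (ω *_) (Z-sym j i))) (ZZ j j)) ⟩
      a * (a * (ω * Z i i) + b * (ω * Z i j)) + b * (a * (ω * Z i j) + b * (ω * Z j j))
        ≡⟨ lem a b ω (Z i i) (Z i j) (Z j j) ⟩
      ω * (a * a * Z i i + + 2 * (a * b * Z i j) + b * b * Z j j) ∎
      where
      lem : ∀ a b w x y z → a * (a * (w * x) + b * (w * y)) + b * (a * (w * y) + b * (w * z))
        ≡ w * (a * a * x + + 2 * (a * b * y) + b * b * z)
      lem = solve-∀

    null-row : ∀ i → Z i i ≡ + 0 → ∀ j → Z i j ≡ + 0
    null-row i e = ∑²≡0⇒≡0 (Z i) (trans (ZZ i i) (trans (cong (ω *_) e) (ℤₚ.*-zeroʳ ω)))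

    null-column : ∀ i j → Z j j ≡ + 0 → Z i j ≡ + 0
    null-column i j e = trans (Z-sym i j) (null-row j e i)

    -- Angles between the rows of Z after the signs of `s` are absorbed: for short `i` and `j`, T i
    -- j / 8 is the cosine between s i · Z i and s j · Z j. The values 8 and -4 mean angles 0 and
    -- 120°.
    T : Matrix ℤ n
    T i j = s i * s j * Z i j

    T-sym : ∀ i j → T i j ≡ T j i
    T-sym i j = cong₂ _*_ (ℤₚ.*-comm (s i) (s j)) (Z-sym i j)

    T-diagonal : ∀ {i} → Short i → T i i ≡ + 8
    T-diagonal (±s , Zii) = cong₂ _*_ (sign² ±s) Zii

    T-null : ∀ i j → Z j j ≡ + 0 → T i j ≡ + 0
    T-null i j e = trans (cong (s i * s j *_) (null-column i j e)) (ℤₚ.*-zeroʳ (s i * s j))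

    -- From Z = 3 M - s sᵀ and s i² = s j² = 1, T i j = 3 (s i s j M i j) - 1, where the bracket is
    -- odd.
    T-mod₆ : ∀ i j → Short i → Short j → T i j ≡ + 2 [mod + 6 ]
    T-mod₆ i j (±i , _) (±j , _) = quotient N , (begin
      s i * s j * Z i j
        ≡⟨ lem₁ (s i) (s j) (Z i j) ⟩
      s i * s j * (Z i j + s i * s j) + - (s i * s i * (s j * s j))
        ≡⟨ cong₂ (λ x y → s i * s j * x + - y) (sym (3M i j)) (cong₂ _*_ (sign² ±i) (sign² ±j)) ⟩
      s i * s j * (+ 3 * M i j) + - (+ 1 * + 1)
        ≡⟨ lem₂ (s i * s j) (M i j) ⟩
      + 3 * (s i * s j * M i j) + - (+ 1)
        ≡⟨ cong (λ x → + 3 * x + - (+ 1)) (equality N) ⟩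
      + 3 * (+ 1 + + 2 * quotient N) + - (+ 1)
        ≡⟨ lem₃ (quotient N) ⟩
      + 2 + + 6 * quotient N ∎)
      where
      N : s i * s j * M i j ≡ + 1 [mod + 2 ]
      N = mod-* (mod-* (sign-odd ±i) (sign-odd ±j)) (M-odd i j)
      lem₁ : ∀ a b z → a * b * z ≡ a * b * (z + a * b) + - (a * a * (b * b))
      lem₁ = solve-∀
      lem₂ : ∀ a m → a * (+ 3 * m) + - (+ 1 * + 1) ≡ + 3 * (a * m) + - (+ 1)
      lem₂ = solve-∀
      lem₃ : ∀ z → + 3 * (+ 1 + + 2 * z) + - (+ 1) ≡ + 2 + + 6 * z
      lem₃ = solve-∀

    -- Cauchy-Schwarz, from the square of s i · Z i + a s j · Z j.
    T-bound : ∀ i j → Short i → Short j → ∀ a → Sign a → + 0 ≤ + 8 + a * T i j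
    T-bound i j (±i , Zii) (±j , Zjj) a ±a = nonneg-cancel (+ 2) _ (+≤+ (s≤s z≤n)) (nonneg-cancel ω _ ω≥1
      (subst (+ 0 ≤_) (trans (norm (s i) (a * s j) i j) (cong (ω *_) (begin
        s i * s i * Z i i + + 2 * (s i * (a * s j) * Z i j) + a * s j * (a * s j) * Z j j
          ≡⟨ lem a (s i) (s j) (Z i i) (Z i j) (Z j j) ⟩
        s i * s i * Z i i + + 2 * (a * T i j) + (a * a) * (s j * s j) * Z j j
          ≡⟨ cong₂ (λ x y → x + + 2 * (a * T i j) + y) (cong₂ _*_ (sign² ±i) Zii)
               (cong₂ _*_ (cong₂ _*_ (sign² ±a) (sign² ±j)) Zjj) ⟩
        + 8 + + 2 * (a * T i j) + + 8
          ≡⟨ lem′ (a * T i j) ⟩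
        + 2 * (+ 8 + a * T i j) ∎)))
        (dot≥0 (λ k → s i * Z i k + a * s j * Z j k))))
      where
      lem : ∀ a b c x y z → b * b * x + + 2 * (b * (a * c) * y) + a * c * (a * c) * z
        ≡ b * b * x + + 2 * (a * (b * c * y)) + (a * a) * (c * c) * z
      lem = solve-∀
      lem′ : ∀ x → + 8 + + 2 * x + + 8 ≡ + 2 * (+ 8 + x)
      lem′ = solve-∀

    T-range : ∀ i j → Short i → Short j → (T i j ≡ + 2) ⊎ ((T i j ≡ + 8) ⊎ (T i j ≡ - (+ 4)))
    T-range i j si sj = cases (quotient T₆) (equality T₆) lower
      -- Adding 2 makes the bound 10 + 6z ≥ 0 divisible by 6 and yields z ≥ -2; the value z = -2 is
      -- excluded by `lower` itself.
      (nonneg-cancel (+ 6) _ (+≤+ (s≤s z≤n)) (subst (+ 0 ≤_) (lem₂ (quotient T₆)) (ℤₚ.+-mono-≤ lower (+≤+ {n = 2} z≤n))))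
      (nonneg-cancel (+ 6) _ (+≤+ (s≤s z≤n)) (subst (+ 0 ≤_)
        (trans (cong (λ x → + 8 + - (+ 1) * x) (equality T₆)) (lem₃ (quotient T₆)))
        (T-bound i j si sj (- (+ 1)) (inj₂ refl))))
      where
      T₆ = T-mod₆ i j si sj
      lem₁ : ∀ z → + 8 + + 1 * (+ 2 + + 6 * z) ≡ + 10 + + 6 * z
      lem₁ = solve-∀
      lem₂ : ∀ z → + 10 + + 6 * z + + 2 ≡ + 6 * (+ 2 + z)
      lem₂ = solve-∀
      lem₃ : ∀ z → + 8 + - (+ 1) * (+ 2 + + 6 * z) ≡ + 6 * (+ 1 + - z)
      lem₃ = solve-∀
      lower : + 0 ≤ + 10 + + 6 * quotient T₆
      lower = subst (+ 0 ≤_) (trans (cong (λ x → + 8 + + 1 * x) (equality T₆)) (lem₁ (quotient T₆)))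
        (T-bound i j si sj (+ 1) (inj₁ refl))
      cases : ∀ z → T i j ≡ + 2 + + 6 * z → + 0 ≤ + 10 + + 6 * z → + 0 ≤ + 2 + z → + 0 ≤ + 1 + - z →
        (T i j ≡ + 2) ⊎ ((T i j ≡ + 8) ⊎ (T i j ≡ - (+ 4)))
      cases (+ zero)             e _ _ _ = inj₁ e
      cases (+ suc zero)         e _ _ _ = inj₂ (inj₁ e)
      cases (+ suc (suc z))      e _ _ ()
      cases -[1+ zero ]          e _ _ _ = inj₂ (inj₂ e)
      cases -[1+ suc zero ]      e () _ _
      cases -[1+ suc (suc z) ]   e _ () _

    ∑T : ∀ i → ∑ (T i) ≡ + 0
    ∑T i = begin
      ∑ (λ j → s i * s j * Z i j)     ≡⟨ (∑-cong λ j → ℤₚ.*-assoc (s i) (s j) (Z i j)) ⟩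
      ∑ (λ j → s i * (s j * Z i j))   ≡⟨ *-∑ (s i) (λ j → s j * Z i j) ⟨
      s i * dot s (Z i)               ≡⟨ cong (s i *_) (sZ i) ⟩
      s i * + 0                       ≡⟨ ℤₚ.*-zeroʳ (s i) ⟩
      + 0                             ∎

    -- (8 - T)(T + 4) ≥ 0 sums to zero along a row, which excludes T = 2.
    slack : Matrix ℤ n
    slack i j = + 4 * T i j + + 1 * (+ 4 * Z j j + - (+ 1) * (Z i j * Z i j))

    -- `slack` is written with 4 Z j j and (Z i j)² in place of 32 and (T i j)². The forms agree at
    -- short `j`, null columns contribute 0, and a row sum becomes 4 tr Z - |Z i|² = 8ω - 8ω.
    slack-short : ∀ i j → Short i → Short j → slack i j ≡ + 4 * T i j + + 32 + - (T i j * T i j)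
    slack-short i j (±i , _) (±j , Zjj) = begin
      + 4 * T i j + + 1 * (+ 4 * Z j j + - (+ 1) * (Z i j * Z i j))
        ≡⟨ cong₂ (λ x y → + 4 * T i j + + 1 * (+ 4 * x + - (+ 1) * y)) Zjj (begin
             Z i j * Z i j
               ≡⟨ lem₁ (Z i j) ⟩
             + 1 * + 1 * (Z i j * Z i j)
               ≡⟨ cong₂ (λ x y → x * y * (Z i j * Z i j)) (sign² ±i) (sign² ±j) ⟨
             s i * s i * (s j * s j) * (Z i j * Z i j)
               ≡⟨ lem₂ (s i) (s j) (Z i j) ⟩
             T i j * T i j ∎) ⟩
      + 4 * T i j + + 1 * (+ 4 * + 8 + - (+ 1) * (T i j * T i j))
        ≡⟨ lem₃ (T i j) ⟩
      + 4 * T i j + + 32 + - (T i j * T i j) ∎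
      where
      lem₁ : ∀ z → z * z ≡ + 1 * + 1 * (z * z)
      lem₁ = solve-∀
      lem₂ : ∀ a b z → a * a * (b * b) * (z * z) ≡ a * b * z * (a * b * z)
      lem₂ = solve-∀
      lem₃ : ∀ x → + 4 * x + + 1 * (+ 4 * + 8 + - (+ 1) * (x * x)) ≡ + 4 * x + + 32 + - (x * x)
      lem₃ = solve-∀

    slack≥0 : ∀ i j → Short i → + 0 ≤ slack i j
    slack≥0 i j si = [ short , null ]′ (shape j)
      where
      value : ∀ {x} → T i j ≡ x → Short j → slack i j ≡ + 4 * x + + 32 + - (x * x)
      value e sj = trans (slack-short i j si sj) (cong (λ x → + 4 * x + + 32 + - (x * x)) e)
      short : Short j → + 0 ≤ slack i j
      short sj = [ (λ e → subst (+ 0 ≤_) (sym (value e sj)) (+≤+ z≤n))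
                 , [ (λ e → subst (+ 0 ≤_) (sym (value e sj)) (+≤+ z≤n))
                   , (λ e → subst (+ 0 ≤_) (sym (value e sj)) (+≤+ z≤n)) ]′ ]′ (T-range i j si sj)
      null : _ × Z j j ≡ + 0 → + 0 ≤ slack i j
      null (_ , e) = ℤₚ.≤-reflexive (sym (trans
        (cong₂ (λ x y → + 4 * x + + 1 * y) (T-null i j e)
          (cong₂ (λ x y → + 4 * x + - (+ 1) * (y * y)) e (null-column i j e))) refl))

    ∑slack : ∀ i → Short i → ∑ (slack i) ≡ + 0
    ∑slack i (_ , Zii) = begin
      ∑ (slack i)
        ≡⟨ ∑-linear (+ 4) (+ 1) (T i) (λ j → + 4 * Z j j + - (+ 1) * (Z i j * Z i j)) ⟩
      + 4 * ∑ (T i) + + 1 * ∑ (λ j → + 4 * Z j j + - (+ 1) * (Z i j * Z i j))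
        ≡⟨ cong₂ (λ x y → + 4 * x + + 1 * y) (∑T i) (∑-linear (+ 4) (- (+ 1)) (λ j → Z j j) (λ j → Z i j * Z i j)) ⟩
      + 4 * + 0 + + 1 * (+ 4 * tr Z + - (+ 1) * dot (Z i) (Z i))
        ≡⟨ cong₂ (λ x y → + 4 * + 0 + + 1 * (+ 4 * x + - (+ 1) * y)) trZ (trans (ZZ i i) (cong (ω *_) Zii)) ⟩
      + 4 * + 0 + + 1 * (+ 4 * (+ 2 * ω) + - (+ 1) * (ω * + 8))
        ≡⟨ lem ω ⟩
      + 0 ∎
      where
      lem : ∀ w → + 4 * + 0 + + 1 * (+ 4 * (+ 2 * w) + - (+ 1) * (w * + 8)) ≡ + 0
      lem = solve-∀

    T-values : ∀ i j → Short i → Short j → (T i j ≡ + 8) ⊎ (T i j ≡ - (+ 4))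
    T-values i j si sj = [ (λ e → ⊥-elim (36≢0 (trans
          (sym (trans (slack-short i j si sj) (cong (λ x → + 4 * x + + 32 + - (x * x)) e)))
          (∑≡0⇒≡0 (slack i) (λ j → slack≥0 i j si) (∑slack i si) j))))
      , (λ h → h) ]′ (T-range i j si sj)
      where
      36≢0 : + 36 ≢ + 0
      36≢0 ()

    T≢0⇒short : ∀ i j → T i j ≢ + 0 → Short j
    T≢0⇒short i j ne = [ (λ h → h) , (λ h → ⊥-elim (ne (T-null i j (proj₂ h)))) ]′ (shape j)

    -- The row sums to zero and contains T o o = 8, so it has a negative entry, and -4 is the only
    -- negative value.
    second : ∀ o → Short o → ∃ λ j → T o j ≡ - (+ 4)
    second o so = decide (any? λ j → T o j ℤ.≟ - (+ 4))
      where
      decide : Dec (∃ λ j → T o j ≡ - (+ 4)) → ∃ λ j → T o j ≡ - (+ 4)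
      decide (yes found) = found
      decide (no none)   = ⊥-elim (8≢0 (trans (sym (T-diagonal so)) (∑≡0⇒≡0 (T o) T≥0 (∑T o) o)))
        where
        8≢0 : + 8 ≢ + 0
        8≢0 ()
        T≥0 : ∀ j → + 0 ≤ T o j
        T≥0 j = [ (λ sj → [ (λ e → subst (+ 0 ≤_) (sym e) (+≤+ z≤n)) , (λ e → ⊥-elim (none (j , e))) ]′ (T-values o j so sj))
                , (λ h → ℤₚ.≤-reflexive (sym (T-null o j (proj₂ h)))) ]′ (shape j)

    -- The sum of rows `o` and `p` of T adds up to zero and equals 8 - 4 at `o`, so it is negative
    -- somewhere. Of the possible values 16, 4, 0, -8 only the last is negative, and it needs -4 in
    -- both rows.
    third : ∀ o p → Short o → Short p → T o p ≡ - (+ 4) → ∃ λ j → (T o j ≡ - (+ 4)) × (T p j ≡ - (+ 4))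
    third o p so sp Top = decide (any? λ j → T o j + T p j ℤ.≟ - (+ 8))
      where
      decide : Dec (∃ λ j → T o j + T p j ≡ - (+ 8)) → ∃ λ j → (T o j ≡ - (+ 4)) × (T p j ≡ - (+ 4))
      decide (yes (j , e)) = j , [ short , (λ h → null (proj₂ h)) ]′ (shape j)
        where
        absurd : ∀ {x y} → T o j ≡ x → T p j ≡ y → x + y ≢ - (+ 8) → (T o j ≡ - (+ 4)) × (T p j ≡ - (+ 4))
        absurd f g ne = ⊥-elim (ne (trans (sym (cong₂ _+_ f g)) e))
        null : Z j j ≡ + 0 → (T o j ≡ - (+ 4)) × (T p j ≡ - (+ 4))
        null z = absurd (T-null o j z) (T-null p j z) λ ()
        short : Short j → (T o j ≡ - (+ 4)) × (T p j ≡ - (+ 4))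
        short sj = [ (λ f → [ (λ g → absurd f g λ ()) , (λ g → absurd f g λ ()) ]′ (T-values p j sp sj))
                   , (λ f → [ (λ g → absurd f g λ ()) , (λ g → f , g) ]′ (T-values p j sp sj)) ]′ (T-values o j so sj)
      decide (no none) = ⊥-elim (4≢0 (trans (sym (cong₂ _+_ (T-diagonal so) (trans (T-sym p o) Top)))
        (∑≡0⇒≡0 (λ j → T o j + T p j) sum≥0 (trans (∑-+ (T o) (T p)) (cong₂ _+_ (∑T o) (∑T p))) o)))
        where
        4≢0 : + 4 ≢ + 0
        4≢0 ()
        known : ∀ {x y j} → T o j ≡ x → T p j ≡ y → + 0 ≤ x + y → + 0 ≤ T o j + T p j
        known f g = subst (+ 0 ≤_) (sym (cong₂ _+_ f g))
        sum≥0 : ∀ j → + 0 ≤ T o j + T p j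
        sum≥0 j = [ short , (λ h → known (T-null o j (proj₂ h)) (T-null p j (proj₂ h)) (+≤+ z≤n)) ]′ (shape j)
          where
          short : Short j → + 0 ≤ T o j + T p j
          short sj = [ (λ f → [ (λ g → known f g (+≤+ z≤n)) , (λ g → known f g (+≤+ z≤n)) ]′ (T-values p j sp sj))
                     , (λ f → [ (λ g → known f g (+≤+ z≤n)) , (λ g → ⊥-elim (none (j , cong₂ _+_ f g))) ]′ (T-values p j sp sj)) ]′
                     (T-values o j so sj)

    y : Matrix ℤ n
    y d j = s d * Z d j

    y-T : ∀ d j → Sign (s j) → y d j ≡ s j * T d j
    y-T d j ±j = trans (lem₁ (s d * Z d j)) (trans (cong (_* (s d * Z d j)) (sym (sign² ±j))) (lem₂ (s d) (s j) (Z d j)))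
      where
      lem₁ : ∀ x → x ≡ + 1 * x
      lem₁ = solve-∀
      lem₂ : ∀ a b z → b * b * (a * z) ≡ b * (a * b * z)
      lem₂ = solve-∀

    dot-yy : ∀ d e → dot (y d) (y e) ≡ ω * T d e
    dot-yy d e = trans (dot-scale (s d) (s e) (Z d) (Z e)) (trans (cong (s d * s e *_) (ZZ d e))
      (lem (s d * s e) ω (Z d e)))
      where
      lem : ∀ a w z → a * (w * z) ≡ w * (a * z)
      lem = solve-∀

    dot-sy : ∀ d → dot s (y d) ≡ + 0
    dot-sy d = trans (∑-cong λ k → lem (s k) (s d) (Z d k)) (trans (sym (*-∑ (s d) (λ k → s k * Z d k)))
      (trans (cong (s d *_) (sZ d)) (ℤₚ.*-zeroʳ (s d))))
      where
      lem : ∀ a b z → a * (b * z) ≡ b * (a * z)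
      lem = solve-∀

    -- The sign vector attached to direction `d`. If s = u₁ + u₂ + u₃, the part of a uᵢ in the plane
    -- is uᵢ - s/3, here taken to be - y d / 6. At short `j` the right side is -6 s j or 6 s j
    -- according to T = 8 or -4; elsewhere y d j = 0 and 2 s j = ±6.
    U : ∀ d → Short d → ∀ j → ∃ λ u → Sign u × + 6 * u ≡ + 2 * s j + - (+ 1) * y d j
    U d sd j = [ short , long ]′ (shape j)
      where
      value : ∀ {x} → T d j ≡ x → Sign (s j) → + 2 * s j + - (+ 1) * y d j ≡ s j * (+ 2 + - x)
      value {x} e ±j = trans (cong (λ z → + 2 * s j + - (+ 1) * z) (trans (y-T d j ±j) (cong (s j *_) e))) (lem (s j) x)
        where
        lem : ∀ s x → + 2 * s + - (+ 1) * (s * x) ≡ s * (+ 2 + - x)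
        lem = solve-∀
      short : Short j → ∃ λ u → Sign u × + 6 * u ≡ + 2 * s j + - (+ 1) * y d j
      short (±j , Zjj) =
        [ (λ e → - s j , neg-sign ±j , trans (lem₁ (s j)) (sym (value e ±j)))
        , (λ e → s j , ±j , trans (ℤₚ.*-comm (+ 6) (s j)) (sym (value e ±j))) ]′ (T-values d j sd (±j , Zjj))
        where
        neg-sign : ∀ {x} → Sign x → Sign (- x)
        neg-sign (inj₁ refl) = inj₂ refl
        neg-sign (inj₂ refl) = inj₁ refl
        lem₁ : ∀ x → + 6 * - x ≡ x * (+ 2 + - (+ 8))
        lem₁ = solve-∀
      long : (s j ≡ + 3 ⊎ s j ≡ - (+ 3)) × Z j j ≡ + 0 → ∃ λ u → Sign u × + 6 * u ≡ + 2 * s j + - (+ 1) * y d j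
      long (h , z) = [ (λ e → + 1 , inj₁ refl , sym (value′ e)) , (λ e → - (+ 1) , inj₂ refl , sym (value′ e)) ]′ h
        where
        value′ : ∀ {x} → s j ≡ x → + 2 * s j + - (+ 1) * y d j ≡ + 2 * x + - (+ 1) * + 0
        value′ e = cong₂ (λ a b → + 2 * a + - (+ 1) * b) e
          (trans (cong (s d *_) (null-column d j z)) (ℤₚ.*-zeroʳ (s d)))

    module Triple (d e f : Fin n) (sd : Short d) (se : Short e) (sf : Short f)
      (Tde : T d e ≡ - (+ 4)) (Tdf : T d f ≡ - (+ 4)) (Tef : T e f ≡ - (+ 4)) where

      private
        w : Fin n → ℤ
        w k = y d k + y e k + y f k

        dot-yw : ∀ x {a b c} → T x d ≡ a → T x e ≡ b → T x f ≡ c → a + b + c ≡ + 0 → dot (y x) w ≡ + 0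
        dot-yw x {a} {b} {c} p q r z = begin
          dot (y x) w
            ≡⟨ trans (dot-comm (y x) w) (dot-+³ (y d) (y e) (y f) (y x)) ⟩
          dot (y d) (y x) + dot (y e) (y x) + dot (y f) (y x)
            ≡⟨ cong₂ _+_ (cong₂ _+_ (trans (dot-yy d x) (cong (ω *_) (trans (T-sym d x) p)))
                                    (trans (dot-yy e x) (cong (ω *_) (trans (T-sym e x) q))))
                 (trans (dot-yy f x) (cong (ω *_) (trans (T-sym f x) r))) ⟩
          ω * a + ω * b + ω * c
            ≡⟨ lem ω a b c ⟩
          ω * (a + b + c)
            ≡⟨ trans (cong (ω *_) z) (ℤₚ.*-zeroʳ ω) ⟩
          + 0 ∎
          where
          lem : ∀ w a b c → w * a + w * b + w * c ≡ w * (a + b + c)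
          lem = solve-∀

      -- Three vectors of equal length at mutual angle 120° sum to zero: by 8 - 4 - 4 = 0 the sum is
      -- orthogonal to each of them, hence to itself.
      ∑y≡0 : ∀ k → y d k + y e k + y f k ≡ + 0
      ∑y≡0 = ∑²≡0⇒≡0 w (trans (dot-+³ (y d) (y e) (y f) w) (cong₂ _+_ (cong₂ _+_
        (dot-yw d (T-diagonal sd) Tde Tdf refl)
        (dot-yw e (trans (T-sym e d) Tde) (T-diagonal se) Tef refl))
        (dot-yw f (trans (T-sym f d) Tdf) (trans (T-sym f e) Tef) (T-diagonal sf) refl)))

      -- T = 8 is equality in Cauchy-Schwarz: the difference of the two signed rows has squared
      -- length ω (8 - 16 + 8).
      parallel : ∀ i x → Short i → Short x → T x i ≡ + 8 → ∀ j → Z i j ≡ s i * y x j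
      parallel i x (±i , Zii) (±x , Zxx) Txi j = trans (lem₀ (Z i j) (s i * y x j))
        (trans (cong (λ z → s i * y x j + z) (trans (lem₁ (s i) (s x) (Z i j) (Z x j)) (∑²≡0⇒≡0 (λ k → + 1 * Z i k + - (s i * s x) * Z x k) zero-norm j))) (ℤₚ.+-identityʳ _))
        where
        lem₀ : ∀ a b → a ≡ b + (a + - b)
        lem₀ = solve-∀
        lem₁ : ∀ a b z w → z + - (a * (b * w)) ≡ + 1 * z + - (a * b) * w
        lem₁ = solve-∀
        lem₂ : ∀ a b x y z → + 1 * + 1 * x + + 2 * (+ 1 * - (a * b) * y) + - (a * b) * - (a * b) * z
          ≡ x + - (+ 2 * (b * a * y)) + (a * a) * (b * b) * z
        lem₂ = solve-∀
        zero-norm : dot (λ k → + 1 * Z i k + - (s i * s x) * Z x k) (λ k → + 1 * Z i k + - (s i * s x) * Z x k) ≡ + 0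
        zero-norm = trans (norm (+ 1) (- (s i * s x)) i x) (trans (cong (ω *_) (trans
          (lem₂ (s i) (s x) (Z i i) (Z i x) (Z x x))
          (cong₂ _+_ (cong₂ (λ a b → a + - (+ 2 * b)) Zii (trans (cong (s x * s i *_) (Z-sym i x)) Txi))
            (cong₂ _*_ (cong₂ _*_ (sign² ±i) (sign² ±x)) Zxx)))) (ℤₚ.*-zeroʳ ω))

      -- For short `i` the entries T d i, T e i, T f i lie in {8, -4} and sum to zero, so exactly
      -- one of them is 8. Row i of Z is parallel to that direction, and the relation y d + y e + y
      -- f = 0 removes the other two.
      gram-y : ∀ i j → y d i * y d j + y e i * y e j + y f i * y f j ≡ + 12 * Z i j
      gram-y i j = [ short , null ]′ (shape i)
        where
        null : _ × Z i i ≡ + 0 → y d i * y d j + y e i * y e j + y f i * y f j ≡ + 12 * Z i j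
        null (_ , z) = trans (cong₂ _+_ (cong₂ _+_ (vanish d) (vanish e)) (vanish f))
          (sym (trans (cong (+ 12 *_) (null-row i z j)) refl))
          where
          vanish : ∀ x → y x i * y x j ≡ + 0
          vanish x = cong (_* y x j) (trans (cong (s x *_) (null-column x i z)) (ℤₚ.*-zeroʳ (s x)))
        ∑T≡0 : T d i + T e i + T f i ≡ + 0
        ∑T≡0 = trans (lem (s i) (s d) (s e) (s f) (Z d i) (Z e i) (Z f i))
          (trans (cong (s i *_) (∑y≡0 i)) (ℤₚ.*-zeroʳ (s i)))
          where
          lem : ∀ i a b c x y z → a * i * x + b * i * y + c * i * z ≡ i * (a * x + b * y + c * z)
          lem = solve-∀
        short : Short i → y d i * y d j + y e i * y e j + y f i * y f j ≡ + 12 * Z i j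
        short si@(±i , _) =
          [ (λ p → [ (λ q → [ (λ r → absurd p q r λ ()) , (λ r → absurd p q r λ ()) ]′ (T-values f i sf si))
                   , (λ q → [ (λ r → absurd p q r λ ())
                            , (λ r → trans (combine p q r) (trans (lem₁ (s i) (y d j) (y e j) (y f j)) (parallel′ d sd p)))
                            ]′ (T-values f i sf si)) ]′ (T-values e i se si))
          , (λ p → [ (λ q → [ (λ r → absurd p q r λ ())
                            , (λ r → trans (combine p q r) (trans (lem₂ (s i) (y d j) (y e j) (y f j)) (parallel′ e se q)))
                            ]′ (T-values f i sf si))
                   , (λ q → [ (λ r → trans (combine p q r) (trans (lem₃ (s i) (y d j) (y e j) (y f j)) (parallel′ f sf r)))
                            , (λ r → absurd p q r λ ()) ]′ (T-values f i sf si)) ]′ (T-values e i se si))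
          ]′ (T-values d i sd si)
          where
          absurd : ∀ {a b c} {A : Set} → T d i ≡ a → T e i ≡ b → T f i ≡ c → a + b + c ≢ + 0 → A
          absurd p q r ne = ⊥-elim (ne (trans (sym (cong₂ _+_ (cong₂ _+_ p q) r)) ∑T≡0))
          parallel′ : ∀ x → Short x → T x i ≡ + 8 → + 12 * (s i * y x j) ≡ + 12 * Z i j
          parallel′ x sx p = cong (+ 12 *_) (sym (parallel i x si sx p j))
          -- The added multiple of the zero sum shifts the coefficients 8, -4, -4 to 12, 0, 0.
          combine : ∀ {a b c} → T d i ≡ a → T e i ≡ b → T f i ≡ c →
            y d i * y d j + y e i * y e j + y f i * y f j ≡
            s i * (a * y d j + b * y e j + c * y f j + + 4 * (y d j + y e j + y f j))
          combine {a} {b} {c} p q r = begin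
            y d i * y d j + y e i * y e j + y f i * y f j
              ≡⟨ cong₂ _+_ (cong₂ _+_ (cong (_* y d j) (trans (y-T d i ±i) (cong (s i *_) p)))
                                      (cong (_* y e j) (trans (y-T e i ±i) (cong (s i *_) q))))
                           (cong (_* y f j) (trans (y-T f i ±i) (cong (s i *_) r))) ⟩
            s i * a * y d j + s i * b * y e j + s i * c * y f j
              ≡⟨ lem (s i) a b c (y d j) (y e j) (y f j) ⟩
            s i * (a * y d j + b * y e j + c * y f j + + 4 * + 0)
              ≡⟨ cong (λ z → s i * (a * y d j + b * y e j + c * y f j + + 4 * z)) (∑y≡0 j) ⟨
            s i * (a * y d j + b * y e j + c * y f j + + 4 * (y d j + y e j + y f j)) ∎
            where
            lem : ∀ s a b c x y z → s * a * x + s * b * y + s * c * z ≡ s * (a * x + b * y + c * z + + 4 * + 0)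
            lem = solve-∀
          lem₁ : ∀ s x y z → s * (+ 8 * x + - (+ 4) * y + - (+ 4) * z + + 4 * (x + y + z)) ≡ + 12 * (s * x)
          lem₁ = solve-∀
          lem₂ : ∀ s x y z → s * (- (+ 4) * x + + 8 * y + - (+ 4) * z + + 4 * (x + y + z)) ≡ + 12 * (s * y)
          lem₂ = solve-∀
          lem₃ : ∀ s x y z → s * (- (+ 4) * x + - (+ 4) * y + + 8 * z + + 4 * (x + y + z)) ≡ + 12 * (s * z)
          lem₃ = solve-∀

  square-roots : ∀ a {x} → x * x ≡ a * a → (x ≡ a) ⊎ (x ≡ - a)
  square-roots a {x} e = [ (λ z → inj₁ (trans (lem₁ x a) (trans (cong (λ w → w + a) z) (ℤₚ.+-identityˡ a))))
                         , (λ z → inj₂ (trans (lem₂ x a) (trans (cong (λ w → w + - a) z) (ℤₚ.+-identityˡ (- a))))) ]′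
    (ℤₚ.i*j≡0⇒i≡0∨j≡0 (x + - a) {x + a} (trans (lem₃ x a) (trans (cong (λ w → w + - (a * a)) e) (ℤₚ.+-inverseʳ (a * a)))))
    where
    lem₁ : ∀ x a → x ≡ x + - a + a
    lem₁ = solve-∀
    lem₂ : ∀ x a → x ≡ x + a + - a
    lem₂ = solve-∀
    lem₃ : ∀ x a → (x + - a) * (x + a) ≡ x * x + - (a * a)
    lem₃ = solve-∀

  consecutive-even : ∀ z → z * (z + + 1) ≡ + 0 [mod + 2 ]
  consecutive-even = λ { (+ n) → nonneg n ; -[1+ n ] → negative n (nonneg n) }
    where
    lem₁ : ∀ n → (+ 1 + n) * (+ 1 + n + + 1) ≡ n * (n + + 1) + + 2 * (+ 1 + n)
    lem₁ = solve-∀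
    lem₂ : ∀ q n → + 0 + + 2 * q + + 2 * n ≡ + 0 + + 2 * (q + n)
    lem₂ = solve-∀
    lem₃ : ∀ n → - (+ 1 + n) * (- (+ 1 + n) + + 1) ≡ n * (n + + 1)
    lem₃ = solve-∀
    step : ∀ n → + n * (+ n + + 1) ≡ + 0 [mod + 2 ] → + suc n * (+ suc n + + 1) ≡ + 0 [mod + 2 ]
    step n (q , e) = q + + suc n , trans (lem₁ (+ n)) (trans (cong (λ w → w + + 2 * + suc n) e) (lem₂ q (+ suc n)))
    nonneg : ∀ n → + n * (+ n + + 1) ≡ + 0 [mod + 2 ]
    nonneg zero    = + 0 , refl
    nonneg (suc n) = step n (nonneg n)
    negative : ∀ n → + n * (+ n + + 1) ≡ + 0 [mod + 2 ] → -[1+ n ] * (-[1+ n ] + + 1) ≡ + 0 [mod + 2 ]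
    negative n (q , e) = q , trans (lem₃ (+ n)) e

  odd² : ∀ {x} → x ≡ + 1 [mod + 2 ] → x * x ≡ + 1 [mod + 8 ]
  odd² {x} (z , e) = quotient c , trans (cong₂ _*_ e e) (trans (lem z) (trans (cong (λ w → + 1 + + 4 * w) (equality c)) (lem′ (quotient c))))
    where
    c = consecutive-even z
    lem : ∀ z → (+ 1 + + 2 * z) * (+ 1 + + 2 * z) ≡ + 1 + + 4 * (z * (z + + 1))
    lem = solve-∀
    lem′ : ∀ q → + 1 + + 4 * (+ 0 + + 2 * q) ≡ + 1 + + 8 * q
    lem′ = solve-∀

  1-mod-8 : ∀ {x} → x ≡ + 1 [mod + 8 ] → + 0 ≤ x → + 0 ≤ + 9 + - x → (x ≡ + 1) ⊎ (x ≡ + 9)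
  1-mod-8 {x} (z , e) x≥0 x≤9 = cases z e (subst (+ 0 ≤_) e x≥0)
    -- Adding 7 makes 1 + 8z ≥ 0 divisible by 8 and gives z ≥ -1; z = -1 contradicts the unrounded
    -- bound.
    (nonneg-cancel (+ 8) _ (+≤+ (s≤s z≤n)) (subst (+ 0 ≤_) (lem₁ z) (ℤₚ.+-mono-≤ (subst (+ 0 ≤_) e x≥0) (+≤+ {n = 7} z≤n))))
    (nonneg-cancel (+ 8) _ (+≤+ (s≤s z≤n)) (subst (+ 0 ≤_) (trans (cong (λ x → + 9 + - x) e) (lem₂ z)) x≤9))
    where
    lem₁ : ∀ z → + 1 + + 8 * z + + 7 ≡ + 8 * (+ 1 + z)
    lem₁ = solve-∀
    lem₂ : ∀ z → + 9 + - (+ 1 + + 8 * z) ≡ + 8 * (+ 1 + - z)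
    lem₂ = solve-∀
    cases : ∀ z → x ≡ + 1 + + 8 * z → + 0 ≤ + 1 + + 8 * z → + 0 ≤ + 1 + z → + 0 ≤ + 1 + - z → (x ≡ + 1) ⊎ (x ≡ + 9)
    cases (+ zero)        e _ _ _  = inj₁ e
    cases (+ suc zero)    e _ _ _  = inj₂ e
    cases (+ suc (suc z)) e _ _ ()
    cases -[1+ zero ]     e () _ _
    cases -[1+ suc z ]    e _ () _

  -- Case (d): splitting M along the eigenvalues 2 and -1.

  module Exceptional {n} {S : Matrix ℤ n} (seidel : IsSymmetricSeidel n S) {τ m : ℤ} (τ≥1 : + 1 ≤ τ)
    (m≡ : m ≡ + 4 * τ + + 1) (n≡ : + n ≡ + 4 * τ + - (+ 1))
    (ann : Annihilated m (+ 1) (+ 2) S (defect m S) (defect m S · S))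
    (trK : tr (defect m S · S) ≡ - (+ 6)) where

    open Seidel seidel

    M K Y Z : Matrix ℤ n
    M = defect m S
    K = M · S
    -- 3 M = Y + Z splits M along the eigenvalues 2 and -1 of S.
    Y i j = + 1 * K i j + + 1 * M i j
    Z i j = + 2 * M i j + - (+ 1) * K i j

    -- The nonzero eigenvalues of Y = (S + I) M and Z = (2 I - S) M. At S = 2 the factors of Y are 3
    -- and m - 4; at S = -1 those of Z are 3 and m - 1.
    λ′ ω : ℤ
    λ′ = + 3 * (m + - (+ 4))
    ω  = + 3 * (m + - (+ 1))

    open Products ann S-sym (defect-sym m)
    open Annihilated ann

    private
      kk km mm : ℤ → ℤ → ℤ
      kk k x = (m + - (+ 1 * + 1 + + 2)) * (+ 1 * k + + 2 * x) + - (+ 1 * + 2) * k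
      km k x = m * k + - (+ 1 * (+ 1 * k + + 2 * x) + + 2 * k)
      mm k x = m * x + - (+ 1 * k + + 2 * x)

      dot-MK : ∀ i j → dot (M i) (K j) ≡ km (K i j) (M i j)
      dot-MK i j = trans (dot-comm (M i) (K j)) (trans (dot-KM j i) (cong₂ km (K-sym j i) (defect-sym m j i)))

      products : ∀ a b c d i j → dot (λ k → a * K i k + b * M i k) (λ k → c * K j k + d * M j k) ≡
        a * (c * kk (K i j) (M i j) + d * km (K i j) (M i j)) + b * (c * km (K i j) (M i j) + d * mm (K i j) (M i j))
      products a b c d i j = trans (dot-bilinear a b c d (K i) (M i) (K j) (M j))
        (cong₂ (λ x y → a * x + b * y) (cong₂ (λ x y → c * x + d * y) (dot-KK i j) (dot-KM i j))
                                       (cong₂ (λ x y → c * x + d * y) (dot-MK i j) (dot-MM i j)))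

      Z-flip : ∀ i k → Z i k ≡ - (+ 1) * K i k + + 2 * M i k
      Z-flip i k = ℤₚ.+-comm (+ 2 * M i k) (- (+ 1) * K i k)

    dot-YY : ∀ i j → dot (Y i) (Y j) ≡ λ′ * Y i j
    dot-YY i j = trans (products (+ 1) (+ 1) (+ 1) (+ 1) i j) (lem m (K i j) (M i j))
      where
      lem : ∀ m k x →
        + 1 * (+ 1 * ((m + - (+ 1 * + 1 + + 2)) * (+ 1 * k + + 2 * x) + - (+ 1 * + 2) * k)
             + + 1 * (m * k + - (+ 1 * (+ 1 * k + + 2 * x) + + 2 * k)))
        + + 1 * (+ 1 * (m * k + - (+ 1 * (+ 1 * k + + 2 * x) + + 2 * k))
             + + 1 * (m * x + - (+ 1 * k + + 2 * x)))
        ≡ + 3 * (m + - (+ 4)) * (+ 1 * k + + 1 * x)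
      lem = solve-∀

    dot-YZ : ∀ i j → dot (Y i) (Z j) ≡ + 0
    dot-YZ i j = trans (∑-cong λ k → cong (Y i k *_) (Z-flip j k))
      (trans (products (+ 1) (+ 1) (- (+ 1)) (+ 2) i j) (lem m (K i j) (M i j)))
      where
      lem : ∀ m k x →
        + 1 * (- (+ 1) * ((m + - (+ 1 * + 1 + + 2)) * (+ 1 * k + + 2 * x) + - (+ 1 * + 2) * k)
             + + 2 * (m * k + - (+ 1 * (+ 1 * k + + 2 * x) + + 2 * k)))
        + + 1 * (- (+ 1) * (m * k + - (+ 1 * (+ 1 * k + + 2 * x) + + 2 * k))
             + + 2 * (m * x + - (+ 1 * k + + 2 * x)))
        ≡ + 0
      lem = solve-∀

    dot-ZZ : ∀ i j → dot (Z i) (Z j) ≡ ω * Z i j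
    dot-ZZ i j = trans (∑-cong λ k → cong₂ _*_ (Z-flip i k) (Z-flip j k))
      (trans (products (- (+ 1)) (+ 2) (- (+ 1)) (+ 2) i j) (lem m (K i j) (M i j)))
      where
      lem : ∀ m k x →
        - (+ 1) * (- (+ 1) * ((m + - (+ 1 * + 1 + + 2)) * (+ 1 * k + + 2 * x) + - (+ 1 * + 2) * k)
             + + 2 * (m * k + - (+ 1 * (+ 1 * k + + 2 * x) + + 2 * k)))
        + + 2 * (- (+ 1) * (m * k + - (+ 1 * (+ 1 * k + + 2 * x) + + 2 * k))
             + + 2 * (m * x + - (+ 1 * k + + 2 * x)))
        ≡ + 3 * (m + - (+ 1)) * (+ 2 * x + - (+ 1) * k)
      lem = solve-∀

    Y-sym : ∀ i j → Y i j ≡ Y j i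
    Y-sym i j = cong₂ (λ x y → + 1 * x + + 1 * y) (K-sym i j) (defect-sym m i j)

    Z-sym : ∀ i j → Z i j ≡ Z j i
    Z-sym i j = cong₂ (λ x y → + 2 * x + - (+ 1) * y) (defect-sym m i j) (K-sym i j)

    ω≡12τ : ω ≡ + 12 * τ
    ω≡12τ = trans (cong (λ m → + 3 * (m + - (+ 1))) m≡) (lem τ)
      where
      lem : ∀ τ → + 3 * (+ 4 * τ + + 1 + - (+ 1)) ≡ + 12 * τ
      lem = solve-∀

    λ≡ω-9 : λ′ ≡ ω + - (+ 9)
    λ≡ω-9 = lem m
      where
      lem : ∀ m → + 3 * (m + - (+ 4)) ≡ + 3 * (m + - (+ 1)) + - (+ 9)
      lem = solve-∀

    λ≥1 : + 1 ≤ λ′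
    λ≥1 = subst (+ 1 ≤_) (sym (trans λ≡ω-9 (cong (λ w → w + - (+ 9)) ω≡12τ)))
      (ℤₚ.≤-trans (+≤+ {n = 3} (s≤s z≤n)) (ℤₚ.+-monoˡ-≤ (- (+ 9)) (ℤₚ.*-monoˡ-≤-nonNeg (+ 12) τ≥1)))

    ω≥1 : + 1 ≤ ω
    ω≥1 = subst (+ 1 ≤_) (sym ω≡12τ) (ℤₚ.≤-trans (+≤+ {n = 12} (s≤s z≤n)) (ℤₚ.*-monoˡ-≤-nonNeg (+ 12) τ≥1))

    M-diagonal : ∀ i → M i i ≡ + 3
    M-diagonal i = trans (defect-diagonal m i) (trans (cong₂ (λ m n → m + - (n + - (+ 1))) m≡ n≡) (lem τ))
      where
      lem : ∀ τ → + 4 * τ + + 1 + - (+ 4 * τ + - (+ 1) + - (+ 1)) ≡ + 3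
      lem = solve-∀

    -- In `defect-mod₂` the coefficient m - 1 = 4τ is even and n - 2 = 4τ - 3 is odd.
    M-odd : ∀ i j → M i j ≡ + 1 [mod + 2 ]
    M-odd i j = quotient d + + 2 * τ * δ i j + - (+ 2 * τ) + + 1 , trans (equality d)
      (trans (cong₂ (λ m n → (m + - (+ 1)) * δ i j + - (n + - (+ 2)) + + 2 * quotient d) m≡ n≡) (lem τ (δ i j) (quotient d)))
      where
      d = defect-mod₂ m i j
      lem : ∀ τ d q → (+ 4 * τ + + 1 + - (+ 1)) * d + - (+ 4 * τ + - (+ 1) + - (+ 2)) + + 2 * q
        ≡ + 1 + + 2 * (q + + 2 * τ * d + - (+ 2 * τ) + + 1)
      lem = solve-∀

    trM : tr M ≡ + 3 * + n
    trM = trans (∑-cong M-diagonal) (trans (∑-const n (+ 3)) (ℤₚ.*-comm (+ n) (+ 3)))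

    -- Trace equal to the eigenvalue: the projection Y / λ′ has rank 1. In the same way `trZ` says
    -- that Z / ω has rank 2.
    trY : tr Y ≡ λ′
    trY = begin
      tr Y                            ≡⟨ ∑-linear (+ 1) (+ 1) (λ i → K i i) (λ i → M i i) ⟩
      + 1 * tr K + + 1 * tr M         ≡⟨ cong₂ (λ x y → + 1 * x + + 1 * y) trK (trans trM (cong (+ 3 *_) n≡)) ⟩
      + 1 * - (+ 6) + + 1 * (+ 3 * (+ 4 * τ + - (+ 1)))  ≡⟨ lem τ ⟩
      + 3 * (+ 4 * τ + + 1 + - (+ 4)) ≡⟨ cong (λ m → + 3 * (m + - (+ 4))) m≡ ⟨
      λ′                              ∎
      where
      lem : ∀ τ → + 1 * - (+ 6) + + 1 * (+ 3 * (+ 4 * τ + - (+ 1))) ≡ + 3 * (+ 4 * τ + + 1 + - (+ 4))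
      lem = solve-∀

    trZ : tr Z ≡ + 2 * ω
    trZ = begin
      tr Z                            ≡⟨ ∑-linear (+ 2) (- (+ 1)) (λ i → M i i) (λ i → K i i) ⟩
      + 2 * tr M + - (+ 1) * tr K     ≡⟨ cong₂ (λ x y → + 2 * x + - (+ 1) * y) (trans trM (cong (+ 3 *_) n≡)) trK ⟩
      + 2 * (+ 3 * (+ 4 * τ + - (+ 1))) + - (+ 1) * - (+ 6)  ≡⟨ lem τ ⟩
      + 2 * (+ 12 * τ)                ≡⟨ cong (+ 2 *_) ω≡12τ ⟨
      + 2 * ω                         ∎
      where
      lem : ∀ τ → + 2 * (+ 3 * (+ 4 * τ + - (+ 1))) + - (+ 1) * - (+ 6) ≡ + 2 * (+ 12 * τ)
      lem = solve-∀

    Z-diagonal : ∀ i → Z i i ≡ + 9 + - Y i i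
    Z-diagonal i = trans (lem (M i i) (K i i)) (cong (λ x → + 3 * x + - Y i i) (M-diagonal i))
      where
      lem : ∀ x k → + 2 * x + - (+ 1) * k ≡ + 3 * x + - (+ 1 * k + + 1 * x)
      lem = solve-∀

    -- The entries of row i of M are odd, so |M i|² ≡ n modulo 8. On the other hand |M i|² = (m - 1)
    -- M i i - Y i i with M i i = 3, so Y i i ≡ 3 (m - 1) - n = 8τ + 1.
    Y-mod₈ : ∀ i → Y i i ≡ + 1 [mod + 8 ]
    Y-mod₈ i = τ + - quotient c , (begin
      Y i i
        ≡⟨ lem₁ m (M i i) (K i i) ⟩
      m * M i i + - M i i + - (m * M i i + - (+ 1 * K i i + + 2 * M i i))
        ≡⟨ cong (λ x → m * M i i + - M i i + - x) (trans (sym (dot-MM i i)) (trans (equality c)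
             (cong (λ x → x + + 8 * quotient c) (trans (∑-const n (+ 1)) (ℤₚ.*-identityʳ (+ n)))))) ⟩
      m * M i i + - M i i + - (+ n + + 8 * quotient c)
        ≡⟨ cong (λ x → m * x + - x + - (+ n + + 8 * quotient c)) (M-diagonal i) ⟩
      m * + 3 + - (+ 3) + - (+ n + + 8 * quotient c)
        ≡⟨ cong₂ (λ m n → m * + 3 + - (+ 3) + - (n + + 8 * quotient c)) m≡ n≡ ⟩
      (+ 4 * τ + + 1) * + 3 + - (+ 3) + - (+ 4 * τ + - (+ 1) + + 8 * quotient c)
        ≡⟨ lem₂ τ (quotient c) ⟩
      + 1 + + 8 * (τ + - quotient c) ∎)
      where
      c : dot (M i) (M i) ≡ ∑ {n} (λ _ → + 1) [mod + 8 ]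
      c = mod-∑ λ j → odd² (M-odd i j)
      lem₁ : ∀ m x k → + 1 * k + + 1 * x ≡ m * x + - x + - (m * x + - (+ 1 * k + + 2 * x))
      lem₁ = solve-∀
      lem₂ : ∀ τ q → (+ 4 * τ + + 1) * + 3 + - (+ 3) + - (+ 4 * τ + - (+ 1) + + 8 * q) ≡ + 1 + + 8 * (τ + - q)
      lem₂ = solve-∀

    -- Both Y i i and Z i i = 9 - Y i i are nonnegative, being squared row lengths divided by λ′ and
    -- ω. Between 0 and 9 only 1 and 9 are 1 modulo 8.
    Y-values : ∀ i → (Y i i ≡ + 1) ⊎ (Y i i ≡ + 9)
    Y-values i = 1-mod-8 (Y-mod₈ i)
      (nonneg-cancel λ′ _ λ≥1 (subst (+ 0 ≤_) (dot-YY i i) (dot≥0 (Y i))))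
      (subst (+ 0 ≤_) (Z-diagonal i) (nonneg-cancel ω _ ω≥1 (subst (+ 0 ≤_) (dot-ZZ i i) (dot≥0 (Z i)))))

    -- If every diagonal entry were 9, tr Y would be 9n instead of tr K + tr M = 3n - 6, forcing 6
    -- (n + 1) = 0.
    base : ∃ λ o → Y o o ≡ + 1
    base = decide (any? λ i → Y i i ℤ.≟ + 1)
      where
      decide : Dec (∃ λ o → Y o o ≡ + 1) → ∃ λ o → Y o o ≡ + 1
      decide (yes found) = found
      decide (no none) = ⊥-elim (suc≢0 (zero-cancel (+ 6) (+ suc n) (+≤+ (s≤s z≤n)) (begin
        + 6 * + suc n
          ≡⟨ lem (+ n) ⟩
        + n * + 9 + - (+ 1 * - (+ 6) + + 1 * (+ 3 * + n))
          ≡⟨ cong₂ (λ x y → x + - y) (sym (trans (∑-cong all-9) (∑-const n (+ 9))))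
               (sym (trans (∑-linear (+ 1) (+ 1) (λ i → K i i) (λ i → M i i))
                           (cong₂ (λ x y → + 1 * x + + 1 * y) trK trM))) ⟩
        tr Y + - tr Y
          ≡⟨ ℤₚ.+-inverseʳ (tr Y) ⟩
        + 0 ∎)))
        where
        suc≢0 : + suc n ≢ + 0
        suc≢0 ()
        lem : ∀ n → + 6 * (+ 1 + n) ≡ n * + 9 + - (+ 1 * - (+ 6) + + 1 * (+ 3 * n))
        lem = solve-∀
        all-9 : ∀ i → Y i i ≡ + 9
        all-9 i = [ (λ e → ⊥-elim (none (i , e))) , (λ e → e) ]′ (Y-values i)

    o : Fin n
    o = proj₁ base

    s : Fin n → ℤ
    s = Y o

    -- Y is λ′ times a projection of trace 1, so its rows are multiples of one row.
    residual-norm : ∀ i → dot (λ k → + 1 * Y i k + - s i * s k) (λ k → + 1 * Y i k + - s i * s k)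
      ≡ λ′ * (Y i i + - (s i * s i))
    residual-norm i = begin
      _ ≡⟨ dot-bilinear (+ 1) (- s i) (+ 1) (- s i) (Y i) s (Y i) s ⟩
      + 1 * (+ 1 * dot (Y i) (Y i) + - s i * dot (Y i) s) + - s i * (+ 1 * dot s (Y i) + - s i * dot s s)
        ≡⟨ cong₂ (λ x y → + 1 * x + - s i * y)
             (cong₂ (λ x y → + 1 * x + - s i * y) (dot-YY i i) (trans (dot-YY i o) (cong (λ′ *_) (Y-sym i o))))
             (cong₂ (λ x y → + 1 * x + - s i * y) (dot-YY o i) (trans (dot-YY o o) (cong (λ′ *_) (proj₂ base)))) ⟩
      + 1 * (+ 1 * (λ′ * Y i i) + - s i * (λ′ * s i)) + - s i * (+ 1 * (λ′ * s i) + - s i * (λ′ * + 1))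
        ≡⟨ lem λ′ (Y i i) (s i) ⟩
      λ′ * (Y i i + - (s i * s i)) ∎
      where
      lem : ∀ l y s → + 1 * (+ 1 * (l * y) + - s * (l * s)) + - s * (+ 1 * (l * s) + - s * (l * + 1)) ≡ l * (y + - (s * s))
      lem = solve-∀

    -- Each term is nonnegative by `residual-norm`, and their sum is tr Y - |s|² = λ′ - λ′, because
    -- |s|² = λ′ Y o o with Y o o = 1.
    residual≡0 : ∀ i → Y i i + - (s i * s i) ≡ + 0
    residual≡0 = ∑≡0⇒≡0 (λ i → Y i i + - (s i * s i))
      (λ i → nonneg-cancel λ′ _ λ≥1 (subst (+ 0 ≤_) (residual-norm i) (dot≥0 (λ k → + 1 * Y i k + - s i * s k))))
      (begin
        ∑ (λ i → Y i i + - (s i * s i))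
          ≡⟨ (∑-cong λ i → lem (Y i i) (s i * s i)) ⟩
        ∑ (λ i → + 1 * Y i i + - (+ 1) * (s i * s i))
          ≡⟨ ∑-linear (+ 1) (- (+ 1)) (λ i → Y i i) (λ i → s i * s i) ⟩
        + 1 * tr Y + - (+ 1) * dot s s
          ≡⟨ cong₂ (λ x y → + 1 * x + - (+ 1) * y) trY (trans (dot-YY o o) (cong (λ′ *_) (proj₂ base))) ⟩
        + 1 * λ′ + - (+ 1) * (λ′ * + 1)
          ≡⟨ lem′ λ′ ⟩
        + 0 ∎)
      where
      lem : ∀ a b → a + - b ≡ + 1 * a + - (+ 1) * b
      lem = solve-∀
      lem′ : ∀ l → + 1 * l + - (+ 1) * (l * + 1) ≡ + 0
      lem′ = solve-∀

    Y≡ss : ∀ i j → Y i j ≡ s i * s j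
    Y≡ss i j = trans (lem (Y i j) (s i) (s j)) (trans (cong (λ z → z + s i * s j)
        (∑²≡0⇒≡0 (λ k → + 1 * Y i k + - s i * s k)
          (trans (residual-norm i) (trans (cong (λ′ *_) (residual≡0 i)) (ℤₚ.*-zeroʳ λ′))) j))
      (ℤₚ.+-identityˡ _))
      where
      lem : ∀ y a b → y ≡ + 1 * y + - a * b + a * b
      lem = solve-∀

    shape : ∀ i → (Sign (s i) × Z i i ≡ + 8) ⊎ ((s i ≡ + 3 ⊎ s i ≡ - (+ 3)) × Z i i ≡ + 0)
    shape i = [ (λ e → inj₁ (square-roots (+ 1) (trans (sym (Y≡ss i i)) e) , trans (Z-diagonal i) (cong (λ y → + 9 + - y) e)))
              , (λ e → inj₂ (square-roots (+ 3) (trans (sym (Y≡ss i i)) e) , trans (Z-diagonal i) (cong (λ y → + 9 + - y) e))) ]′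
      (Y-values i)

    3M≡Z+ss : ∀ i j → + 3 * M i j ≡ Z i j + s i * s j
    3M≡Z+ss i j = trans (lem (M i j) (K i j)) (cong (λ y → Z i j + y) (Y≡ss i j))
      where
      lem : ∀ x k → + 3 * x ≡ + 2 * x + - (+ 1) * k + (+ 1 * k + + 1 * x)
      lem = solve-∀

    open Planar M Z s ω≥1 3M≡Z+ss M-odd Z-sym dot-ZZ (λ i → dot-YZ o i) shape trZ

    private
      -- Rows of Y are eigenvectors of `S` for 2, as (S - 2 I)(S + I) M = 0; `SZ` is the same
      -- relation read for the eigenvalue -1.
      SY : ∀ j i → dot (S i) (Y j) ≡ + 2 * Y j i
      SY j i = begin
        dot (S i) (Y j)
          ≡⟨ trans (dot-comm (S i) (Y j)) (∑-cong λ k → cong (Y j k *_) (S-sym i k)) ⟩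
        dot (Y j) (λ k → S k i)
          ≡⟨ dot-linearˡ (+ 1) (+ 1) (K j) (M j) (λ k → S k i) ⟩
        + 1 * dot (K j) (λ k → S k i) + + 1 * dot (M j) (λ k → S k i)
          ≡⟨ cong₂ (λ x y → + 1 * x + + 1 * y) (K*S j i) (M*S j i) ⟩
        + 1 * (+ 1 * K j i + + 2 * M j i) + + 1 * K j i
          ≡⟨ lem (K j i) (M j i) ⟩
        + 2 * Y j i ∎
        where
        lem : ∀ k x → + 1 * (+ 1 * k + + 2 * x) + + 1 * k ≡ + 2 * (+ 1 * k + + 1 * x)
        lem = solve-∀

      SZ : ∀ j i → dot (S i) (Z j) ≡ - Z j i
      SZ j i = begin
        dot (S i) (Z j)
          ≡⟨ trans (dot-comm (S i) (Z j)) (∑-cong λ k → cong (Z j k *_) (S-sym i k)) ⟩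
        dot (Z j) (λ k → S k i)
          ≡⟨ dot-linearˡ (+ 2) (- (+ 1)) (M j) (K j) (λ k → S k i) ⟩
        + 2 * dot (M j) (λ k → S k i) + - (+ 1) * dot (K j) (λ k → S k i)
          ≡⟨ cong₂ (λ x y → + 2 * x + - (+ 1) * y) (M*S j i) (K*S j i) ⟩
        + 2 * K j i + - (+ 1) * (+ 1 * K j i + + 2 * M j i)
          ≡⟨ lem (K j i) (M j i) ⟩
        - Z j i ∎
        where
        lem : ∀ k x → + 2 * k + - (+ 1) * (+ 1 * k + + 2 * x) ≡ - (+ 2 * x + - (+ 1) * k)
        lem = solve-∀

      Sy : ∀ d i → dot (S i) (y d) ≡ - y d i
      Sy d i = begin
        ∑ (λ k → S i k * (s d * Z d k))  ≡⟨ (∑-cong λ k → lem (S i k) (s d) (Z d k)) ⟩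
        ∑ (λ k → s d * (S i k * Z d k))  ≡⟨ *-∑ (s d) (λ k → S i k * Z d k) ⟨
        s d * dot (S i) (Z d)            ≡⟨ cong (s d *_) (SZ d i) ⟩
        s d * - Z d i                    ≡⟨ ℤₚ.neg-distribʳ-* (s d) (Z d i) ⟨
        - y d i                          ∎
        where
        lem : ∀ a b c → a * (b * c) ≡ b * (a * c)
        lem = solve-∀

    u : ∀ d → Short d → Fin n → ℤ
    u d sd j = proj₁ (U d sd j)

    u-sign : ∀ d (sd : Short d) j → Sign (u d sd j)
    u-sign d sd j = proj₁ (proj₂ (U d sd j))

    6u : ∀ d (sd : Short d) j → + 6 * u d sd j ≡ + 2 * s j + - (+ 1) * y d j
    6u d sd j = proj₂ (proj₂ (U d sd j))

    -- From 6u = 2s - y and s ⟂ y, 36 times the product is 4 |s|² + y d · y e, where |s|² = ω - 9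
    -- and y d · y e = ω T d e.
    dot-uu : ∀ d e (sd : Short d) (se : Short e) x → ω * T d e + + 4 * (ω + - (+ 9)) ≡ + 36 * x →
      dot (u d sd) (u e se) ≡ x
    dot-uu d e sd se x h = ℤₚ.*-cancelˡ-≡ (+ 36) _ _ (begin
      + 36 * dot (u d sd) (u e se)
        ≡⟨ dot-scale (+ 6) (+ 6) (u d sd) (u e se) ⟨
      dot (λ k → + 6 * u d sd k) (λ k → + 6 * u e se k)
        ≡⟨ (∑-cong λ k → cong₂ _*_ (6u d sd k) (6u e se k)) ⟩
      dot (λ k → + 2 * s k + - (+ 1) * y d k) (λ k → + 2 * s k + - (+ 1) * y e k)
        ≡⟨ dot-bilinear (+ 2) (- (+ 1)) (+ 2) (- (+ 1)) s (y d) s (y e) ⟩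
      + 2 * (+ 2 * dot s s + - (+ 1) * dot s (y e)) + - (+ 1) * (+ 2 * dot (y d) s + - (+ 1) * dot (y d) (y e))
        ≡⟨ cong₂ (λ a b → + 2 * a + - (+ 1) * b)
             (cong₂ (λ a b → + 2 * a + - (+ 1) * b) ss (dot-sy e))
             (cong₂ (λ a b → + 2 * a + - (+ 1) * b) (trans (dot-comm (y d) s) (dot-sy d)) (dot-yy d e)) ⟩
      + 2 * (+ 2 * (ω + - (+ 9)) + - (+ 1) * + 0) + - (+ 1) * (+ 2 * + 0 + - (+ 1) * (ω * T d e))
        ≡⟨ lem (ω + - (+ 9)) (ω * T d e) ⟩
      ω * T d e + + 4 * (ω + - (+ 9))
        ≡⟨ h ⟩
      + 36 * x ∎)
      where
      ss : dot s s ≡ ω + - (+ 9)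
      ss = trans (dot-YY o o) (trans (cong (λ′ *_) (proj₂ base)) (trans (ℤₚ.*-identityʳ λ′) λ≡ω-9))
      lem : ∀ a b → + 2 * (+ 2 * a + - (+ 1) * + 0) + - (+ 1) * (+ 2 * + 0 + - (+ 1) * b) ≡ b + + 4 * a
      lem = solve-∀

    dot-uu-diagonal : ∀ d (sd : Short d) → dot (u d sd) (u d sd) ≡ + 4 * τ + - (+ 1)
    dot-uu-diagonal d sd = dot-uu d d sd sd _ (trans (cong₂ (λ w t → w * t + + 4 * (w + - (+ 9))) ω≡12τ (T-diagonal sd)) (lem τ))
      where
      lem : ∀ τ → + 12 * τ * + 8 + + 4 * (+ 12 * τ + - (+ 9)) ≡ + 36 * (+ 4 * τ + - (+ 1))
      lem = solve-∀

    dot-uu-off : ∀ d e (sd : Short d) (se : Short e) → T d e ≡ - (+ 4) → dot (u d sd) (u e se) ≡ - (+ 1)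
    dot-uu-off d e sd se Tde = dot-uu d e sd se _ (trans (cong (λ t → ω * t + + 4 * (ω + - (+ 9))) Tde) (lem ω))
      where
      lem : ∀ w → w * - (+ 4) + + 4 * (w + - (+ 9)) ≡ + 36 * - (+ 1)
      lem = solve-∀

    -- 6 S u = 4s + y d, because `s` and y d have eigenvalues 2 and -1. Replacing y d by - y e - y f
    -- splits this as (2s - y e) + (2s - y f).
    Su : ∀ d e f (sd : Short d) (se : Short e) (sf : Short f) → (∀ k → y d k + y e k + y f k ≡ + 0) →
      ∀ i → dot (S i) (u d sd) ≡ u e se i + u f sf i
    Su d e f sd se sf ∑y i = ℤₚ.*-cancelˡ-≡ (+ 6) _ _ (begin
      + 6 * dot (S i) (u d sd)
        ≡⟨ *-∑ (+ 6) (λ k → S i k * u d sd k) ⟩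
      ∑ (λ k → + 6 * (S i k * u d sd k))
        ≡⟨ (∑-cong λ k → trans (lem₁ (S i k) (u d sd k)) (cong (S i k *_) (6u d sd k))) ⟩
      dot (S i) (λ k → + 2 * s k + - (+ 1) * y d k)
        ≡⟨ dot-linearʳ (+ 2) (- (+ 1)) s (y d) (S i) ⟩
      + 2 * dot (S i) s + - (+ 1) * dot (S i) (y d)
        ≡⟨ cong₂ (λ a b → + 2 * a + - (+ 1) * b) (SY o i) (Sy d i) ⟩
      + 2 * (+ 2 * s i) + - (+ 1) * - y d i
        ≡⟨ lem₂ (s i) (y d i) (y e i) (y f i) ⟩
      (+ 2 * s i + - (+ 1) * y e i) + (+ 2 * s i + - (+ 1) * y f i) + (y d i + y e i + y f i)
        ≡⟨ cong₂ _+_ (cong₂ _+_ (sym (6u e se i)) (sym (6u f sf i))) (∑y i) ⟩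
      + 6 * u e se i + + 6 * u f sf i + + 0
        ≡⟨ lem₃ (u e se i) (u f sf i) ⟩
      + 6 * (u e se i + u f sf i) ∎)
      where
      lem₁ : ∀ a b → + 6 * (a * b) ≡ a * (+ 6 * b)
      lem₁ = solve-∀
      lem₂ : ∀ s p q r → + 2 * (+ 2 * s) + - (+ 1) * - p
        ≡ (+ 2 * s + - (+ 1) * q) + (+ 2 * s + - (+ 1) * r) + (p + q + r)
      lem₂ = solve-∀
      lem₃ : ∀ a b → + 6 * a + + 6 * b + + 0 ≡ + 6 * (a + b)
      lem₃ = solve-∀

    completion : Completion τ S M
    completion = record
      { u₁ = u d sd ; u₂ = u e se ; u₃ = u f sf
      ; ±u₁ = u-sign d sd ; ±u₂ = u-sign e se ; ±u₃ = u-sign f sf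
      ; u₁u₁ = dot-uu-diagonal d sd ; u₂u₂ = dot-uu-diagonal e se ; u₃u₃ = dot-uu-diagonal f sf
      ; u₁u₂ = dot-uu-off d e sd se Tde ; u₁u₃ = dot-uu-off d f sd sf Tdf ; u₂u₃ = dot-uu-off e f se sf Tef
      ; Su₁ = Su d e f sd se sf ∑y≡0
      ; Su₂ = Su e d f se sd sf (λ k → trans (swap₁ (y e k) (y d k) (y f k)) (∑y≡0 k))
      ; Su₃ = Su f d e sf sd se (λ k → trans (swap₂ (y f k) (y d k) (y e k)) (∑y≡0 k))
      ; gram = gram }
      where
      -- The base index is short because s o = Y o o = 1, so it can serve as the first direction.
      d = o
      sd : Short d
      sd = T≢0⇒short-base (shape o)
        where
        T≢0⇒short-base : _ → Short o
        T≢0⇒short-base (inj₁ h) = h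
        T≢0⇒short-base (inj₂ (inj₁ h , _)) = ⊥-elim (contra (trans (sym h) (proj₂ base)))
          where
          contra : + 3 ≢ + 1
          contra ()
        T≢0⇒short-base (inj₂ (inj₂ h , _)) = ⊥-elim (contra (trans (sym h) (proj₂ base)))
          where
          contra : - (+ 3) ≢ + 1
          contra ()
      e = proj₁ (second d sd)
      Tde : T d e ≡ - (+ 4)
      Tde = proj₂ (second d sd)
      -4≢0 : - (+ 4) ≢ + 0
      -4≢0 ()
      se : Short e
      se = T≢0⇒short d e λ h → -4≢0 (trans (sym Tde) h)
      f = proj₁ (third d e sd se Tde)
      Tdf : T d f ≡ - (+ 4)
      Tdf = proj₁ (proj₂ (third d e sd se Tde))
      Tef : T e f ≡ - (+ 4)
      Tef = proj₂ (proj₂ (third d e sd se Tde))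
      sf : Short f
      sf = T≢0⇒short d f λ h → -4≢0 (trans (sym Tdf) h)
      open Triple d e f sd se sf Tde Tdf Tef
      swap₁ : ∀ a b c → a + b + c ≡ b + a + c
      swap₁ = solve-∀
      swap₂ : ∀ a b c → a + b + c ≡ b + c + a
      swap₂ = solve-∀
      gram : ∀ i j → M i j ≡ u d sd i * u d sd j + u e se i * u e se j + u f sf i * u f sf j
      gram i j = ℤₚ.*-cancelˡ-≡ (+ 36) _ _ (begin
        + 36 * M i j
          ≡⟨ lem₁ (M i j) ⟩
        + 12 * (+ 3 * M i j)
          ≡⟨ cong (+ 12 *_) (3M≡Z+ss i j) ⟩
        + 12 * (Z i j + s i * s j)
          ≡⟨ lem₂ (Z i j) (s i) (s j) ⟩
        -- The two zeros stand for the vanishing sums of the three y; they are the cross terms in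
        -- the expansion of the products (2s - y)(2s - y).
        + 12 * (s i * s j) + - (+ 2) * (s i * + 0) + - (+ 2) * (+ 0 * s j) + + 12 * Z i j
          ≡⟨ cong₂ _+_ (cong₂ (λ a b → + 12 * (s i * s j) + - (+ 2) * (s i * a) + - (+ 2) * (b * s j))
               (sym (∑y≡0 j)) (sym (∑y≡0 i))) (sym (gram-y i j)) ⟩
        _ ≡⟨ lem₃ (s i) (s j) (y d i) (y e i) (y f i) (y d j) (y e j) (y f j) ⟩
        (+ 2 * s i + - (+ 1) * y d i) * (+ 2 * s j + - (+ 1) * y d j)
          + (+ 2 * s i + - (+ 1) * y e i) * (+ 2 * s j + - (+ 1) * y e j)
          + (+ 2 * s i + - (+ 1) * y f i) * (+ 2 * s j + - (+ 1) * y f j)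
          ≡⟨ cong₂ _+_ (cong₂ _+_ (cong₂ _*_ (sym (6u d sd i)) (sym (6u d sd j))) (cong₂ _*_ (sym (6u e se i)) (sym (6u e se j))))
               (cong₂ _*_ (sym (6u f sf i)) (sym (6u f sf j))) ⟩
        + 6 * u d sd i * (+ 6 * u d sd j) + + 6 * u e se i * (+ 6 * u e se j) + + 6 * u f sf i * (+ 6 * u f sf j)
          ≡⟨ lem₄ (u d sd i) (u e se i) (u f sf i) (u d sd j) (u e se j) (u f sf j) ⟩
        + 36 * (u d sd i * u d sd j + u e se i * u e se j + u f sf i * u f sf j) ∎)
        where
        lem₁ : ∀ x → + 36 * x ≡ + 12 * (+ 3 * x)
        lem₁ = solve-∀
        lem₂ : ∀ z s t → + 12 * (z + s * t) ≡ + 12 * (s * t) + - (+ 2) * (s * + 0) + - (+ 2) * (+ 0 * t) + + 12 * z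
        lem₂ = solve-∀
        lem₃ : ∀ s t a b c a′ b′ c′ →
          + 12 * (s * t) + - (+ 2) * (s * (a′ + b′ + c′)) + - (+ 2) * ((a + b + c) * t) + (a * a′ + b * b′ + c * c′)
          ≡ (+ 2 * s + - (+ 1) * a) * (+ 2 * t + - (+ 1) * a′) + (+ 2 * s + - (+ 1) * b) * (+ 2 * t + - (+ 1) * b′)
            + (+ 2 * s + - (+ 1) * c) * (+ 2 * t + - (+ 1) * c′)
        lem₃ = solve-∀
        lem₄ : ∀ a b c x y z → + 6 * a * (+ 6 * x) + + 6 * b * (+ 6 * y) + + 6 * c * (+ 6 * z) ≡ + 36 * (a * x + b * y + c * z)
        lem₄ = solve-∀

  -- Bordering by sign vectors.

  cons : ∀ {n} → ℤ → (Fin n → ℤ) → Fin (suc n) → ℤ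
  cons a v zero    = a
  cons a v (suc i) = v i

  border : ∀ {n} → Matrix ℤ n → (Fin n → ℤ) → Matrix ℤ (suc n)
  border S u zero    = cons (+ 0) u
  border S u (suc i) = cons (u i) (S i)

  dot-cons : ∀ {n} a b (v w : Fin n → ℤ) → dot (cons a v) (cons b w) ≡ a * b + dot v w
  dot-cons a b v w = ∑-∷ (λ i → cons a v i * cons b w i)

  cons-sign : ∀ {n a} {v : Fin n → ℤ} → Sign a → (∀ i → Sign (v i)) → ∀ i → Sign (cons a v i)
  cons-sign ±a ±v zero    = ±a
  cons-sign ±a ±v (suc i) = ±v i

  border-seidel : ∀ {n} {S : Matrix ℤ n} {u} → IsSymmetricSeidel n S → (∀ i → Sign (u i)) →
    IsSymmetricSeidel (suc n) (border S u)
  border-seidel {n} {S} {u} (S₀ , S± , S-sym) ±u = diagonal , signs , symmetric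
    where
    diagonal : ∀ i → border S u i i ≡ + 0
    diagonal zero    = refl
    diagonal (suc i) = S₀ i
    signs : ∀ i j → i ≢ j → Sign (border S u i j)
    signs zero    zero    ne = ⊥-elim (ne refl)
    signs zero    (suc j) ne = ±u j
    signs (suc i) zero    ne = ±u i
    signs (suc i) (suc j) ne = S± i j (ne ∘ cong suc)
    symmetric : ∀ i j → border S u i j ≡ border S u j i
    symmetric zero    zero    = refl
    symmetric zero    (suc j) = refl
    symmetric (suc i) zero    = refl
    symmetric (suc i) (suc j) = S-sym i j

  SquareDefect : ℤ → ∀ {n} → Matrix ℤ n → Matrix ℤ n → Set
  SquareDefect m {n} S M = ∀ (i j : Fin n) → ∑ (λ k → S i k * S k j) ≡ m * δ i j + - M i j

  -- On the old block the new row and column add u uᵀ to the square, so the defect M loses u uᵀ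
  -- there. `corner` and `edge` state the remaining blocks of the same equation.
  border-square : ∀ {m n} {S M : Matrix ℤ n} {u : Fin n → ℤ} {P : Matrix ℤ (suc n)} →
    (∀ i j → S i j ≡ S j i) → SquareDefect m S M →
    dot u u + P zero zero ≡ m → (∀ i → dot (S i) u + P (suc i) zero ≡ + 0) →
    (∀ i → P zero (suc i) ≡ P (suc i) zero) → (∀ i j → M i j ≡ u i * u j + P (suc i) (suc j)) →
    SquareDefect m (border S u) P
  border-square {m} {n} {S} {M} {u} {P} S-sym S² corner edge P-sym gram = go
    where
    open ≡-Reasoning
    column : ∀ i j → ∑ (λ k → border S u i k * border S u k j) ≡ border S u i zero * border S u zero j
      + ∑ (λ k → border S u i (suc k) * border S u (suc k) j)
    column i j = ∑-∷ (λ k → border S u i k * border S u k j)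
    go : SquareDefect m (border S u) P
    go zero zero = trans (column zero zero) (trans (lem (dot u u) (P zero zero)) (cong (λ z → z * + 1 + - P zero zero) corner))
      where
      lem : ∀ a p → + 0 * + 0 + a ≡ (a + p) * + 1 + - p
      lem = solve-∀
    go zero (suc j) = trans (column zero (suc j)) (begin
      + 0 * u j + ∑ (λ k → u k * S k j)
        ≡⟨ cong (λ z → + 0 * u j + z) (∑-cong λ k → trans (ℤₚ.*-comm (u k) (S k j)) (cong (_* u k) (S-sym k j))) ⟩
      + 0 * u j + dot (S j) u
        ≡⟨ lem (u j) (dot (S j) u) (P (suc j) zero) m ⟩
      m * + 0 + (dot (S j) u + P (suc j) zero) + - P (suc j) zero
        ≡⟨ cong₂ (λ a b → m * + 0 + a + - b) (edge j) (sym (P-sym j)) ⟩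
      m * + 0 + + 0 + - P zero (suc j)
        ≡⟨ cong (λ z → z + - P zero (suc j)) (ℤₚ.+-identityʳ (m * + 0)) ⟩
      m * + 0 + - P zero (suc j) ∎)
      where
      lem : ∀ u d p m → + 0 * u + d ≡ m * + 0 + (d + p) + - p
      lem = solve-∀
    go (suc i) zero = trans (column (suc i) zero) (begin
      u i * + 0 + dot (S i) u
        ≡⟨ lem (u i) (dot (S i) u) (P (suc i) zero) m ⟩
      m * + 0 + (dot (S i) u + P (suc i) zero) + - P (suc i) zero
        ≡⟨ cong (λ a → m * + 0 + a + - P (suc i) zero) (edge i) ⟩
      m * + 0 + + 0 + - P (suc i) zero
        ≡⟨ cong (λ z → z + - P (suc i) zero) (ℤₚ.+-identityʳ (m * + 0)) ⟩
      m * + 0 + - P (suc i) zero ∎)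
      where
      lem : ∀ u d p m → u * + 0 + d ≡ m * + 0 + (d + p) + - p
      lem = solve-∀
    go (suc i) (suc j) = trans (column (suc i) (suc j)) (begin
      u i * u j + ∑ (λ k → S i k * S k j)
        ≡⟨ cong (λ z → u i * u j + z) (trans (S² i j) (cong (λ z → m * δ i j + - z) (gram i j))) ⟩
      u i * u j + (m * δ i j + - (u i * u j + P (suc i) (suc j)))
        ≡⟨ lem (u i * u j) (m * δ i j) (P (suc i) (suc j)) ⟩
      m * δ i j + - P (suc i) (suc j) ∎)
      where
      lem : ∀ u d p → u + (d + - (u + p)) ≡ d + - p
      lem = solve-∀

  dot-column : ∀ {n} {S : Matrix ℤ n} → (∀ i j → S i j ≡ S j i) → ∀ v j → ∑ (λ k → v k * S k j) ≡ dot (S j) v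
  dot-column {S = S} S-sym v j = trans (∑-cong λ k → cong (v k *_) (S-sym k j)) (dot-comm v (S j))

  -- Bordering by the three vectors one at a time; after each step the defect drops in rank by one.
  module Bordered {n} {S : Matrix ℤ n} (seidel : IsSymmetricSeidel n S) {τ : ℤ}
    (completion : Completion τ S (defect (+ 4 * τ + + 1) S)) where
    open Completion completion
    open ≡-Reasoning

    m : ℤ
    m = + 4 * τ + + 1

    -- The leading -1 is the off-diagonal entry of the corner I - J, which has to cancel S U = U (J
    -- - I).
    v₂ v₃ : Fin (suc n) → ℤ
    v₂ = cons (- (+ 1)) u₂
    v₃ = cons (- (+ 1)) u₃

    w : Fin (suc (suc n)) → ℤ
    w = cons (- (+ 1)) v₃

    S₁ : Matrix ℤ (suc n)
    S₁ = border S u₁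

    S₂ : Matrix ℤ (suc (suc n))
    S₂ = border S₁ v₂

    S₃ : Matrix ℤ (suc (suc (suc n)))
    S₃ = border S₂ w

    seidel₁ : IsSymmetricSeidel (suc n) S₁
    seidel₁ = border-seidel seidel ±u₁

    seidel₂ : IsSymmetricSeidel (suc (suc n)) S₂
    seidel₂ = border-seidel seidel₁ (cons-sign (inj₂ refl) ±u₂)

    seidel₃ : IsSymmetricSeidel (suc (suc (suc n))) S₃
    seidel₃ = border-seidel seidel₂ (cons-sign (inj₂ refl) (cons-sign (inj₂ refl) ±u₃))

    sym₁ = proj₂ (proj₂ seidel₁)
    sym₂ = proj₂ (proj₂ seidel₂)

    -- `S₁` interchanges `v₂` and `v₃`, so M₁ S₁ = K₁ and K₁ S₁ = M₁. Both vectors start with -1,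
    -- hence both corner entries are 2; this positive K₁ corner is the one that belongs to (x - 2)(x
    -- + 1)².
    M₁ K₁ : Matrix ℤ (suc n)
    M₁ i j = v₂ i * v₂ j + v₃ i * v₃ j
    K₁ i j = v₂ i * v₃ j + v₃ i * v₂ j

    M₂ : Matrix ℤ (suc (suc n))
    M₂ i j = w i * w j

    S₁v₂ : ∀ i → dot (S₁ i) v₂ ≡ v₃ i
    S₁v₂ zero    = trans (dot-cons (+ 0) (- (+ 1)) u₁ u₂) (cong (λ z → + 0 * - (+ 1) + z) u₁u₂)
    S₁v₂ (suc i) = trans (dot-cons (u₁ i) (- (+ 1)) (S i) u₂)
      (trans (cong (λ z → u₁ i * - (+ 1) + z) (Su₂ i)) (lem (u₁ i) (u₃ i)))
      where
      lem : ∀ a b → a * - (+ 1) + (a + b) ≡ b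
      lem = solve-∀

    S₁v₃ : ∀ i → dot (S₁ i) v₃ ≡ v₂ i
    S₁v₃ zero    = trans (dot-cons (+ 0) (- (+ 1)) u₁ u₃) (cong (λ z → + 0 * - (+ 1) + z) u₁u₃)
    S₁v₃ (suc i) = trans (dot-cons (u₁ i) (- (+ 1)) (S i) u₃)
      (trans (cong (λ z → u₁ i * - (+ 1) + z) (Su₃ i)) (lem (u₁ i) (u₂ i)))
      where
      lem : ∀ a b → a * - (+ 1) + (a + b) ≡ b
      lem = solve-∀

    v₂v₃ : dot v₂ v₃ ≡ + 0
    v₂v₃ = trans (dot-cons (- (+ 1)) (- (+ 1)) u₂ u₃) (cong (λ z → - (+ 1) * - (+ 1) + z) u₂u₃)

    S₂w : ∀ i → dot (S₂ i) w ≡ + 0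
    S₂w zero    = trans (dot-cons (+ 0) (- (+ 1)) v₂ v₃) (cong (λ z → + 0 * - (+ 1) + z) v₂v₃)
    S₂w (suc i) = trans (dot-cons (v₂ i) (- (+ 1)) (S₁ i) v₃)
      (trans (cong (λ z → v₂ i * - (+ 1) + z) (S₁v₃ i)) (lem (v₂ i)))
      where
      lem : ∀ a → a * - (+ 1) + a ≡ + 0
      lem = solve-∀

    square₀ : SquareDefect m S (defect m S)
    square₀ i j = lem (m * δ i j) (∑ (λ k → S i k * S k j))
      where
      lem : ∀ a b → b ≡ a + - (a + - b)
      lem = solve-∀

    square₁ : SquareDefect m S₁ M₁
    square₁ = border-square {P = M₁} (proj₂ (proj₂ seidel)) square₀
      (trans (cong (λ z → z + + 2) u₁u₁) (lem₁ τ))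
      (λ i → trans (cong (λ z → z + M₁ (suc i) zero) (Su₁ i)) (lem₂ (u₂ i) (u₃ i)))
      (λ i → lem₃ (u₂ i) (u₃ i))
      (λ i j → trans (gram i j) (ℤₚ.+-assoc (u₁ i * u₁ j) (u₂ i * u₂ j) (u₃ i * u₃ j)))
      where
      lem₁ : ∀ τ → + 4 * τ + - (+ 1) + + 2 ≡ + 4 * τ + + 1
      lem₁ = solve-∀
      lem₂ : ∀ a b → a + b + (a * - (+ 1) + b * - (+ 1)) ≡ + 0
      lem₂ = solve-∀
      lem₃ : ∀ a b → - (+ 1) * a + - (+ 1) * b ≡ a * - (+ 1) + b * - (+ 1)
      lem₃ = solve-∀

    square₂ : SquareDefect m S₂ M₂
    square₂ = border-square {P = M₂} sym₁ square₁
      (trans (cong (λ z → z + + 1) (trans (dot-cons (- (+ 1)) (- (+ 1)) u₂ u₂) (cong (λ z → - (+ 1) * - (+ 1) + z) u₂u₂))) (lem₁ τ))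
      (λ i → trans (cong (λ z → z + v₃ i * - (+ 1)) (S₁v₂ i)) (lem₂ (v₃ i)))
      (λ i → ℤₚ.*-comm (- (+ 1)) (v₃ i))
      (λ i j → refl)
      where
      lem₁ : ∀ τ → + 1 + (+ 4 * τ + - (+ 1)) + + 1 ≡ + 4 * τ + + 1
      lem₁ = solve-∀
      lem₂ : ∀ a → a + a * - (+ 1) ≡ + 0
      lem₂ = solve-∀

    square₃ : SquareDefect m S₃ (λ _ _ → + 0)
    square₃ = border-square {P = λ _ _ → + 0} sym₂ square₂
      (trans (cong (λ z → z + + 0) (trans (dot-cons (- (+ 1)) (- (+ 1)) v₃ v₃)
        (cong (λ z → - (+ 1) * - (+ 1) + z) (trans (dot-cons (- (+ 1)) (- (+ 1)) u₃ u₃) (cong (λ z → - (+ 1) * - (+ 1) + z) u₃u₃))))) (lem τ))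
      (λ i → trans (ℤₚ.+-identityʳ _) (S₂w i))
      (λ i → refl)
      (λ i j → sym (ℤₚ.+-identityʳ _))
      where
      lem : ∀ τ → + 1 + (+ 1 + (+ 4 * τ + - (+ 1))) + + 0 ≡ + 4 * τ + + 1
      lem = solve-∀

    ann₁ : Annihilated m (+ 0) (+ 1) S₁ M₁ K₁
    ann₁ = record
      { square = square₁
      ; M*S = λ i j → trans (dot-linearˡ (v₂ i) (v₃ i) v₂ v₃ (λ k → S₁ k j))
          (cong₂ (λ a b → v₂ i * a + v₃ i * b) (trans (dot-column sym₁ v₂ j) (S₁v₂ j)) (trans (dot-column sym₁ v₃ j) (S₁v₃ j)))
      ; K*S = λ i j → trans (dot-linearˡ (v₂ i) (v₃ i) v₃ v₂ (λ k → S₁ k j))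
          (trans (cong₂ (λ a b → v₂ i * a + v₃ i * b) (trans (dot-column sym₁ v₃ j) (S₁v₃ j)) (trans (dot-column sym₁ v₂ j) (S₁v₂ j)))
            (lem (K₁ i j) (M₁ i j))) }
      where
      lem : ∀ k m → m ≡ + 0 * k + + 1 * m
      lem = solve-∀

    ann₂ : Annihilated m (+ 0) (+ 0) S₂ M₂ (λ _ _ → + 0)
    ann₂ = record
      { square = square₂
      ; M*S = λ i j → trans (∑-cong λ k → ℤₚ.*-assoc (w i) (w k) (S₂ k j)) (trans (sym (*-∑ (w i) (λ k → w k * S₂ k j)))
          (trans (cong (w i *_) (trans (dot-column sym₂ w j) (S₂w j))) (ℤₚ.*-zeroʳ (w i))))
      ; K*S = λ i j → ∑-0 λ k → refl }

    ann₃ : Annihilated m (+ 0) (+ 0) S₃ (λ _ _ → + 0) (λ _ _ → + 0)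
    ann₃ = record { square = square₃ ; M*S = λ i j → ∑-0 λ k → refl ; K*S = λ i j → ∑-0 λ k → refl }

open SeidelMatrices

-- The four polynomials and the relations between neighbours.

linear : ℤ → Poly
linear a = X ⊕ C a

linear-regular : ∀ a → a ≢ + 0 → Regular (linear a)
linear-regular a a≢0 = regular-coeff₀ (linear a) λ e → a≢0 (begin
  a                         ≡⟨ coeff₀-C a ⟨
  coeff (C a) 0             ≡⟨ ℤₚ.+-identityˡ _ ⟨
  + 0 + coeff (C a) 0       ≡⟨ cong (λ z → z + coeff (C a) 0) (trans (sym (at (*-identityʳ X) 0)) (at (X⊗ (C (+ 1))) 0)) ⟨
  coeff X 0 + coeff (C a) 0 ≡⟨ coeff-⊕ X (C a) 0 ⟨
  coeff (linear a) 0        ≡⟨ e ⟩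
  + 0                       ∎)
  where open ≡-Reasoning

D-linear : ∀ a → D (linear a) ≋ C (+ 1)
D-linear a = ≋-trans (D-+ X (C a)) (≋-trans (+-cong D-X (D-C a)) (+-identityʳ (C (+ 1))))

cubicD : Poly
cubicD = linear (- (+ 2)) ⊗ (linear (+ 1) ⊗ linear (+ 1))

cubicD-regular : Regular cubicD
cubicD-regular = regular-* (linear-regular (- (+ 2)) λ ()) (regular-* (linear-regular (+ 1) λ ()) (linear-regular (+ 1) λ ()))

module _ (m : ℤ) where
  private Q = quad m

  -- At k = 2(t - 1) the exponents are 2t + 1, 2t, 2t - 1 and 2(t - 1), expressed without truncated
  -- subtraction.
  formA formB formC formD : ℕ → Poly
  formA k = Q ^ (3 ℕ.+ k)
  formB k = X ⊗ Q ^ (2 ℕ.+ k)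
  formC k = quad (+ 1) ⊗ Q ^ (1 ℕ.+ k)
  formD k = cubicD ⊗ Q ^ k

module Steps {m : ℤ} (m≢0 : m ≢ + 0) (k : ℕ) where
  open SetoidReasoning setoid
  private
    Q = quad m
    Q-regular = quad-regular m m≢0

  -- With g = x² and K₀₀ = 0 the deletion formula reads x² Q p′ = p (x³ - μ x); one factor x is
  -- cancelled.
  dropFirst-X : ∀ {n} {S M K : Matrix ℤ (suc n)} → Annihilated m (+ 0) (+ 0) S M K → S zero zero ≡ + 0 →
    K zero zero ≡ + 0 → ∀ {μ} → M zero zero ≡ μ →
    X ⊗ Q ⊗ charPoly n (dropFirst S) ≋ charPoly (suc n) S ⊗ quad μ
  dropFirst-X {n} {S} {M} {K} ann S₀₀ K₀₀ {μ} M₀₀ = cancel regular-X (begin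
    X ⊗ (X ⊗ Q ⊗ p′)
      ≈⟨ solve 3 (λ x q p → x :* (x :* q :* p) := (x :* x :- con (+ 0) :* x :- con (+ 0)) :* q :* p) ≋-refl X Q p′ ⟩
    cofactor (+ 0) (+ 0) ⊗ Q ⊗ p′
      ≈⟨ charPoly-dropFirst ann S₀₀ ⟩
    p ⊗ (cofactor (+ 0) (+ 0) ⊗ X ⊕ ⊖ ((X ⊕ ⊖ C (+ 0)) ⊗ C (M zero zero)) ⊕ ⊖ C (K zero zero))
      ≡⟨ cong₂ (λ a b → p ⊗ (cofactor (+ 0) (+ 0) ⊗ X ⊕ ⊖ ((X ⊕ ⊖ C (+ 0)) ⊗ C a) ⊕ ⊖ C b)) M₀₀ K₀₀ ⟩
    p ⊗ (cofactor (+ 0) (+ 0) ⊗ X ⊕ ⊖ ((X ⊕ ⊖ C (+ 0)) ⊗ C μ) ⊕ ⊖ C (+ 0))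
      ≈⟨ solve 3 (λ x p μ → p :* ((x :* x :- con (+ 0) :* x :- con (+ 0)) :* x :- (x :- con (+ 0)) :* μ :- con (+ 0))
           := x :* (p :* (x :* x :- μ))) ≋-refl X p (C μ) ⟩
    X ⊗ (p ⊗ quad μ) ∎)
    where
    p = charPoly (suc n) S
    p′ = charPoly n (dropFirst S)

  dropFirst-D : ∀ {n} {S M K : Matrix ℤ (suc n)} → Annihilated m (+ 0) (+ 1) S M K → S zero zero ≡ + 0 →
    M zero zero ≡ + 2 → K zero zero ≡ + 2 →
    quad (+ 1) ⊗ Q ⊗ charPoly n (dropFirst S) ≋ charPoly (suc n) S ⊗ cubicD
  dropFirst-D {n} {S} {M} {K} ann S₀₀ M₀₀ K₀₀ = begin
    quad (+ 1) ⊗ Q ⊗ p′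
      ≈⟨ solve 3 (λ x q p → (x :* x :- con (+ 1)) :* q :* p := (x :* x :- con (+ 0) :* x :- con (+ 1)) :* q :* p) ≋-refl X Q p′ ⟩
    cofactor (+ 0) (+ 1) ⊗ Q ⊗ p′
      ≈⟨ charPoly-dropFirst ann S₀₀ ⟩
    p ⊗ (cofactor (+ 0) (+ 1) ⊗ X ⊕ ⊖ ((X ⊕ ⊖ C (+ 0)) ⊗ C (M zero zero)) ⊕ ⊖ C (K zero zero))
      ≡⟨ cong₂ (λ a b → p ⊗ (cofactor (+ 0) (+ 1) ⊗ X ⊕ ⊖ ((X ⊕ ⊖ C (+ 0)) ⊗ C a) ⊕ ⊖ C b)) M₀₀ K₀₀ ⟩
    p ⊗ (cofactor (+ 0) (+ 1) ⊗ X ⊕ ⊖ ((X ⊕ ⊖ C (+ 0)) ⊗ C (+ 2)) ⊕ ⊖ C (+ 2))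
      -- (x² - 1) x - 2x - 2 = x³ - 3x - 2 = (x - 2)(x + 1)². The value K₀₀ = -2 would give (x +
      -- 2)(x - 1)² instead.
      ≈⟨ solve 2 (λ x p → p :* ((x :* x :- con (+ 0) :* x :- con (+ 1)) :* x :- (x :- con (+ 0)) :* con (+ 2) :- con (+ 2))
           := p :* ((x :+ con (- (+ 2))) :* ((x :+ con (+ 1)) :* (x :+ con (+ 1))))) ≋-refl X p ⟩
    p ⊗ cubicD ∎
    where
    p = charPoly (suc n) S
    p′ = charPoly n (dropFirst S)

  quad-0-regular : Regular (quad (+ 0))
  quad-0-regular s e = regular-* regular-X regular-X s (≋-trans
    (solve 2 (λ x s → x :* x :* s := (x :* x :- con (+ 0)) :* s) ≋-refl X s) e)

  -- This and the next five lemmas solve a deletion relation for one polynomial given the other: for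
  -- the smaller matrix after a deletion, for the larger one after a bordering.
  formA⇒B : ∀ {p p′} → X ⊗ Q ⊗ p′ ≋ p ⊗ quad (+ 0) → p ≋ formA m k → p′ ≋ formB m k
  formA⇒B {p} {p′} e f = cancel (regular-* regular-X Q-regular) (begin
    X ⊗ Q ⊗ p′                        ≈⟨ e ⟩
    p ⊗ quad (+ 0)                    ≈⟨ *-congʳ f ⟩
    Q ⊗ Q ^ (2 ℕ.+ k) ⊗ quad (+ 0)    ≈⟨ solve 3 (λ x q s → q :* s :* (x :* x :- con (+ 0)) := x :* q :* (x :* s)) ≋-refl X Q (Q ^ (2 ℕ.+ k)) ⟩
    X ⊗ Q ⊗ (X ⊗ Q ^ (2 ℕ.+ k))       ∎)

  formB⇒A : ∀ {p p′} → X ⊗ Q ⊗ p′ ≋ p ⊗ quad (+ 0) → p′ ≋ formB m k → p ≋ formA m k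
  formB⇒A {p} {p′} e f = cancel quad-0-regular (begin
    quad (+ 0) ⊗ p                    ≈⟨ *-comm _ p ⟩
    p ⊗ quad (+ 0)                    ≈⟨ e ⟨
    X ⊗ Q ⊗ p′                        ≈⟨ *-congˡ f ⟩
    X ⊗ Q ⊗ (X ⊗ Q ^ (2 ℕ.+ k))       ≈⟨ solve 3 (λ x q s → x :* q :* (x :* s) := (x :* x :- con (+ 0)) :* (q :* s)) ≋-refl X Q (Q ^ (2 ℕ.+ k)) ⟩
    quad (+ 0) ⊗ formA m k            ∎)

  formB⇒C : ∀ {p p′} → X ⊗ Q ⊗ p′ ≋ p ⊗ quad (+ 1) → p ≋ formB m k → p′ ≋ formC m k
  formB⇒C {p} {p′} e f = cancel (regular-* regular-X Q-regular) (begin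
    X ⊗ Q ⊗ p′                              ≈⟨ e ⟩
    p ⊗ quad (+ 1)                          ≈⟨ *-congʳ f ⟩
    X ⊗ (Q ⊗ Q ^ (1 ℕ.+ k)) ⊗ quad (+ 1)    ≈⟨ solve 4 (λ x q s d → x :* (q :* s) :* d := x :* q :* (d :* s)) ≋-refl X Q (Q ^ (1 ℕ.+ k)) (quad (+ 1)) ⟩
    X ⊗ Q ⊗ (quad (+ 1) ⊗ Q ^ (1 ℕ.+ k))    ∎)

  formC⇒B : ∀ {p p′} → X ⊗ Q ⊗ p′ ≋ p ⊗ quad (+ 1) → p′ ≋ formC m k → p ≋ formB m k
  formC⇒B {p} {p′} e f = cancel (quad-regular (+ 1) λ ()) (begin
    quad (+ 1) ⊗ p                          ≈⟨ *-comm _ p ⟩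
    p ⊗ quad (+ 1)                          ≈⟨ e ⟨
    X ⊗ Q ⊗ p′                              ≈⟨ *-congˡ f ⟩
    X ⊗ Q ⊗ (quad (+ 1) ⊗ Q ^ (1 ℕ.+ k))    ≈⟨ solve 4 (λ x q s d → x :* q :* (d :* s) := d :* (x :* (q :* s))) ≋-refl X Q (Q ^ (1 ℕ.+ k)) (quad (+ 1)) ⟩
    quad (+ 1) ⊗ formB m k                  ∎)

  formC⇒D : ∀ {p p′} → quad (+ 1) ⊗ Q ⊗ p′ ≋ p ⊗ cubicD → p ≋ formC m k → p′ ≋ formD m k
  formC⇒D {p} {p′} e f = cancel (regular-* (quad-regular (+ 1) λ ()) Q-regular) (begin
    quad (+ 1) ⊗ Q ⊗ p′                     ≈⟨ e ⟩
    p ⊗ cubicD                              ≈⟨ *-congʳ f ⟩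
    quad (+ 1) ⊗ (Q ⊗ Q ^ k) ⊗ cubicD       ≈⟨ solve 4 (λ u q s d → u :* (q :* s) :* d := u :* q :* (d :* s)) ≋-refl (quad (+ 1)) Q (Q ^ k) cubicD ⟩
    quad (+ 1) ⊗ Q ⊗ (cubicD ⊗ Q ^ k)       ∎)

  formD⇒C : ∀ {p p′} → quad (+ 1) ⊗ Q ⊗ p′ ≋ p ⊗ cubicD → p′ ≋ formD m k → p ≋ formC m k
  formD⇒C {p} {p′} e f = cancel cubicD-regular (begin
    cubicD ⊗ p                              ≈⟨ *-comm _ p ⟩
    p ⊗ cubicD                              ≈⟨ e ⟨
    quad (+ 1) ⊗ Q ⊗ p′                     ≈⟨ *-congˡ f ⟩
    quad (+ 1) ⊗ Q ⊗ (cubicD ⊗ Q ^ k)       ≈⟨ solve 4 (λ u q s d → u :* q :* (d :* s) := d :* (u :* (q :* s))) ≋-refl (quad (+ 1)) Q (Q ^ k) cubicD ⟩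
    cubicD ⊗ formC m k                      ∎)

unit-regular : Regular (C (+ 1))
unit-regular s e = ≋-trans (≋-sym (*-identityˡ s)) e

unit-derivative : cofactor (+ 0) (+ 0) ⊗ D (C (+ 1)) ≋ C (+ 1) ⊗ (C (+ 0) ⊗ X ⊕ C (+ 0))
unit-derivative = ≋-trans (*-congˡ (≋-trans (D-C (+ 1)) (≋-sym C-0)))
  (solve 2 (λ g x → g :* con (+ 0) := con (+ 1) :* (con (+ 0) :* x :+ con (+ 0))) ≋-refl (cofactor (+ 0) (+ 0)) X)

X-multiple : X ⊗ (X ⊗ (X ⊗ X)) ≋ cofactor (+ 0) (+ 0) ⊗ cofactor (+ 0) (+ 0)
X-multiple = solve 1 (λ x → x :* (x :* (x :* x))
  := (x :* x :- con (+ 0) :* x :- con (+ 0)) :* (x :* x :- con (+ 0) :* x :- con (+ 0))) ≋-refl X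

X-derivative : cofactor (+ 0) (+ 0) ⊗ D X ≋ X ⊗ (C (+ 1) ⊗ X ⊕ C (+ 0))
X-derivative = ≋-trans (*-congˡ D-X) (solve 1 (λ x → (x :* x :- con (+ 0) :* x :- con (+ 0)) :* con (+ 1)
  := x :* (con (+ 1) :* x :+ con (+ 0))) ≋-refl X)

quad₁-regular : Regular (quad (+ 1))
quad₁-regular = quad-regular (+ 1) λ ()

quad₁-multiple : quad (+ 1) ⊗ quad (+ 1) ≋ cofactor (+ 0) (+ 1) ⊗ cofactor (+ 0) (+ 1)
quad₁-multiple = solve 1 (λ x → (x :* x :- con (+ 1)) :* (x :* x :- con (+ 1))
  := (x :* x :- con (+ 0) :* x :- con (+ 1)) :* (x :* x :- con (+ 0) :* x :- con (+ 1))) ≋-refl X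

quad₁-derivative : cofactor (+ 0) (+ 1) ⊗ D (quad (+ 1)) ≋ quad (+ 1) ⊗ (C (+ 2) ⊗ X ⊕ C (+ 0))
quad₁-derivative = ≋-trans (*-congˡ (D-quad (+ 1))) (solve 1 (λ x →
  (x :* x :- con (+ 0) :* x :- con (+ 1)) :* (con (+ 2) :* x)
  := (x :* x :- con (+ 1)) :* (con (+ 2) :* x :+ con (+ 0))) ≋-refl X)

cubicD-multiple : cubicD ⊗ linear (- (+ 2)) ≋ cofactor (+ 1) (+ 2) ⊗ cofactor (+ 1) (+ 2)
cubicD-multiple = solve 1 (λ x → (x :+ con (- (+ 2))) :* ((x :+ con (+ 1)) :* (x :+ con (+ 1))) :* (x :+ con (- (+ 2)))
  := (x :* x :- con (+ 1) :* x :- con (+ 2)) :* (x :* x :- con (+ 1) :* x :- con (+ 2))) ≋-refl X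

-- g u′ / u for g = (x - 2)(x + 1) and u = (x - 2)(x + 1)²: (x + 1) + 2 (x - 2) = 3x - 3.
cubicD-derivative : cofactor (+ 1) (+ 2) ⊗ D cubicD ≋ cubicD ⊗ (C (+ 3) ⊗ X ⊕ C (- (+ 3)))
cubicD-derivative = ≋-trans
  (*-congˡ (≋-trans (D-* (linear (- (+ 2))) (linear (+ 1) ⊗ linear (+ 1)))
    (+-cong (*-congʳ (D-linear (- (+ 2))))
      (*-congˡ (≋-trans (D-* (linear (+ 1)) (linear (+ 1))) (+-cong (*-congʳ (D-linear (+ 1))) (*-congˡ (D-linear (+ 1)))))))))
  (solve 1 (λ x → let a = x :+ con (- (+ 2)) ; b = x :+ con (+ 1) in
      (x :* x :- con (+ 1) :* x :- con (+ 2)) :* (con (+ 1) :* (b :* b) :+ a :* (con (+ 1) :* b :+ b :* con (+ 1)))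
      := a :* (b :* b) :* (con (+ 3) :* x :+ con (- (+ 3)))) ≋-refl X)

-- The cycle of implications (a) ⇒ (b) ⇒ (c) ⇒ (d) ⇒ (a).

HasSeidel : Poly → Set
HasSeidel p = ∃ λ n → ∃ λ (S : Matrix ℤ n) → IsSymmetricSeidel n S × (charPoly n S ≋ p)

dropFirst-seidel : ∀ {n} {S : Matrix ℤ (suc n)} → IsSymmetricSeidel (suc n) S → IsSymmetricSeidel n (dropFirst S)
dropFirst-seidel (S₀ , S± , S-sym) =
  (λ i → S₀ (suc i)) , (λ i j ne → S± (suc i) (suc j) λ { refl → ne refl }) , (λ i j → S-sym (suc i) (suc j))

defect-corner : ∀ m {n} {S : Matrix ℤ (suc n)} → IsSymmetricSeidel (suc n) S → ∀ {N} → + suc n ≡ N →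
  defect m S zero zero ≡ m + - (N + - (+ 1))
defect-corner m seidel e = trans (Seidel.defect-diagonal seidel m zero) (cong (λ N → m + - (N + - (+ 1))) e)

-- With e = c = 0 the matrix K = M S satisfies K² = 0, and K is symmetric.
K≡0 : ∀ {m n} {S M K : Matrix ℤ n} → Annihilated m (+ 0) (+ 0) S M K → (∀ i j → S i j ≡ S j i) →
  (∀ i j → M i j ≡ M j i) → ∀ i j → K i j ≡ + 0
K≡0 {m} {M = M} {K} ann S-sym M-sym i = ∑²≡0⇒≡0 (K i) (trans (Products.dot-KK ann S-sym M-sym i i) (lem m (K i i) (M i i)))
  where
  lem : ∀ m k x → (m + - (+ 0 * + 0 + + 0)) * (+ 0 * k + + 0 * x) + - (+ 0 * + 0) * k ≡ + 0
  lem = solve-∀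

-- Keeping τ abstract stops the type checker from normalising arithmetic in + suc t′.
module Equivalences (t′ : ℕ) (τ : ℤ) (τ≡ : τ ≡ + suc t′) where
  open SetoidReasoning setoid

  m : ℤ
  m = + 4 * τ + + 1

  k : ℕ
  k = 2 ℕ.* t′

  τ≥1 : + 1 ≤ τ
  τ≥1 = subst (+ 1 ≤_) (sym τ≡) (+≤+ (s≤s z≤n))

  m≢0 : m ≢ + 0
  m≢0 e = absurd (trans (cong (λ τ → + 4 * τ + + 1) (sym τ≡)) e)
    where
    absurd : + 4 * + suc t′ + + 1 ≢ + 0
    absurd ()

  open Steps {m} m≢0 k

  2k : ∀ a → + (2 ℕ.* (a ℕ.+ k)) ≡ + 2 * (+ a + + 2 * (τ + - (+ 1)))
  2k a = trans (ℤₚ.pos-* 2 (a ℕ.+ k)) (cong (λ z → + 2 * (+ a + z)) (trans (ℤₚ.pos-* 2 t′)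
    (cong (λ τ → + 2 * (τ + - (+ 1))) (sym τ≡))))

  -- Here u = 1 and the order is 4τ + 2, so M₀₀ = m - (n - 1) = 0 and the deletion relation has μ =
  -- 0.
  A⇒B : HasSeidel (formA m k) → HasSeidel (formB m k)
  A⇒B (n , S , seidel , e) = split n refl
    where
    open Seidel seidel
    module Spec = Spectrum {m} {+ 0} {+ 0} m≢0 {C (+ 1)} {cofactor (+ 0) (+ 0) ⊗ cofactor (+ 0) (+ 0)} {+ 0} {+ 0}
      unit-regular (*-identityˡ _) unit-derivative (3 ℕ.+ k) S S₀ S-sym (≋-trans e (≋-sym (*-identityˡ _)))
    order : + n ≡ + 4 * τ + + 2
    order = trans Spec.order (trans (cong (λ z → + 0 + z) (2k 3)) (lem τ))
      where
      lem : ∀ τ → + 0 + + 2 * (+ 3 + + 2 * (τ + - (+ 1))) ≡ + 4 * τ + + 2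
      lem = solve-∀
    split : ∀ n′ → n ≡ n′ → HasSeidel (formB m k)
    split zero refl = ⊥-elim (absurd (trans order (cong (λ τ → + 4 * τ + + 2) τ≡)))
      where
      absurd : + 0 ≢ + 4 * + suc t′ + + 2
      absurd ()
    split (suc n) refl = n , dropFirst S , dropFirst-seidel seidel , formA⇒B (dropFirst-X Spec.ann (S₀ zero)
      (K≡0 Spec.ann S-sym (defect-sym m) zero zero)
      (trans (defect-corner m seidel order) (lem τ))) e
      where
      lem : ∀ τ → + 4 * τ + + 1 + - (+ 4 * τ + + 2 + - (+ 1)) ≡ + 0
      lem = solve-∀

  -- Here u = x and the order is 4τ + 1, so M₀₀ = 1 and the deletion produces the factor x² - 1.
  B⇒C : HasSeidel (formB m k) → HasSeidel (formC m k)
  B⇒C (n , S , seidel , e) = split n refl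
    where
    open Seidel seidel
    module Spec = Spectrum {m} {+ 0} {+ 0} m≢0 {X} {X ⊗ (X ⊗ X)} {+ 1} {+ 0}
      regular-X X-multiple X-derivative (2 ℕ.+ k) S S₀ S-sym e
    order : + n ≡ + 4 * τ + + 1
    order = trans Spec.order (trans (cong (λ z → + 1 + z) (2k 2)) (lem τ))
      where
      lem : ∀ τ → + 1 + + 2 * (+ 2 + + 2 * (τ + - (+ 1))) ≡ + 4 * τ + + 1
      lem = solve-∀
    split : ∀ n′ → n ≡ n′ → HasSeidel (formC m k)
    split zero refl = ⊥-elim (m≢0 (sym order))
    split (suc n) refl = n , dropFirst S , dropFirst-seidel seidel , formB⇒C (dropFirst-X Spec.ann (S₀ zero)
      (K≡0 Spec.ann S-sym (defect-sym m) zero zero)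
      (trans (defect-corner m seidel order) (lem τ))) e
      where
      lem : ∀ τ → + 4 * τ + + 1 + - (+ 4 * τ + + 1 + - (+ 1)) ≡ + 1
      lem = solve-∀

  module SpectrumC {n} {S : Matrix ℤ n} (seidel : IsSymmetricSeidel n S) (e : charPoly n S ≋ formC m k) where
    open Seidel seidel
    open Spectrum {m} {+ 0} {+ 1} m≢0 {quad (+ 1)} {quad (+ 1)} {+ 2} {+ 0}
      quad₁-regular quad₁-multiple quad₁-derivative (1 ℕ.+ k) S S₀ S-sym e public using (ann; order)

    order-4τ : + n ≡ + 4 * τ
    order-4τ = trans order (trans (cong (λ z → + 2 + z) (2k 1)) (lem τ))
      where
      lem : ∀ τ → + 2 + + 2 * (+ 1 + + 2 * (τ + - (+ 1))) ≡ + 4 * τ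
      lem = solve-∀

  reflect-quad : ∀ a → reflect (quad a) ≋ quad a
  reflect-quad a = ≋-trans (reflect-+ (X ⊗ X) (⊖ C a)) (≋-trans
    (+-cong (≋-trans (reflect-* X X) (*-cong reflect-X reflect-X)) (≋-trans (reflect-neg (C a)) (-‿cong (reflect-C a))))
    (solve 2 (λ x a → (:- x) :* (:- x) :- a := x :* x :- a) ≋-refl X (C a)))

  reflect-quad^ : ∀ a l → reflect (quad a ^ l) ≋ quad a ^ l
  reflect-quad^ a zero    = reflect-C (+ 1)
  reflect-quad^ a (suc l) = ≋-trans (reflect-* (quad a) (quad a ^ l)) (*-cong (reflect-quad a) (reflect-quad^ a l))

  neg-seidel : ∀ {n} {S : Matrix ℤ n} → IsSymmetricSeidel n S → IsSymmetricSeidel n (λ i j → - S i j)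
  neg-seidel (S₀ , S± , S-sym) = (λ i → cong -_ (S₀ i))
    , (λ i j ne → [ (λ e → inj₂ (cong -_ e)) , (λ e → inj₁ (cong -_ e)) ]′ (S± i j ne)) , (λ i j → cong -_ (S-sym i j))

  neg-K : ∀ {n} (S : Matrix ℤ n) i j →
    (defect m (λ i j → - S i j) · (λ i j → - S i j)) i j ≡ - (defect m S · S) i j
  neg-K S i j = trans (∑-cong λ l → trans
      (cong (λ z → (m * δ i l + - z) * - S l j) (∑-cong λ l′ → lem₁ (S i l′) (S l′ l)))
      (lem₂ (defect m S i l) (S l j)))
    (trans (sym (*-∑ (- (+ 1)) (λ l → defect m S i l * S l j))) (ℤₚ.-1*i≡-i _))
    where
    lem₁ : ∀ a b → - a * - b ≡ a * b
    lem₁ = solve-∀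
    lem₂ : ∀ a b → a * - b ≡ - (+ 1) * (a * b)
    lem₂ = solve-∀

  C⇒D-positive : ∀ {n} {S : Matrix ℤ (suc n)} → IsSymmetricSeidel (suc n) S → charPoly (suc n) S ≋ formC m k →
    (defect m S · S) zero zero ≡ + 2 → HasSeidel (formD m k)
  C⇒D-positive {n} {S} seidel e K₀₀ = n , dropFirst S , dropFirst-seidel seidel ,
    formC⇒D (dropFirst-D ann (proj₁ seidel zero) (trans (defect-corner m seidel order-4τ) (lem τ)) K₀₀) e
    where
    open SpectrumC seidel e
    lem : ∀ τ → + 4 * τ + + 1 + - (+ 4 * τ + - (+ 1)) ≡ + 2
    lem = solve-∀

  -- If K₀₀ = -2, pass to - S: the order is even and the polynomial in (c) is even in x, so the
  -- characteristic polynomial is unchanged, while K = (m I - S²) S changes sign.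
  C⇒D : HasSeidel (formC m k) → HasSeidel (formD m k)
  C⇒D (n , S , seidel , e) = split n refl
    where
    open SpectrumC seidel e
    split : ∀ n′ → n ≡ n′ → HasSeidel (formD m k)
    split zero refl = ⊥-elim (absurd (trans order-4τ (cong (+ 4 *_) τ≡)))
      where
      absurd : + 0 ≢ + 4 * + suc t′
      absurd ()
    split (suc n) refl = [ C⇒D-positive seidel e
      , (λ K₀₀ → C⇒D-positive (neg-seidel seidel)
          (≋-trans (charPoly-neg (2 ℕ.+ k) S n≡) (≋-trans (reflect-cong e) (≋-trans (reflect-* (quad (+ 1)) (quad m ^ (1 ℕ.+ k)))
            (*-cong (reflect-quad (+ 1)) (reflect-quad^ m (1 ℕ.+ k))))))
          (trans (neg-K S zero zero) (cong -_ K₀₀))) ]′ (corner-K τ seidel τ≥1 order-4τ ann)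
      where
      n≡ : suc n ≡ 2 ℕ.* (2 ℕ.+ k)
      n≡ = trans (ℤₚ.+-injective order) (sym (ℕₚ.*-suc 2 (1 ℕ.+ k)))

  restore : ∀ {n} {S : Matrix ℤ n} → IsSymmetricSeidel n S → Completion τ S (defect m S) →
    charPoly n S ≋ formD m k → HasSeidel (formA m k)
  restore seidel completion e = _ , S₃ , seidel₃ ,
    -- Deleting the first row and column of `S₃`, `S₂`, `S₁` returns the previous matrix by
    -- computation, and the corner values M₀₀ = 0, 1, 2 and K₀₀ = 0, 0, 2 also hold by `refl`.
    formB⇒A (dropFirst-X {S = S₃} ann₃ refl refl refl)
      (formC⇒B (dropFirst-X {S = S₂} ann₂ refl refl refl) (formD⇒C (dropFirst-D {S = S₁} ann₁ refl refl refl) e))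
    where open Bordered seidel completion hiding (m)

  D⇒A : HasSeidel (formD m k) → HasSeidel (formA m k)
  D⇒A (n , S , seidel , e) = restore seidel (Exceptional.completion seidel τ≥1 refl order Spec.ann trK) e
    where
    open Seidel seidel
    module Spec = Spectrum {m} {+ 1} {+ 2} m≢0 {cubicD} {linear (- (+ 2))} {+ 3} { - (+ 3)}
      cubicD-regular cubicD-multiple cubicD-derivative k S S₀ S-sym e
    order : + n ≡ + 4 * τ + - (+ 1)
    order = trans Spec.order (trans (cong (λ z → + 3 + z) (2k 0)) (lem τ))
      where
      lem : ∀ τ → + 3 + + 2 * (+ 0 + + 2 * (τ + - (+ 1))) ≡ + 4 * τ + - (+ 1)
      lem = solve-∀
    -- `trace-K` with e = 1 and ℓ₀ = -3 gives tr K = tr M - 3m, and tr M = 3n, so the value is 3 (n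
    -- - m) = 3 · (-2).
    trK : tr (defect m S · S) ≡ - (+ 6)
    trK = trans Spec.trace-K (trans (cong (λ z → + 1 * z + m * - (+ 3))
      (trans (∑-cong (defect-diagonal m)) (trans (∑-const n (m + - (+ n + - (+ 1)))) (cong (λ n → n * (m + - (n + - (+ 1)))) order))))
      (lem τ))
      where
      lem : ∀ τ → + 1 * ((+ 4 * τ + - (+ 1)) * (+ 4 * τ + + 1 + - (+ 4 * τ + - (+ 1) + - (+ 1)))) + (+ 4 * τ + + 1) * - (+ 3) ≡ - (+ 6)
      lem = solve-∀

  q≋ : q (suc t′) ≋ quad m
  q≋ = ≋-trans (reflexive (trans (⊕-def _ _) (cong₂ _⊕_ (trans (⊗-def Xₚ Xₚ) (cong₂ _⊗_ X-def X-def)) (C-def _))))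
    (+-congˡ (≋-trans (C-neg (+ (4 ℕ.* suc t′ ℕ.+ 1))) (-‿cong (reflexive (cong (λ z → C (z + + 1)) (trans (ℤₚ.pos-* 4 (suc t′)) (cong (+ 4 *_) (sym τ≡))))))))

  q^≋ : ∀ l → q (suc t′) ^ₚ l ≋ quad m ^ l
  q^≋ l = ≋-trans (reflexive (^ₚ-def (q (suc t′)) l)) (^-cong q≋ l)

  2t≡ : 2 ℕ.* suc t′ ≡ 2 ℕ.+ k
  2t≡ = ℕₚ.*-suc 2 t′

  polyA≋ : polyA (suc t′) ≋ formA m k
  polyA≋ = ≋-trans (q^≋ (2 ℕ.* suc t′ ℕ.+ 1)) (reflexive (cong (quad m ^_)
    (trans (ℕₚ.+-comm (2 ℕ.* suc t′) 1) (cong suc 2t≡))))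

  polyB≋ : polyB (suc t′) ≋ formB m k
  polyB≋ = ≋-trans (reflexive (trans (⊗-def Xₚ _) (cong (_⊗ (q (suc t′) ^ₚ (2 ℕ.* suc t′))) X-def)))
    (*-congˡ (≋-trans (q^≋ (2 ℕ.* suc t′)) (reflexive (cong (quad m ^_) 2t≡))))

  polyC≋ : polyC (suc t′) ≋ formC m k
  polyC≋ = ≋-trans (reflexive (⊗-def _ (q (suc t′) ^ₚ (2 ℕ.* suc t′ ℕ.∸ 1)))) (*-cong
    (≋-trans (reflexive (trans (⊕-def _ _) (cong₂ _⊕_ (trans (⊗-def Xₚ Xₚ) (cong₂ _⊗_ X-def X-def)) (C-def _)))) (+-congˡ (C-neg (+ 1))))
    (≋-trans (q^≋ (2 ℕ.* suc t′ ℕ.∸ 1)) (reflexive (cong (λ l → quad m ^ (l ℕ.∸ 1)) 2t≡))))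

  polyD≋ : polyD (suc t′) ≋ formD m k
  polyD≋ = ≋-trans (reflexive (⊗-def _ (q (suc t′) ^ₚ (2 ℕ.* t′)))) (*-cong
    (≋-trans (reflexive (⊗-def (Xₚ +ₚ constₚ (- (+ 2))) ((Xₚ +ₚ constₚ (+ 1)) ^ₚ 2)))
      (*-cong (lin (- (+ 2))) (≋-trans (reflexive (^ₚ-def (Xₚ +ₚ constₚ (+ 1)) 2))
        (≋-trans (^-cong (lin (+ 1)) 2) (*-congˡ (*-identityʳ (linear (+ 1))))))))
    (q^≋ (2 ℕ.* t′)))
    where
    lin : ∀ a → Xₚ +ₚ constₚ a ≋ linear a
    lin a = reflexive (trans (⊕-def Xₚ (constₚ a)) (cong₂ _⊕_ X-def (C-def a)))

  to : ∀ {p r} → p ≋ r → HasSymSeidelWithCharPoly p → HasSeidel r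
  to e (n , S , seidel , f) = n , S , seidel , ≋-trans (coeffwise f) e

  from : ∀ {p r} → p ≋ r → HasSeidel r → HasSymSeidelWithCharPoly p
  from e (n , S , seidel , f) = n , S , seidel , at (≋-trans f (≋-sym e))

theorem4p3 : (t : ℕ) → 1 ℕ.≤ t →
    (HasSymSeidelWithCharPoly (polyA t) ⇔ HasSymSeidelWithCharPoly (polyB t)) ×
    (HasSymSeidelWithCharPoly (polyA t) ⇔ HasSymSeidelWithCharPoly (polyC t)) ×
    (HasSymSeidelWithCharPoly (polyA t) ⇔ HasSymSeidelWithCharPoly (polyD t))
theorem4p3 (suc t′) (s≤s _) =
  -- Each converse runs round the rest of the cycle.
  mk⇔ (from polyB≋ ∘ A⇒B ∘ to polyA≋) (from polyA≋ ∘ D⇒A ∘ C⇒D ∘ B⇒C ∘ to polyB≋) ,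
  mk⇔ (from polyC≋ ∘ B⇒C ∘ A⇒B ∘ to polyA≋) (from polyA≋ ∘ D⇒A ∘ C⇒D ∘ to polyC≋) ,
  mk⇔ (from polyD≋ ∘ C⇒D ∘ B⇒C ∘ A⇒B ∘ to polyA≋) (from polyA≋ ∘ D⇒A ∘ to polyD≋)
  where open Equivalences t′ (+ suc t′) refl
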